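{- For $n\ge2$, the poset $NC^B(n-1,1)$ (ordered by reverse refinement) is a lattice. Its meet operation is the restriction of the meet in the lattice of all partitions of $X=\{\pm1,\dots,\pm n\}$: for $\pi,\rho\in NC^B(n-1,1)$, the blocks of $\pi\wedge\rho\in NC^B(n-1,1)$ are exactly the nonempty intersections $A\cap B$ with $A$ a block of $\pi$ and $B$ a block of $\rho$.
   Context: Here $p=n-1$, $q=1$, $X=\{1,\dots,n\}\cup\{ -1,\dots,-n\}$, and $\gamma=(1,\dots,n-1,-1,\dots,-(n-1))(n,-n)$. $B_n$ is the group of permutations $\tau$ of $X$ with $\tau(-i)=-\tau(i)$. For a permutation $\sigma$ of a finite set $S$, $\#(\sigma)$ is its number of orbits; $\#(\tau,\gamma)$ is the number of orbits of the group generated by $\tau,\gamma$. $\mathcal{S}_{nc}(S,\gamma)=\{\tau\mid \#(\tau)+\#(\tau^{ -1}\gamma)+\#(\gamma)=|S|+2\#(\tau,\gamma)\}$ and $\mathcal{S}^B_{nc}(n-1,1)=\mathcal{S}_{nc}(X,\gamma)\cap B_n$. For $\tau\in B_n$, $\Omega(\tau)$ is the partition of $X$ into orbits of $\tau$; $\widetilde{\Omega}(\tau)$ is obtained from $\Omega(\tau)$ by merging all blocks $A$ with $A=-A$ into one block. $NC^B(n-1,1)=\{\widetilde{\Omega}(\tau)\mid\tau\in\mathcal{S}^B_{nc}(n-1,1)\}$. Reverse refinement: $\pi\le\rho$ iff every block of $\rho$ is a union of blocks of $\pi$. -}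

module Defs where

open import Level using (0ℓ)
open import Data.Bool using (Bool; true; false; not)
open import Data.Nat as ℕ using (ℕ; zero; suc; _+_; _*_)
open import Data.Fin as Fin using (Fin; toℕ; fromℕ; lower₁)
open import Data.Product using (Σ; Σ-syntax; ∃; _×_; _,_)
open import Data.Sum using (_⊎_)
open import Function using (Surjective)
open import Function.Bundles using (_↔_; Inverse; _⇔_)
open import Relation.Binary using (Rel)
open import Relation.Binary.PropositionalEquality using (_≡_)
open import Relation.Binary.Construct.Closure.ReflexiveTransitive using (Star)
open import Relation.Binary.Construct.Closure.Symmetric using (SymClosure)
open import Relation.Nullary using (yes; no)

-- X = {±1,…,±n}: (true , i) stands for i+1, (false , i) for -(i+1).
X : ℕ → Set
X n = Bool × Fin n

neg : ∀ {n} → X n → X n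
neg (s , i) = (not s , i)

-- γ = (1,…,n-1,-1,…,-(n-1)) (n,-n)
γ : ∀ {n} → X n → X n
γ {zero} x = x
γ {suc m} (s , i) with toℕ i ℕ.≟ m
... | yes _ = (not s , i)
... | no i≠m with Fin.suc (lower₁ i (λ e → i≠m (Relation.Binary.PropositionalEquality.sym e))) Fin.≟ fromℕ m
...   | yes _ = (not s , Fin.zero) -- n-1 ↦ -1, -(n-1) ↦ 1
...   | no _  = (s , Fin.suc (lower₁ i (λ e → i≠m (Relation.Binary.PropositionalEquality.sym e))))

Graph : ∀ {A : Set} → (A → A) → Rel A 0ℓ
Graph f x y = y ≡ f x

Conn : ∀ {A : Set} → Rel A 0ℓ → Rel A 0ℓ
Conn R = Star (SymClosure R)

NumClasses : ∀ {A : Set} → Rel A 0ℓ → ℕ → Set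
NumClasses {A} R k =
  Σ[ c ∈ (A → Fin k) ] (Surjective _≡_ _≡_ c × (∀ x y → Conn R x y ⇔ (c x ≡ c y)))

-- #(σ) = k : number of orbits of a permutation (orbits of ⟨σ⟩ = classes of its graph)
NumOrbits : ∀ {A : Set} → (A → A) → ℕ → Set
NumOrbits σ k = NumClasses (Graph σ) k

-- #(σ,τ) = k : number of orbits of the group generated by σ and τ
NumOrbits₂ : ∀ {A : Set} → (A → A) → (A → A) → ℕ → Set
NumOrbits₂ σ τ k = NumClasses (λ x y → Graph σ x y ⊎ Graph τ x y) k

Perm : ℕ → Set
Perm n = X n ↔ X n

InB : ∀ {n} → Perm n → Set
InB τ = ∀ x → Inverse.to τ (neg x) ≡ neg (Inverse.to τ x)

-- τ ∈ S_nc(X,γ) with |X| = 2n; τ⁻¹γ is x ↦ τ⁻¹(γ x)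
InSnc : ∀ {n} → Perm n → Set
InSnc {n} τ = Σ[ a ∈ ℕ ] Σ[ b ∈ ℕ ] Σ[ c ∈ ℕ ] Σ[ d ∈ ℕ ]
  ( NumOrbits (Inverse.to τ) a
  × NumOrbits (λ x → Inverse.from τ (γ x)) b
  × NumOrbits (γ {n}) c
  × NumOrbits₂ (Inverse.to τ) (γ {n}) d
  × a + b + c ≡ 2 * n + 2 * d )

-- partitions of X are represented by their equivalence relations ("same block")
Partition : ℕ → Set₁
Partition n = Rel (X n) 0ℓ

Orb : ∀ {n} → Perm n → Partition n
Orb τ = Conn (Graph (Inverse.to τ))

SelfNeg : ∀ {n} → Perm n → X n → Set
SelfNeg τ x = ∀ y → Orb τ x y ⇔ Orb τ x (neg y)

Ωt : ∀ {n} → Perm n → Partition n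
Ωt τ x y = Orb τ x y ⊎ (SelfNeg τ x × SelfNeg τ y)

NCB : (n : ℕ) → Partition n → Set
NCB n π = Σ[ τ ∈ Perm n ] (InB τ × InSnc τ × (∀ x y → π x y ⇔ Ωt τ x y))

-- reverse refinement: every block of ρ is a union of blocks of π
_≤P_ : ∀ {n} → Partition n → Partition n → Set
π ≤P ρ = ∀ x y → π x y → ρ x y

_∧P_ : ∀ {n} → Partition n → Partition n → Partition n
(π ∧P ρ) x y = π x y × ρ x y

IsMeetIn : (n : ℕ) → Partition n → Partition n → Partition n → Set₁
IsMeetIn n π ρ μ = NCB n μ × μ ≤P π × μ ≤P ρ
  × (∀ σ → NCB n σ → σ ≤P π → σ ≤P ρ → σ ≤P μ)

IsJoinIn : (n : ℕ) → Partition n → Partition n → Partition n → Set₁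
IsJoinIn n π ρ j = NCB n j × π ≤P j × ρ ≤P j
  × (∀ σ → NCB n σ → π ≤P σ → ρ ≤P σ → j ≤P σ)

{-# OPTIONS --safe #-}
-- Call τ geodesic if #(τ) + #(τ⁻¹γ) = 2n + #(γ). A transposition merges or splits cycles, so by induction
-- on τ⁻¹γ one has ≤ for every τ, and the geodesic τ are exactly the permutations reached from γ by
-- splitting cycles. Hence they correspond to the partitions E into noncrossing classes inside the cycles
-- of γ, τ moving each point to the next one of its class.
-- If τ ∈ S^B_nc(n-1,1) maps n to ±n, then τ is geodesic and Ω̃(τ) merges the zero blocks of E. Otherwise put
-- z = τ(n); then (-z n)(z -n) τ is geodesic with z in its outer zero block, and the blocks of τ are those of
-- this E except that the zero block together with {n , -n} is cut into two opposite halves, z being the first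
-- outer point of the half containing n.
-- Intersecting two such partitions gives another one: at most two half circles are involved, and they meet
-- in an arc and its antipode. Finally, joins exist because there are finitely many candidates, meets and a top.

module Submission where

open import Defs
open import Level using (Level; 0ℓ)
open import Data.Bool using (Bool; true; false; not; _xor_)
import Data.Bool.Properties as Bool
open import Data.Nat using (ℕ; zero; suc; _+_; _*_; _∸_; _≤_; _<_; _≤?_; _<?_; z≤n; s≤s; s≤s⁻¹)
import Data.Nat.Properties as ℕ
open import Data.Fin as Fin using (Fin; toℕ; fromℕ; lower₁; punchOut; punchIn)
import Data.Fin.Properties as Fin
open import Data.Product using (Σ-syntax; ∃; ∃-syntax; ∃₂; _×_; _,_; proj₁; proj₂)
open import Data.Sum using (_⊎_; inj₁; inj₂; [_,_]′)
open import Data.List using (List; []; _∷_; map; allFin; cartesianProduct)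
open import Data.List.Relation.Unary.Any using (here; there)
open import Data.List.Membership.Propositional using (_∈_)
open import Data.List.Membership.Propositional.Properties using (∈-map⁺; ∈-map⁻; ∈-allFin; ∈-cartesianProduct⁺)
open import Function using (_∘_; id; Surjective; Injective)
open import Function.Bundles using (_↔_; Inverse; _⇔_; Equivalence; mk⇔; mk↔ₛ′)
open import Relation.Binary using (Rel; _⇒_; IsEquivalence; DecidableEquality; tri<; tri≈; tri>)
open import Relation.Binary.PropositionalEquality using (_≡_; _≢_; refl; sym; trans; cong; cong₂; subst; subst₂; _≗_)
import Relation.Binary.PropositionalEquality as ≡
open import Relation.Binary.Construct.Closure.ReflexiveTransitive using (ε; _◅_; _◅◅_)
open import Relation.Binary.Construct.Closure.Symmetric using (fwd; bwd)
import Relation.Binary.Construct.Closure.Equivalence as Eqv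
open import Relation.Nullary using (¬_; Dec; yes; no; does; contradiction)
open import Relation.Nullary.Decidable using (map′; _×-dec_; _⊎-dec_; _→-dec_; ¬?; decidable-stable; dec-true; toWitness)
open import Data.Product.Function.NonDependent.Propositional using (_×-↔_)
open import Function.Properties.Inverse using (↔-refl; ↔-sym; ↔-trans)
open import Data.Unit using (⊤; tt)
open import Data.Fin.Subset using (Subset)
open import Data.Fin.Subset.Properties using (anySubset?)
open import Data.Vec using (lookup; tabulate)
open import Data.Vec.Properties using (lookup∘tabulate)

open Inverse using (to; from; strictlyInverseˡ; strictlyInverseʳ)

-- If τ moves n to an outer point, τ and γ generate a transitive group and the defining equation
-- reads #(τ) + #(τ⁻¹γ) = 2n, two short of geodesic. The product (-z n)(z -n) repairs exactly this:
-- it commutes with negation, keeps the number of cycles of τ and changes that of τ⁻¹γ by two. So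
-- only noncrossing relations inside the two cycles of γ are ever analysed. A cut is recorded by a
-- sign and a position that need not belong to the zero block, because an intersection shrinks the
-- zero block and may lose the point where the cut began. When two cut partitions are intersected,
-- the zero points at which the two cuts agree stay attached to n or -n and form the new zero block,
-- which is cut again; the points at which they disagree lie in two opposite arcs and are separated
-- for good. Partitions are arbitrary relations and membership quantifies over permutations, so
-- nothing is decidable at the outset. The description by a decidable noncrossing relation and a cut
-- supplies both decidability and the finite search behind joins.

_⇔′_ : ∀ {A : Set} → Rel A 0ℓ → Rel A 0ℓ → Set
E ⇔′ F = ∀ x y → E x y ⇔ F x y

⇒to : {P Q : Set} → P ⇔ Q → P → Q
⇒to = Equivalence.to

⇒from : {P Q : Set} → P ⇔ Q → Q → P
⇒from = Equivalence.from

-- Counting classes of relations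

Classes : ∀ {A : Set} → Rel A 0ℓ → ℕ → Set
Classes {A} E k = Σ[ c ∈ (A → Fin k) ] (Surjective _≡_ _≡_ c × (∀ x y → E x y ⇔ (c x ≡ c y)))

module _ {A : Set} where

  classes-resp : {E F : Rel A 0ℓ} {k : ℕ} → E ⇒ F → F ⇒ E → Classes E k → Classes F k
  classes-resp E⇒F F⇒E (c , surj , ker) =
    c , surj , λ x y → mk⇔ (⇒to (ker x y) ∘ F⇒E) (E⇒F ∘ ⇒from (ker x y))

  -- Representatives of the coarser classes have pairwise distinct finer colours.
  classes-mono : {E F : Rel A 0ℓ} {k l : ℕ} → E ⇒ F → Classes E k → Classes F l → l ≤ k
  classes-mono E⇒F (c , _ , kerᶜ) (d , surj , kerᵈ) = Fin.injective⇒≤ {f = c ∘ rep} rep-injective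
    where
    rep = proj₁ ∘ surj
    rep-injective : ∀ {i j} → c (rep i) ≡ c (rep j) → i ≡ j
    rep-injective {i} {j} eq = trans (sym (proj₂ (surj i) refl))
      (trans (⇒to (kerᵈ _ _) (E⇒F (⇒from (kerᶜ _ _) eq))) (proj₂ (surj j) refl))

  classes-unique : {E : Rel A 0ℓ} {k l : ℕ} → Classes E k → Classes E l → k ≡ l
  classes-unique C D = ℕ.≤-antisym (classes-mono id D C) (classes-mono id C D)

  classes-dec : {E : Rel A 0ℓ} {k : ℕ} → Classes E k → ∀ x y → Dec (E x y)
  classes-dec (c , _ , ker) x y = map′ (⇒from (ker x y)) (⇒to (ker x y)) (c x Fin.≟ c y)

  classes-positive : {E : Rel A 0ℓ} {k : ℕ} → A → Classes E k → ∃[ k′ ] k ≡ suc k′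
  classes-positive {k = zero}  x (c , _) with c x
  ... | ()
  classes-positive {k = suc k} _ _ = k , refl

  conn-equiv : (R : Rel A 0ℓ) → IsEquivalence (Conn R)
  conn-equiv = Eqv.isEquivalence

  conn-sym : {R : Rel A 0ℓ} {x y : A} → Conn R x y → Conn R y x
  conn-sym {R} = IsEquivalence.sym (conn-equiv R)

  conn-gen : {R S : Rel A 0ℓ} → R ⇒ Conn S → Conn R ⇒ Conn S
  conn-gen = Eqv.fold (conn-equiv _)

  edge : {R : Rel A 0ℓ} {x y : A} → R x y → Conn R x y
  edge r = fwd r ◅ ε

  -- By `gen` an edge of `R` stays in a class or joins the two given ones, so the colour of `y` can
  -- be renamed to that of `x` and then deleted by `punchOut`.
  classes-merge : {E R : Rel A 0ℓ} {k : ℕ} (x y : A) → Classes E k → ¬ E x y →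
    E ⇒ Conn R → Conn R x y →
    (∀ {u v} → R u v → E u v ⊎ (E u x × E y v) ⊎ (E u y × E x v)) →
    ∃[ k′ ] (k ≡ suc k′ × Classes (Conn R) k′)
  classes-merge {E} {R} {zero} x _ (c , _) _ _ _ _ with c x
  ... | ()
  classes-merge {E} {R} {suc k} x y (c , surj , ker) x≁y E⇒ xRy gen =
    k , refl , c′ , surj′ , λ u v → mk⇔ (sound u v) (complete u v)
    where
    cx≢cy : c x ≢ c y
    cx≢cy = x≁y ∘ ⇒from (ker x y)

    mg : A → Fin (suc k)
    mg u with c u Fin.≟ c y
    ... | yes _ = c x
    ... | no  _ = c u

    mg-≢ : ∀ u → c y ≢ mg u
    mg-≢ u with c u Fin.≟ c y
    ... | yes _  = cx≢cy ∘ sym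
    ... | no u≢y = u≢y ∘ sym

    mg-cong : ∀ {u v} → c u ≡ c v → mg u ≡ mg v
    mg-cong {u} {v} eq with c u Fin.≟ c y | c v Fin.≟ c y
    ... | yes _ | yes _ = refl
    ... | yes p | no ¬q = contradiction (trans (sym eq) p) ¬q
    ... | no ¬p | yes q = contradiction (trans eq q) ¬p
    ... | no _  | no _  = eq

    mg-x : mg x ≡ c x
    mg-x with c x Fin.≟ c y
    ... | yes _ = refl
    ... | no _  = refl

    mg-y : mg y ≡ c x
    mg-y with c y Fin.≟ c y
    ... | yes _ = refl
    ... | no ¬p = contradiction refl ¬p

    mg-xy : mg x ≡ mg y
    mg-xy = trans mg-x (sym mg-y)

    mg-R : ∀ {u v} → R u v → mg u ≡ mg v
    mg-R r with gen r
    ... | inj₁ uv              = mg-cong (⇒to (ker _ _) uv)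
    ... | inj₂ (inj₁ (ux , yv)) = trans (mg-cong (⇒to (ker _ _) ux)) (trans mg-xy (mg-cong (⇒to (ker _ _) yv)))
    ... | inj₂ (inj₂ (uy , xv)) = trans (mg-cong (⇒to (ker _ _) uy)) (trans (sym mg-xy) (mg-cong (⇒to (ker _ _) xv)))

    toRep : ∀ u → ∃[ w ] (Conn R u w × mg u ≡ c w)
    toRep u with c u Fin.≟ c y
    ... | yes p = x , E⇒ (⇒from (ker _ _) p) ◅◅ conn-sym xRy , refl
    ... | no  _ = u , ε , refl

    mg-reflect : ∀ u v → mg u ≡ mg v → Conn R u v
    mg-reflect u v eq with toRep u | toRep v
    ... | w , uw , ew | w′ , vw′ , ew′ =
      uw ◅◅ E⇒ (⇒from (ker w w′) (trans (sym ew) (trans eq ew′))) ◅◅ conn-sym vw′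

    c′ : A → Fin k
    c′ u = punchOut (mg-≢ u)

    sound : ∀ u v → Conn R u v → c′ u ≡ c′ v
    sound u v uv = Fin.punchOut-cong (c y) (Eqv.gfold ≡.isEquivalence mg mg-R uv)

    complete : ∀ u v → c′ u ≡ c′ v → Conn R u v
    complete u v eq = mg-reflect u v (Fin.punchOut-injective (mg-≢ u) (mg-≢ v) eq)

    mg-id : ∀ u → c u ≢ c y → mg u ≡ c u
    mg-id u u≢y with c u Fin.≟ c y
    ... | yes p = contradiction p u≢y
    ... | no _  = refl

    surj′ : Surjective _≡_ _≡_ c′
    surj′ i with surj (punchIn (c y) i)
    ... | u , cu = u , λ { refl →
      trans (Fin.punchOut-cong (c y) {i≢k = Fin.punchInᵢ≢i (c y) i ∘ sym} (trans (mg-id u u≢y) (cu refl)))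
            (Fin.punchOut-punchIn (c y)) }
      where
      u≢y : c u ≢ c y
      u≢y p = Fin.punchInᵢ≢i (c y) i (trans (sym (cu refl)) p)

-- Search and class counts on finite sets

module Finite {A : Set} {N : ℕ} (enum : A ↔ Fin N) where

  elements : List A
  elements = map (from enum) (allFin N)

  ∈-elements : ∀ x → x ∈ elements
  ∈-elements x = subst (_∈ elements) (strictlyInverseʳ enum x) (∈-map⁺ (from enum) (∈-allFin (to enum x)))

  enum-injective : ∀ {x y} → to enum x ≡ to enum y → x ≡ y
  enum-injective {x} {y} eq =
    trans (sym (strictlyInverseʳ enum x)) (trans (cong (from enum) eq) (strictlyInverseʳ enum y))

  decEq : DecidableEquality A
  decEq x y = map′ enum-injective (cong (to enum)) (to enum x Fin.≟ to enum y)

  any-dec : ∀ {ℓ} {P : A → Set ℓ} → (∀ x → Dec (P x)) → Dec (∃ P)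
  any-dec {P = P} P? = map′ (λ { (i , p) → from enum i , p })
    (λ { (x , p) → to enum x , subst P (sym (strictlyInverseʳ enum x)) p }) (Fin.any? (P? ∘ from enum))

  all-dec : ∀ {ℓ} {P : A → Set ℓ} → (∀ x → Dec (P x)) → Dec (∀ x → P x)
  all-dec {P = P} P? = map′ (λ f x → subst P (strictlyInverseʳ enum x) (f (to enum x)))
    (λ f i → f (from enum i)) (Fin.all? (P? ∘ from enum))

  classes-discrete : {E : Rel A 0ℓ} → IsEquivalence E → E ⇒ _≡_ → Classes E N
  classes-discrete equiv E⇒≡ = to enum , (λ i → from enum i , λ { refl → strictlyInverseˡ enum i }) ,
    λ x y → mk⇔ (cong (to enum) ∘ E⇒≡) (IsEquivalence.reflexive equiv ∘ enum-injective)

  classes-bound : {E : Rel A 0ℓ} {k : ℕ} → IsEquivalence E → Classes E k → k ≤ N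
  classes-bound equiv = classes-mono (IsEquivalence.reflexive equiv) (classes-discrete ≡.isEquivalence id)

  abstract
    -- Adding one pair at a time either changes nothing or merges two classes, and the count
    -- obtained so far decides which.
    classes-∈ : (L : List (A × A)) → ∃[ k ] Classes (Conn (λ x y → (x , y) ∈ L)) k
    classes-∈ [] = N , classes-discrete (conn-equiv _) (Eqv.fold ≡.isEquivalence λ ())
    classes-∈ ((x , y) ∷ L) with classes-∈ L
    ... | k , C with classes-dec C x y
    ... | yes xy = k , classes-resp (conn-gen (edge ∘ there))
      (conn-gen λ { (here refl) → xy ; (there i) → edge i }) C
    ... | no x≁y with classes-merge x y C x≁y (conn-gen (edge ∘ there)) (edge (here refl))
      (λ { (here refl) → inj₂ (inj₁ (ε , ε)) ; (there i) → inj₁ (edge i) })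
    ... | k′ , _ , C′ = k′ , C′

  abstract
    orbits-exist : (f : A → A) → ∃[ k ] NumOrbits f k
    orbits-exist f with classes-∈ (map (λ x → x , f x) elements)
    ... | k , C = k , classes-resp (conn-gen back) (conn-gen forth) C
      where
      back : ∀ {x y} → (x , y) ∈ map (λ x → x , f x) elements → Conn (Graph f) x y
      back i with ∈-map⁻ (λ x → x , f x) i
      ... | _ , _ , refl = edge refl
      forth : ∀ {x y} → y ≡ f x → Conn (λ x y → (x , y) ∈ map (λ x → x , f x) elements) x y
      forth {x} refl = edge (∈-map⁺ (λ x → x , f x) (∈-elements x))

-- Orbits and iterates

module _ {A : Set} where

  Orbit : (A → A) → Rel A 0ℓ
  Orbit f = Conn (Graph f)

  orbit-resp : {f g : A → A} → f ≗ g → Orbit f ⇒ Orbit g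
  orbit-resp f≗g = conn-gen λ { {x} refl → edge (f≗g x) }

  orbits-resp : {f g : A → A} {k : ℕ} → f ≗ g → NumOrbits f k → NumOrbits g k
  orbits-resp f≗g = classes-resp (orbit-resp f≗g) (orbit-resp (sym ∘ f≗g))

  to-injective : (σ : A ↔ A) {x y : A} → to σ x ≡ to σ y → x ≡ y
  to-injective σ {x} {y} eq =
    trans (sym (strictlyInverseʳ σ x)) (trans (cong (from σ) eq) (strictlyInverseʳ σ y))

  iter : (A → A) → ℕ → A → A
  iter f zero    x = x
  iter f (suc k) x = f (iter f k x)

  iter-+ : ∀ f j k x → iter f (j + k) x ≡ iter f j (iter f k x)
  iter-+ f zero    k x = refl
  iter-+ f (suc j) k x = cong f (iter-+ f j k x)

  iter-suc : ∀ f k x → iter f k (f x) ≡ iter f (suc k) x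
  iter-suc f zero    x = refl
  iter-suc f (suc k) x = cong f (iter-suc f k x)

  iter-orbit : ∀ f k x → Orbit f x (iter f k x)
  iter-orbit f zero    x = ε
  iter-orbit f (suc k) x = iter-orbit f k x ◅◅ edge refl

  iter-injective : ∀ {f} → Injective _≡_ _≡_ f → ∀ k {x y} → iter f k x ≡ iter f k y → x ≡ y
  iter-injective inj zero    eq = eq
  iter-injective inj (suc k) eq = iter-injective inj k (inj eq)

least : {P : ℕ → Set} → (∀ k → Dec (P k)) → ∀ k → P k → ∃[ m ] (P m × (∀ i → i < m → ¬ P i))
least {P} P? k pk with go k
  where
  go : ∀ k → (∃[ m ] (P m × (∀ i → i < m → ¬ P i))) ⊎ (∀ i → i < k → ¬ P i)
  go zero    = inj₂ λ _ ()
  go (suc k) with go k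
  ... | inj₁ w = inj₁ w
  ... | inj₂ none with P? k
  ... | yes pk = inj₁ (k , pk , none)
  ... | no ¬pk = inj₂ λ i i<sk pi → [ (λ i<k → none i i<k pi) , (λ { refl → ¬pk pi }) ]′ (ℕ.m≤n⇒m<n∨m≡n (s≤s⁻¹ i<sk))
... | inj₁ w    = w
... | inj₂ none = k , pk , none

-- Multiplying a permutation by a transposition

module Transpositions {A : Set} {N : ℕ} (enum : A ↔ Fin N) where
  open Finite enum

  abstract
    sw : A → A → A → A
    sw x y u with decEq u x
    ... | yes _ = y
    ... | no _ with decEq u y
    ... | yes _ = x
    ... | no _  = u

    sw-l : ∀ x y → sw x y x ≡ y
    sw-l x y with decEq x x
    ... | yes _ = refl
    ... | no ¬p = contradiction refl ¬p

    sw-r : ∀ x y → sw x y y ≡ x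
    sw-r x y with decEq y x
    ... | yes p = p
    ... | no _ with decEq y y
    ... | yes _ = refl
    ... | no ¬p = contradiction refl ¬p

    sw-o : ∀ x y {u} → u ≢ x → u ≢ y → sw x y u ≡ u
    sw-o x y {u} u≢x u≢y with decEq u x
    ... | yes p = contradiction p u≢x
    ... | no _ with decEq u y
    ... | yes p = contradiction p u≢y
    ... | no _  = refl

  data SwView (x y u : A) : Set where
    at-l  : u ≡ x → sw x y u ≡ y → SwView x y u
    at-r  : u ≡ y → sw x y u ≡ x → SwView x y u
    off   : u ≢ x → u ≢ y → sw x y u ≡ u → SwView x y u

  swView : ∀ x y u → SwView x y u
  swView x y u with decEq u x
  ... | yes refl = at-l refl (sw-l x y)
  ... | no u≢x with decEq u y
  ... | yes refl = at-r refl (sw-r x y)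
  ... | no u≢y = off u≢x u≢y (sw-o x y u≢x u≢y)

  sw-involutive : ∀ x y u → sw x y (sw x y u) ≡ u
  sw-involutive x y u with swView x y u
  ... | at-l refl e   = trans (cong (sw x y) e) (sw-r x y)
  ... | at-r refl e   = trans (cong (sw x y) e) (sw-l x y)
  ... | off _ _ e     = trans (cong (sw x y) e) e

  sw-comm : ∀ x y → sw x y ≗ sw y x
  sw-comm x y u with swView x y u
  ... | at-l refl e = trans e (sym (sw-r y x))
  ... | at-r refl e = trans e (sym (sw-l y x))
  ... | off p q e   = trans e (sym (sw-o y x q p))

  sw-conj : (σ : A ↔ A) → ∀ x y u → to σ (sw x y u) ≡ sw (to σ x) (to σ y) (to σ u)
  sw-conj σ x y u with swView x y u
  ... | at-l refl e = trans (cong (to σ) e) (sym (sw-l _ _))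
  ... | at-r refl e = trans (cong (to σ) e) (sym (sw-r _ _))
  ... | off p q e   = trans (cong (to σ) e) (sym (sw-o _ _ (p ∘ to-injective σ) (q ∘ to-injective σ)))

  infixl 5 _⊙_,_
  infixr 5 _,_⊚_

  _⊙_,_ : A ↔ A → A → A → A ↔ A
  σ ⊙ x , y = mk↔ₛ′ (to σ ∘ sw x y) (sw x y ∘ from σ)
    (λ u → trans (cong (to σ) (sw-involutive x y _)) (strictlyInverseˡ σ u))
    (λ u → trans (cong (sw x y) (strictlyInverseʳ σ _)) (sw-involutive x y u))

  _,_⊚_ : A → A → A ↔ A → A ↔ A
  x , y ⊚ σ = mk↔ₛ′ (sw x y ∘ to σ) (from σ ∘ sw x y)
    (λ u → trans (cong (sw x y) (strictlyInverseˡ σ _)) (sw-involutive x y u))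
    (λ u → trans (cong (from σ) (sw-involutive x y _)) (strictlyInverseʳ σ u))

  ⊙-cancel : ∀ σ x y → to (σ ⊙ x , y ⊙ x , y) ≗ to σ
  ⊙-cancel σ x y u = cong (to σ) (sw-involutive x y u)

  -- Conjugation turns left multiplication into right multiplication; the left-hand versions of
  -- merging and splitting all come from this.
  ⊚-⊙ : ∀ σ x y → to (σ ⊙ from σ x , from σ y) ≗ to (x , y ⊚ σ)
  ⊚-⊙ σ x y u = trans (sw-conj σ (from σ x) (from σ y) u)
    (cong₂ (λ a b → sw a b (to σ u)) (strictlyInverseˡ σ x) (strictlyInverseˡ σ y))

  period : ∀ {f} → Injective _≡_ _≡_ f → ∀ x → ∃[ k ] iter f (suc k) x ≡ x
  period {f} inj x with Fin.pigeonhole (ℕ.n<1+n N) (λ i → to enum (iter f (toℕ i) x))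
  ... | i , j , i<j , eq with ℕ.m<n⇒0<n∸m i<j
  ... | 0<d with toℕ j ∸ toℕ i in d≡
  ... | suc k = k , iter-injective inj (toℕ i) (trans (sym (iter-+ f (toℕ i) (suc k) x))
    (trans (cong (λ m → iter f m x) (trans (cong (toℕ i +_) (sym d≡)) (ℕ.m+[n∸m]≡n (ℕ.<⇒≤ i<j))))
      (sym (enum-injective eq))))

  injective⇒perm : (f : A → A) → Injective _≡_ _≡_ f → A ↔ A
  injective⇒perm f inj = mk↔ₛ′ f (λ y → iter f (proj₁ (period inj y)) y) (λ y → proj₂ (period inj y))
    (λ x → inj (proj₂ (period inj (f x))))

  abstract
    orbit⇒iter : (σ : A ↔ A) → ∀ {x y} → Orbit (to σ) x y → ∃[ k ] iter (to σ) k x ≡ y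
    orbit⇒iter σ ε = 0 , refl
    orbit⇒iter σ {x} (fwd refl ◅ p) with orbit⇒iter σ p
    ... | k , eq = suc k , trans (sym (iter-suc (to σ) k x)) eq
    -- A backward edge from `x = σ w` to `w` is replaced by going forwards round the rest of the
    -- cycle.
    orbit⇒iter σ {x} (_◅_ {j = w} (bwd refl) p) with orbit⇒iter σ p | period (to-injective σ) w
    ... | k , eq | m , per = k + m , trans (iter-+ (to σ) k m x)
      (trans (cong (iter (to σ) k) (trans (iter-suc (to σ) m w) per)) eq)

  module _ (σ : A ↔ A) (x y : A) where

    σ′ : A → A
    σ′ = to (σ ⊙ x , y)

    -- `σ′` sends `x` to `σ y` and then follows the `σ`-cycle of `y` round to `y`; this cycle does
    -- not contain `x`, so nothing diverts it earlier.
    merged : ¬ Orbit (to σ) x y → Orbit σ′ x y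
    merged x≁y with period (to-injective σ) y
    ... | m , per = subst (Orbit σ′ x) per (go m)
      where
      start : Orbit σ′ x (to σ y)
      start = edge (cong (to σ) (sym (sw-l x y)))
      go : ∀ i → Orbit σ′ x (iter (to σ) (suc i) y)
      go zero = start
      go (suc i) with swView x y (iter (to σ) (suc i) y)
      ... | at-l e _  = contradiction (conn-sym (subst (Orbit (to σ) y) e (iter-orbit (to σ) (suc i) y))) x≁y
      ... | at-r e _  = subst (λ w → Orbit σ′ x (to σ w)) (sym e) start
      ... | off _ _ e = go i ◅◅ edge (cong (to σ) (sym e))

    merge-⊇ : ¬ Orbit (to σ) x y → Orbit (to σ) ⇒ Orbit σ′
    merge-⊇ x≁y = conn-gen λ { {u} refl → lift u }
      where
      xy = merged x≁y
      lift : ∀ u → Orbit σ′ u (to σ u)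
      lift u with swView x y u
      ... | at-l refl _ = xy ◅◅ edge (cong (to σ) (sym (sw-r x y)))
      ... | at-r refl _ = conn-sym xy ◅◅ edge (cong (to σ) (sym (sw-l x y)))
      ... | off _ _ e   = edge (cong (to σ) (sym e))

    abstract
      orbits-merge : ∀ {k} → NumOrbits (to σ) k → ¬ Orbit (to σ) x y → ∃[ k′ ] (k ≡ suc k′ × NumOrbits σ′ k′)
      orbits-merge C x≁y = classes-merge x y C x≁y (merge-⊇ x≁y) (merged x≁y) gen
        where
        gen : ∀ {u v} → v ≡ σ′ u → Orbit (to σ) u v ⊎ (Orbit (to σ) u x × Orbit (to σ) y v) ⊎ (Orbit (to σ) u y × Orbit (to σ) x v)
        gen {u} refl with swView x y u
        ... | at-l refl e = inj₂ (inj₁ (ε , edge (cong (to σ) e)))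
        ... | at-r refl e = inj₂ (inj₂ (ε , edge (cong (to σ) e)))
        ... | off _ _ e   = inj₁ (edge (cong (to σ) e))

    -- The new cycle through y is {σ x, σ² x, …, σᵏ x = y} with k least, and it misses x.
    separated : x ≢ y → Orbit (to σ) x y → ¬ Orbit σ′ x y
    separated x≢y x~y x~′y with orbit⇒iter σ x~y
    ... | k₀ , hit₀ with least (λ k → decEq (iter (to σ) k x) y) k₀ hit₀
    ... | zero , hit , _ = x≢y hit
    ... | suc k , hit , min = let m , eq = orbit⇒iter (σ ⊙ x , y) (conn-sym x~′y) in
        let i , i≤k , e = closed m in x∉ i i≤k (trans e eq)
      where
      f = to σ
      S : A → Set
      S u = ∃[ i ] (i ≤ k × iter f (suc i) x ≡ u)
      x∉ : ∀ i → i ≤ k → iter f (suc i) x ≢ x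
      x∉ i i≤k e = min (k ∸ i) (s≤s (ℕ.m∸n≤m k i))
        (trans (trans (cong (iter f (k ∸ i)) (sym e)) (sym (iter-+ f (k ∸ i) (suc i) x)))
          (trans (cong (λ j → iter f j x) (trans (ℕ.+-suc (k ∸ i) i) (cong suc (ℕ.m∸n+n≡m i≤k)))) hit))
      step : ∀ u → S u → S (σ′ u)
      step u (i , i≤k , e) with swView x y u
      ... | at-l refl _ = contradiction e (x∉ i i≤k)
      ... | at-r refl e′ = 0 , z≤n , cong f (sym e′)
      ... | off _ u≢y e′ with ℕ.m≤n⇒m<n∨m≡n i≤k
      ... | inj₁ i<k = suc i , i<k , cong f (trans e (sym e′))
      ... | inj₂ refl = contradiction (trans (sym e) hit) u≢y
      closed : ∀ m → S (iter σ′ m y)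
      closed zero    = k , ℕ.≤-refl , hit
      closed (suc m) = step _ (closed m)

  abstract
    -- Multiplying by the same transposition again undoes the split and is a merge, so the merging
    -- count read backwards gives the splitting count.
    orbits-split : ∀ σ x y {k} → NumOrbits (to σ) k → x ≢ y → Orbit (to σ) x y → NumOrbits (to (σ ⊙ x , y)) (suc k)
    orbits-split σ x y C x≢y x~y with orbits-exist (to (σ ⊙ x , y))
    ... | k′ , C′ with orbits-merge (σ ⊙ x , y) x y C′ (separated σ x y x≢y x~y)
    ... | k″ , refl , C″ rewrite classes-unique C (orbits-resp (⊙-cancel σ x y) C″) = C′

  from-orbit : (σ : A ↔ A) → ∀ x → Orbit (to σ) (from σ x) x
  from-orbit σ x = edge (sym (strictlyInverseˡ σ x))

  module _ (σ : A ↔ A) (x y : A) (x≁y : ¬ Orbit (Inverse.to σ) x y) where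

    private
      pre≁ : ¬ Orbit (to σ) (from σ x) (from σ y)
      pre≁ p = x≁y (conn-sym (from-orbit σ x) ◅◅ p ◅◅ from-orbit σ y)

    abstract
      orbits-mergeˡ : ∀ {k} → NumOrbits (to σ) k → ∃[ k′ ] (k ≡ suc k′ × NumOrbits (to (x , y ⊚ σ)) k′)
      orbits-mergeˡ C with orbits-merge σ (from σ x) (from σ y) C pre≁
      ... | k′ , eq , C′ = k′ , eq , orbits-resp (⊚-⊙ σ x y) C′

    merge-⊇ˡ : Orbit (to σ) ⇒ Orbit (to (x , y ⊚ σ))
    merge-⊇ˡ p = orbit-resp (⊚-⊙ σ x y) (merge-⊇ σ (from σ x) (from σ y) pre≁ p)

    mergedˡ : Orbit (to (x , y ⊚ σ)) x y
    mergedˡ =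
      conn-sym (edge (sym (trans (cong (sw x y) (strictlyInverseˡ σ y)) (sw-r x y)))) ◅◅
      conn-sym (orbit-resp (⊚-⊙ σ x y) (merged σ (from σ x) (from σ y) pre≁)) ◅◅
      edge (sym (trans (cong (sw x y) (strictlyInverseˡ σ x)) (sw-l x y)))

  abstract
    orbits-splitˡ : ∀ σ x y {k} → NumOrbits (to σ) k → x ≢ y → Orbit (to σ) x y → NumOrbits (to (x , y ⊚ σ)) (suc k)
    orbits-splitˡ σ x y C x≢y x~y = orbits-resp (⊚-⊙ σ x y) (orbits-split σ (from σ x) (from σ y) C
      (λ e → x≢y (trans (sym (strictlyInverseˡ σ x)) (trans (cong (to σ) e) (strictlyInverseˡ σ y))))
      (from-orbit σ x ◅◅ x~y ◅◅ conn-sym (from-orbit σ y)))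

-- The genus inequality and its extremal case

module Geodesics {A : Set} {N : ℕ} (enum : A ↔ Fin N) (γ : A ↔ A) {c : ℕ} (γ-orbits : NumOrbits (Inverse.to γ) c) where
  open Finite enum
  open Transpositions enum

  κ : A ↔ A → A ↔ A
  κ τ = mk↔ₛ′ (from τ ∘ to γ) (from γ ∘ to τ)
    (λ u → trans (cong (from τ) (strictlyInverseˡ γ _)) (strictlyInverseʳ τ u))
    (λ u → trans (cong (from γ) (strictlyInverseˡ τ _)) (strictlyInverseʳ γ u))

  Geodesic : A ↔ A → Set
  Geodesic τ = ∃₂ λ a b → NumOrbits (to τ) a × NumOrbits (to (κ τ)) b × a + b ≡ N + c

  κ-id : ∀ τ → (∀ x → to (κ τ) x ≡ x) → to γ ≗ to τ
  κ-id τ fixed x = trans (sym (strictlyInverseˡ τ _)) (cong (to τ) (fixed x))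

  -- If κ τ moves x then composing τ with (x , κ τ x) splits a cycle off κ τ.
  -- In the extremal case every such step merges two cycles of τ, so τ is obtained from γ by splittings.
  module SplitInduction {ℓ : Level} (Q : (A → A) → Set ℓ)
    (Q-resp : ∀ {f g} → f ≗ g → Q f → Q g)
    (Q-γ : Q (to γ))
    (Q-split : ∀ σ x y → x ≢ y → Orbit (to σ) x y → Q (to σ) → Q (to (σ ⊙ x , y))) where

    induct : ∀ m τ {a b} → NumOrbits (to τ) a → NumOrbits (to (κ τ)) b → N ≤ b + m →
      a + b ≤ N + c × (a + b ≡ N + c → Q (to τ))
    induct m τ {a} {b} Ca Cb fuel with any-dec (λ x → ¬? (decEq (to (κ τ) x) x))
    ... | no none =
      subst₂ _≤_ (ℕ.+-comm b a) (cong (N +_) (classes-unique Ca (orbits-resp γ≗τ γ-orbits)))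
        (ℕ.+-monoˡ-≤ a (classes-bound (conn-equiv _) Cb))
      , λ _ → Q-resp γ≗τ Q-γ
      where
      γ≗τ : to γ ≗ to τ
      γ≗τ = κ-id τ λ x → decidable-stable (decEq _ x) λ ne → none (x , ne)
    ... | yes (x , x≢) = step m fuel
      where
      y = to (κ τ) x
      τ′ = τ ⊙ x , y
      -- The map of `κ τ′` is `sw x y` after that of `κ τ`, hence a left multiplication. Since a
      -- complement has at most `N` cycles, the fuel `m` bounds the splits still possible.
      Cb′ : NumOrbits (to (κ τ′)) (suc b)
      Cb′ = orbits-splitˡ (κ τ) x y Cb (x≢ ∘ sym) (edge refl)
      step : ∀ m → N ≤ b + m → a + b ≤ N + c × (a + b ≡ N + c → Q (to τ))
      step zero    fuel = contradiction
        (ℕ.≤-trans (classes-bound (conn-equiv _) Cb′) (subst (N ≤_) (ℕ.+-identityʳ b) fuel)) ℕ.1+n≰n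
      step (suc m) fuel with classes-dec Ca x y
      ... | yes x~y = ℕ.<⇒≤ strict , λ eq → contradiction eq (ℕ.<⇒≢ strict)
        where
        strict : a + b < N + c
        strict = ℕ.≤-trans (ℕ.+-monoʳ-≤ (suc a) (ℕ.n≤1+n b))
          (proj₁ (induct m τ′ (orbits-split τ x y Ca (x≢ ∘ sym) x~y) Cb′ (subst (N ≤_) (ℕ.+-suc b m) fuel)))
      ... | no x≁y with orbits-merge τ x y Ca x≁y
      ... | a′ , refl , Ca′ with induct m τ′ Ca′ Cb′ (subst (N ≤_) (ℕ.+-suc b m) fuel)
      ... | bound , q = subst (_≤ N + c) (ℕ.+-suc a′ b) bound , λ eq → Q-resp (⊙-cancel τ x y)
        (Q-split τ′ x y (x≢ ∘ sym) (merged τ x y x≁y) (q (trans (ℕ.+-suc a′ b) eq)))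

    geodesic-induct : ∀ τ → Geodesic τ → Q (to τ)
    geodesic-induct τ (a , b , Ca , Cb , eq) = proj₂ (induct N τ Ca Cb (ℕ.m≤n+m N b)) eq

  orbits-bound : ∀ τ {a b} → NumOrbits (to τ) a → NumOrbits (to (κ τ)) b → a + b ≤ N + c
  orbits-bound τ {a} {b} Ca Cb = proj₁ (induct N τ Ca Cb (ℕ.m≤n+m N b))
    -- A trivial predicate, as only the inequality half of `induct` is wanted.
    where open SplitInduction (λ _ → Fin 1) (λ _ q → q) Fin.zero (λ _ _ _ _ _ q → q)

  -- If `x` and `y` also shared a cycle of `κ σ`, both counts would grow and exceed `orbits-bound`.
  -- So the complement loses a cycle and the sum stays extremal.
  geodesic-split : ∀ σ x y {a b} → NumOrbits (to σ) a → NumOrbits (to (κ σ)) b → a + b ≡ N + c →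
    x ≢ y → Orbit (to σ) x y →
    ∃[ b′ ] (b ≡ suc b′ × NumOrbits (to (σ ⊙ x , y)) (suc a) × NumOrbits (to (κ (σ ⊙ x , y))) b′ × suc a + b′ ≡ N + c)
  geodesic-split σ x y {a} {b} Ca Cb eq x≢y x~y with classes-dec Cb x y
  ... | yes κx~y = contradiction
    (ℕ.≤-trans (ℕ.+-monoʳ-≤ (suc a) (ℕ.n≤1+n b))
      (orbits-bound (σ ⊙ x , y) (orbits-split σ x y Ca x≢y x~y) (orbits-splitˡ (κ σ) x y Cb x≢y κx~y)))
    (ℕ.<⇒≱ (s≤s (ℕ.≤-reflexive (sym eq))))
  ... | no κx≁y with orbits-mergeˡ (κ σ) x y κx≁y Cb
  ... | b′ , refl , Cb′ = b′ , refl , orbits-split σ x y Ca x≢y x~y , Cb′ , trans (sym (ℕ.+-suc a b′)) eq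

-- Cyclic intervals of positions

-- b lies strictly inside the cyclic interval from a to c, which for c ≡ a is the whole circle without a.
Between : ℕ → ℕ → ℕ → Set
Between a b c = (a < b × b < c) ⊎ (c ≤ a × (a < b ⊎ b < c))

between-total : ∀ a {u v} → u ≢ v → Between a u v ⊎ Between a v u
between-total a {u} {v} u≢v with ℕ.<-cmp u v | a <? u | a <? v
... | tri≈ _ u≡v _ | _       | _       = contradiction u≡v u≢v
... | tri< u<v _ _ | yes a<u | _       = inj₁ (inj₁ (a<u , u<v))
... | tri< u<v _ _ | no a≮u  | yes a<v = inj₂ (inj₂ (ℕ.≮⇒≥ a≮u , inj₁ a<v))
... | tri< u<v _ _ | no _    | no a≮v  = inj₁ (inj₂ (ℕ.≮⇒≥ a≮v , inj₂ u<v))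
... | tri> _ _ v<u | _       | yes a<v = inj₂ (inj₁ (a<v , v<u))
... | tri> _ _ v<u | yes a<u | no a≮v  = inj₁ (inj₂ (ℕ.≮⇒≥ a≮v , inj₁ a<u))
... | tri> _ _ v<u | no a≮u  | no _    = inj₂ (inj₂ (ℕ.≮⇒≥ a≮u , inj₂ v<u))

-- The interval (a , b]. Half-open because `σ ⊙ x , y` makes `σ x` the successor of `y`: for `x`
-- before `y`, the new cycle of `y` is the part of the old one in (x , y].
inside : ℕ → ℕ → ℕ → Bool
inside a b m with a <? m | m ≤? b
... | yes _ | yes _ = true
... | yes _ | no _  = false
... | no _  | _     = false

data InsideView (a b m : ℕ) : Bool → Set where
  below  : m ≤ a → InsideView a b m false
  within : a < m → m ≤ b → InsideView a b m true
  above  : b < m → InsideView a b m false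

insideView : ∀ a b m → InsideView a b m (inside a b m)
insideView a b m with a <? m | m ≤? b
... | no a≮m  | _       = below (ℕ.≮⇒≥ a≮m)
... | yes a<m | yes m≤b = within a<m m≤b
... | yes a<m | no m≰b  = above (ℕ.≰⇒> m≰b)

module _ {a b : ℕ} (a<b : a < b) where

  -- Membership in (a , b] changes only just after `a` and just after `b`, so a step that neither
  -- starts at them nor jumps over them preserves it.
  inside-step : ∀ {u v} → u ≢ a → u ≢ b → ¬ Between u a v → ¬ Between u b v → inside a b u ≡ inside a b v
  inside-step {u} {v} u≢a u≢b ¬a ¬b with inside a b u | insideView a b u | inside a b v | insideView a b v
  ... | _ | below _        | _ | below _        = refl
  ... | _ | below u≤a      | _ | within a<v _   = contradiction (inj₁ (ℕ.≤∧≢⇒< u≤a u≢a , a<v)) ¬a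
  ... | _ | below _        | _ | above _        = refl
  ... | _ | within a<u u≤b | _ | below v≤a      =
    contradiction (inj₂ (ℕ.≤-trans v≤a (ℕ.<⇒≤ a<u) , inj₁ (ℕ.≤∧≢⇒< u≤b u≢b))) ¬b
  ... | _ | within _ _     | _ | within _ _     = refl
  ... | _ | within _ u≤b   | _ | above b<v      = contradiction (inj₁ (ℕ.≤∧≢⇒< u≤b u≢b , b<v)) ¬b
  ... | _ | above _        | _ | below _        = refl
  ... | _ | above b<u      | _ | within a<v v≤b =
    contradiction (inj₂ (ℕ.≤-trans v≤b (ℕ.<⇒≤ b<u) , inj₂ a<v)) ¬a
  ... | _ | above _        | _ | above _        = refl

  inside-lower : inside a b a ≡ false
  inside-lower with inside a b a | insideView a b a
  ... | _ | below _      = refl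
  ... | _ | within a<a _ = contradiction a<a (ℕ.<-irrefl refl)
  ... | _ | above _      = refl

  inside-upper : inside a b b ≡ true
  inside-upper with inside a b b | insideView a b b
  ... | _ | below b≤a  = contradiction a<b (ℕ.≤⇒≯ b≤a)
  ... | _ | within _ _ = refl
  ... | _ | above b<b  = contradiction b<b (ℕ.<-irrefl refl)

  after-upper : ∀ {v} → ¬ Between b a v → inside a b v ≡ false
  after-upper {v} ¬a with inside a b v | insideView a b v
  ... | _ | below _        = refl
  ... | _ | within a<v v≤b = contradiction (inj₂ (v≤b , inj₂ a<v)) ¬a
  ... | _ | above _        = refl

  after-lower : ∀ {v} → ¬ Between a b v → inside a b v ≡ true
  after-lower {v} ¬b with inside a b v | insideView a b v
  ... | _ | below v≤a  = contradiction (inj₂ (v≤a , inj₁ a<b)) ¬b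
  ... | _ | within _ _ = refl
  ... | _ | above b<v  = contradiction (inj₁ (a<b , b<v)) ¬b

  -- After a split `a` takes over the successor `v` of `b`; for points outside (a , b] the gap
  -- behind `b` extends to one behind `a`.
  between-lower : ∀ {u v} → inside a b u ≡ false → ¬ Between b u v → ¬ Between a u v
  between-lower {u} {v} e ¬u B with inside a b u | insideView a b u
  between-lower {u} {v} refl ¬u (inj₁ (a<u , _))        | _ | below u≤a = ℕ.≤⇒≯ u≤a a<u
  between-lower {u} {v} refl ¬u (inj₂ (_ , inj₁ a<u))   | _ | below u≤a = ℕ.≤⇒≯ u≤a a<u
  between-lower {u} {v} refl ¬u (inj₂ (v≤a , inj₂ u<v)) | _ | below u≤a =
    ¬u (inj₂ (ℕ.≤-trans v≤a (ℕ.<⇒≤ a<b) , inj₂ u<v))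
  between-lower {u} {v} refl ¬u (inj₁ (_ , u<v))        | _ | above b<u = ¬u (inj₁ (b<u , u<v))
  between-lower {u} {v} refl ¬u (inj₂ (v≤a , _))        | _ | above b<u =
    ¬u (inj₂ (ℕ.≤-trans v≤a (ℕ.<⇒≤ a<b) , inj₁ b<u))

  between-upper : ∀ {u v} → inside a b u ≡ true → ¬ Between a u v → ¬ Between b u v
  between-upper {u} {v} e ¬u B with inside a b u | insideView a b u
  between-upper {u} {v} refl ¬u (inj₁ (b<u , _))      | _ | within a<u u≤b = ℕ.≤⇒≯ u≤b b<u
  between-upper {u} {v} refl ¬u (inj₂ (_ , inj₁ b<u)) | _ | within a<u u≤b = ℕ.≤⇒≯ u≤b b<u
  between-upper {u} {v} refl ¬u (inj₂ (_ , inj₂ u<v)) | _ | within a<u u≤b = ¬u (inj₁ (a<u , u<v))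

inside-convex : ∀ {a b p q r} → p < q → q < r → inside a b p ≡ true → inside a b r ≡ true → inside a b q ≡ true
inside-convex {a} {b} {p} {q} {r} p<q q<r ep er
  with inside a b p | insideView a b p | inside a b q | insideView a b q | inside a b r | insideView a b r
inside-convex p<q q<r refl refl | _ | within a<p _ | _ | below q≤a  | _ | within _ r≤b = contradiction (ℕ.<-trans a<p p<q) (ℕ.≤⇒≯ q≤a)
inside-convex p<q q<r refl refl | _ | within a<p _ | _ | within _ _ | _ | within _ r≤b = refl
inside-convex p<q q<r refl refl | _ | within a<p _ | _ | above b<q  | _ | within _ r≤b = contradiction (ℕ.<-trans b<q q<r) (ℕ.≤⇒≯ r≤b)

inside-noncrossing : ∀ {a b p q r s} → p < q → q < r → r < s →
  inside a b p ≡ inside a b r → inside a b q ≡ inside a b s → inside a b p ≡ inside a b q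
inside-noncrossing {a} {b} {p} {q} {r} {s} p<q q<r r<s epr eqs with inside a b p in ep | inside a b q in eq
... | true  | _     = sym (trans (sym eq) (inside-convex p<q q<r ep (sym epr)))
... | false | false = refl
... | false | true  = trans epr (inside-convex q<r r<s eq (sym eqs))

-- Maps that run through noncrossing classes in cyclic order

module Linear {A : Set} (pos : A → ℕ) (pos-injective : ∀ {x y} → pos x ≡ pos y → x ≡ y) where

  NonCrossing : Rel A 0ℓ → Set
  NonCrossing E = ∀ {a b c d} → pos a < pos b → pos b < pos c → pos c < pos d → E a c → E b d → E a b

  -- By `gap`, `f x` is the cyclically next point of the class of `x`. At a fixed point `Between`
  -- covers everything except `x`, which makes the class a singleton.
  record Planar (f : A → A) (E : Rel A 0ℓ) : Set where
    field
      equiv       : IsEquivalence E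
      step        : ∀ x → E x (f x)
      gap         : ∀ {x u} → E x u → ¬ Between (pos x) (pos u) (pos (f x))
      noncrossing : NonCrossing E
    open IsEquivalence equiv public renaming (refl to E-refl; sym to E-sym; trans to E-trans)

  planar-resp : ∀ {f g E} → f ≗ g → Planar f E → Planar g E
  planar-resp {f} {g} {E} f≗g P = record
    { equiv = equiv ; noncrossing = noncrossing
    ; step = λ x → subst (E x) (f≗g x) (step x)
    ; gap = λ {x} {u} xu B → gap xu (subst (λ w → Between (pos x) (pos u) (pos w)) (sym (f≗g x)) B) }
    where open Planar P

  planar-rel : ∀ {f E F} → E ⇒ F → F ⇒ E → Planar f E → Planar f F
  planar-rel E⇒F F⇒E P = record
    { equiv = record { refl = E⇒F E-refl ; sym = E⇒F ∘ E-sym ∘ F⇒E ; trans = λ p q → E⇒F (E-trans (F⇒E p) (F⇒E q)) }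
    ; step = E⇒F ∘ step ; gap = gap ∘ F⇒E
    ; noncrossing = λ p q r ac bd → E⇒F (noncrossing p q r (F⇒E ac) (F⇒E bd)) }
    where open Planar P

  -- From the lower of the two points `f` ascends without skipping the upper one, so it gets there
  -- before wrapping around.
  planar⇒orbit : ∀ {f E} → Planar f E → E ⇒ Orbit f
  planar⇒orbit {f} {E} P {x} {u} xu =
    [ (λ x≤u → go (pos u) x u xu x≤u (ℕ.m∸n≤m (pos u) (pos x)))
    , (λ u≤x → conn-sym (go (pos x) u x (E-sym xu) u≤x (ℕ.m∸n≤m (pos x) (pos u)))) ]′ (ℕ.≤-total (pos x) (pos u))
    where
    open Planar P
    go : ∀ m x u → E x u → pos x ≤ pos u → pos u ∸ pos x ≤ m → Orbit f x u
    go m x u xu x≤u fuel with ℕ.m≤n⇒m<n∨m≡n x≤u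
    ... | inj₂ x≡u = subst (Orbit f x) (pos-injective x≡u) ε
    go zero    x u xu x≤u fuel | inj₁ x<u = contradiction fuel (ℕ.<⇒≱ (ℕ.m<n⇒0<n∸m x<u))
    go (suc m) x u xu x≤u fuel | inj₁ x<u = edge refl ◅◅ go m (f x) u (E-trans (E-sym (step x)) xu)
        (ℕ.≮⇒≥ λ u<fx → gap xu (inj₁ (x<u , u<fx)))
        (s≤s⁻¹ (ℕ.≤-trans (ℕ.∸-monoʳ-< x<fx (ℕ.≮⇒≥ λ u<fx → gap xu (inj₁ (x<u , u<fx)))) fuel))
      where
      x<fx : pos x < pos (f x)
      x<fx = ℕ.≰⇒> λ fx≤x → gap xu (inj₂ (fx≤x , inj₁ x<u))

  orbit⇒planar : ∀ {f E} → Planar f E → Orbit f ⇒ E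
  orbit⇒planar P = Eqv.fold equiv λ { {x} refl → step x }
    where open Planar P

  -- If two such maps differed at `x`, one of the two values would lie in the gap left by the other.
  planar-unique : ∀ {f g E} → Planar f E → Planar g E → f ≗ g
  planar-unique {f} {g} P Q x with pos (f x) ℕ.≟ pos (g x)
  ... | yes e = pos-injective e
  ... | no ne with between-total (pos x) ne
  ... | inj₁ B = contradiction B (Planar.gap Q (Planar.step P x))
  ... | inj₂ B = contradiction B (Planar.gap P (Planar.step Q x))

  Split : Rel A 0ℓ → A → A → Rel A 0ℓ
  Split E x y u v = E u v × (E x u → inside (pos x) (pos y) (pos u) ≡ inside (pos x) (pos y) (pos v))

  module _ {N : ℕ} (enum : A ↔ Fin N) where
    open Finite enum
    open Transpositions enum

    planar-split< : ∀ σ x y {E} → Planar (to σ) E → pos x < pos y → E x y → Planar (to (σ ⊙ x , y)) (Split E x y)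
    planar-split< σ x y {E} P x<y xy = record
      { equiv = record
        { refl = E-refl , λ _ → refl
        ; sym = λ { (uv , h) → E-sym uv , λ xv → sym (h (E-trans xv (E-sym uv))) }
        ; trans = λ { (uv , h) (vw , k) → E-trans uv vw , λ xu → trans (h xu) (k (E-trans xu uv)) } }
      ; step = λ u → step′ u (swView x y u)
      ; gap = λ {u} {v} uv → gap′ u v uv (swView x y u)
      ; noncrossing = λ a<b b<c c<d (ac , h) (bd , k) →
          let ab = noncrossing a<b b<c c<d ac bd in
          ab , λ xa → inside-noncrossing a<b b<c c<d (h xa) (k (E-trans xa ab)) }
      where
      open Planar P
      f = to σ
      step′ : ∀ u → SwView x y u → Split E x y u (f (sw x y u))
      step′ u (at-l refl e) = subst (Split E x y x ∘ f) (sym e)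
        (E-trans xy (step y) , λ _ → trans (inside-lower x<y) (sym (after-upper x<y (gap (E-sym xy)))))
      step′ u (at-r refl e) = subst (Split E x y y ∘ f) (sym e)
        (E-trans (E-sym xy) (step x) , λ _ → trans (inside-upper x<y) (sym (after-lower x<y (gap xy))))
      step′ u (off p q e) = subst (Split E x y u ∘ f) (sym e)
        (step u , λ xu → inside-step x<y (p ∘ pos-injective) (q ∘ pos-injective) (gap (E-sym xu)) (gap (E-trans (E-sym xu) xy)))
      gap′ : ∀ u v → Split E x y u v → SwView x y u → ¬ Between (pos u) (pos v) (pos (f (sw x y u)))
      gap′ u v (uv , h) (at-l refl e) rewrite e =
        between-lower x<y (trans (sym (h E-refl)) (inside-lower x<y)) (gap (E-trans (E-sym xy) uv))
      gap′ u v (uv , h) (at-r refl e) rewrite e =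
        between-upper x<y (trans (sym (h xy)) (inside-upper x<y)) (gap (E-trans xy uv))
      gap′ u v (uv , h) (off _ _ e) rewrite e = gap uv

    planar-split : ∀ σ x y → x ≢ y → Orbit (to σ) x y → Planar (to σ) (Orbit (to σ)) →
      Planar (to (σ ⊙ x , y)) (Orbit (to (σ ⊙ x , y)))
    planar-split σ x y x≢y xy P with ℕ.<-cmp (pos x) (pos y)
    ... | tri< x<y _ _ = planar-rel (planar⇒orbit P′) (orbit⇒planar P′) P′
      where P′ = planar-split< σ x y P x<y xy
    ... | tri≈ _ x≡y _ = contradiction (pos-injective x≡y) x≢y
    ... | tri> _ _ y<x = planar-rel (planar⇒orbit P′) (orbit⇒planar P′) P′
      where P′ = planar-resp (λ u → cong (to σ) (sw-comm y x u)) (planar-split< σ y x P y<x (conn-sym xy))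

    extremal : {P : A → Set} (R : Rel A 0ℓ) → (∀ {x} → R x x) → (∀ {x y z} → R x y → R y z → R x z) →
      (∀ x y → R x y ⊎ R y x) → (∀ x → Dec (P x)) → ∀ x → P x → ∃[ y ] (P y × (∀ v → P v → R v y))
    extremal {P} R R-refl R-trans R-total P? x px with go elements
      where
      go : (L : List A) → ∃[ y ] (P y × (∀ {v} → v ∈ L → P v → R v y))
      go [] = x , px , λ ()
      go (w ∷ L) with go L | P? w
      ... | y , py , top | no ¬pw = y , py , λ { (here refl) pw → contradiction pw ¬pw ; (there i) → top i }
      ... | y , py , top | yes pw with R-total w y
      ... | inj₁ wy = y , py , λ { (here refl) _ → wy ; (there i) → top i }
      ... | inj₂ yw = w , pw , λ { (here refl) _ → R-refl ; (there i) pv → R-trans (top i pv) yw }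
    ... | y , py , top = y , py , λ v → top (∈-elements v)

    argmax : {P : A → Set} → (∀ x → Dec (P x)) → ∀ x → P x → ∃[ y ] (P y × (∀ v → P v → pos v ≤ pos y))
    argmax = extremal (λ x y → pos x ≤ pos y) ℕ.≤-refl ℕ.≤-trans (λ x y → ℕ.≤-total (pos x) (pos y))

    argmin : {P : A → Set} → (∀ x → Dec (P x)) → ∀ x → P x → ∃[ y ] (P y × (∀ v → P v → pos y ≤ pos v))
    argmin = extremal (λ x y → pos y ≤ pos x) ℕ.≤-refl (λ p q → ℕ.≤-trans q p) (λ x y → ℕ.≤-total (pos y) (pos x))

    -- Geodesics and noncrossing relations correspond

    module Realise (γ : A ↔ A) {c : ℕ} (γ-orbits : NumOrbits (Inverse.to γ) c)
      (γ-planar : Planar (Inverse.to γ) (Orbit (Inverse.to γ))) where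
      open Geodesics enum γ γ-orbits

      geodesic⇒planar : ∀ τ → Geodesic τ → Planar (to τ) (Orbit (to τ))
      geodesic⇒planar = geodesic-induct
        where
        open SplitInduction (λ f → Planar f (Orbit f))
          (λ f≗g P → planar-rel (orbit-resp f≗g) (orbit-resp (sym ∘ f≗g)) (planar-resp f≗g P)) γ-planar planar-split

      module _ (μ : Rel A 0ℓ) (μ-equiv : IsEquivalence μ) (μ? : ∀ x y → Dec (μ x y)) (μ-noncrossing : NonCrossing μ) where
        open IsEquivalence μ-equiv renaming (refl to μ-refl; sym to μ-sym; trans to μ-trans)

        -- Here K is the μ-class from σ x up to y. No μ-class crosses K, so inside the E-class of x the interval (x , y] is a union of μ-classes.
        μ⇒Split : ∀ {σ E} → Planar σ E → μ ⇒ E → ∀ {x y} → pos x < pos (σ x) →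
          (∀ v → μ v (σ x) → pos (σ x) ≤ pos v) → μ y (σ x) → (∀ v → μ v (σ x) → pos v ≤ pos y) → μ ⇒ Split E x y
        μ⇒Split {σ} {E} P μ⇒E {x} {y} x<w min yw max {u} {v} uv = μ⇒E uv , λ xu → iff xu uv
          where
          open Planar P
          w = σ x
          in? = inside (pos x) (pos y) ∘ pos
          from-class : ∀ {v} → μ v w → in? v ≡ true
          from-class {v} vw with in? v | insideView (pos x) (pos y) (pos v)
          ... | _ | below v≤x = contradiction (ℕ.<-≤-trans x<w (min v vw)) (ℕ.≤⇒≯ v≤x)
          ... | _ | within _ _ = refl
          ... | _ | above y<v = contradiction y<v (ℕ.≤⇒≯ (max v vw))
          one-way : ∀ {u v} → E x u → μ u v → in? u ≡ true → in? v ≡ true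
          one-way {u} {v} xu uv iu with μ? u w
          ... | yes uw = from-class (μ-trans (μ-sym uv) uw)
          ... | no ¬uw with in? u | insideView (pos x) (pos y) (pos u)
          one-way {u} {v} xu uv refl | no ¬uw | _ | within x<u u≤y = go
            where
            w<u : pos w < pos u
            w<u = ℕ.≤∧≢⇒< (ℕ.≮⇒≥ λ u<w → gap xu (inj₁ (x<u , u<w)))
              λ e → ¬uw (subst (λ z → μ z w) (pos-injective e) μ-refl)
            u<y : pos u < pos y
            u<y = ℕ.≤∧≢⇒< u≤y λ e → ¬uw (subst (λ z → μ z w) (sym (pos-injective e)) yw)
            go : in? v ≡ true
            go with in? v | insideView (pos x) (pos y) (pos v)
            ... | _ | below v≤x = contradiction
              (μ-trans uv (μ-noncrossing (ℕ.≤-<-trans v≤x x<w) w<u u<y (μ-sym uv) (μ-sym yw))) ¬uw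
            ... | _ | within _ _ = refl
            ... | _ | above y<v = contradiction (μ-sym (μ-noncrossing w<u u<y y<v (μ-sym yw) uv)) ¬uw
          iff : ∀ {u v} → E x u → μ u v → in? u ≡ in? v
          iff {u} {v} xu uv with in? u in iu | in? v in iv
          ... | true  | true  = refl
          ... | false | false = refl
          ... | true  | false = trans (sym (one-way xu uv iu)) iv
          ... | false | true  = trans (sym iu) (one-way (E-trans xu (μ⇒E uv)) (μ-sym uv) iv)

        -- Looks for an ascent from `x` to `σ x` at which `σ x` is the least point of its `μ`-class,
        -- and cuts off the interval from there to the greatest point of that class. Every cut uses
        -- up one of the `b` cycles of the complement.
        descend : ∀ b σ {a E} → NumOrbits (to σ) a → NumOrbits (to (κ σ)) b → a + b ≡ N + c →
          Planar (to σ) E → μ ⇒ E → ∃[ τ ] (Geodesic τ × Planar (to τ) μ)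
        descend b σ {a} {E} Ca Cb eq P μ⇒E with any-dec (λ x → (pos x <? pos (to σ x)) ×-dec
          all-dec (λ v → μ? v (to σ x) →-dec (pos (to σ x) ≤? pos v)))
        -- Without such an ascent the least point of each `μ`-class is entered by a wrap-around and
        -- is therefore least in its `E`-class, so an `E`-class contains only one `μ`-class.
        ... | no none = σ , (_ , _ , Ca , Cb , eq) , planar-rel E⇒μ μ⇒E P
          where
          open Planar P
          to-min : ∀ w → ∃[ k ] (μ k w × (∀ u → E k u → pos k ≤ pos u))
          to-min w with argmin (λ v → μ? v w) w μ-refl
          ... | k , kw , min = k , kw , λ u ku → ℕ.≮⇒≥ λ u<k → gap (E-trans (E-trans (step pre) (subst (E _) pre-k E-refl)) ku)
              (subst (Between (pos pre) (pos u) ∘ pos) (sym pre-k) (inj₂ (ℕ.≮⇒≥ pre≮k , inj₂ u<k)))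
            where
            pre = from σ k
            pre-k = strictlyInverseˡ σ k
            pre≮k : ¬ pos pre < pos k
            pre≮k p = none (pre , subst (λ z → pos pre < pos z × (∀ v → μ v z → pos z ≤ pos v)) (sym pre-k)
              (p , λ v vk → min v (μ-trans vk kw)))
          E⇒μ : E ⇒ μ
          E⇒μ {u} {v} uv with to-min u | to-min v
          ... | k , ku , mk | l , lv , ml = μ-trans (μ-sym ku) (subst (λ z → μ z v) (sym k≡l) lv)
            where
            kl : E k l
            kl = E-trans (μ⇒E ku) (E-trans uv (E-sym (μ⇒E lv)))
            k≡l : k ≡ l
            k≡l = pos-injective (ℕ.≤-antisym (mk l kl) (ml k (E-sym kl)))
        descend zero σ Ca Cb eq P μ⇒E | yes (x , _) with classes-positive x Cb
        ... | _ , ()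
        descend (suc b) σ {a} {E} Ca Cb eq P μ⇒E | yes (x , x<w , min) with argmax (λ v → μ? v (to σ x)) (to σ x) μ-refl
        ... | y , yw , max with geodesic-split σ x y Ca Cb eq (λ { refl → ℕ.<-irrefl refl x<y })
            (planar⇒orbit P xy)
          where
          open Planar P
          x<y = ℕ.<-≤-trans x<w (max (to σ x) μ-refl)
          xy : E x y
          xy = E-trans (step x) (μ⇒E (μ-sym yw))
        ... | b′ , refl , Ca′ , Cb′ , eq′ = descend b (σ ⊙ x , y) Ca′ Cb′ eq′
          (planar-split< σ x y P (ℕ.<-≤-trans x<w (max (to σ x) μ-refl)) (Planar.E-trans P (Planar.step P x) (μ⇒E (μ-sym yw))))
          (μ⇒Split P μ⇒E x<w min yw max)

        abstract
          realise : μ ⇒ Orbit (to γ) → ∃[ τ ] (Geodesic τ × Planar (to τ) μ)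
          -- The start is `γ` itself, whose complement is the identity with `N` cycles.
          realise μ⇒γ = descend N γ γ-orbits
            (classes-discrete (conn-equiv _) (Eqv.fold ≡.isEquivalence λ { {x} refl → sym (strictlyInverseʳ γ x) }))
            (ℕ.+-comm c N) γ-planar μ⇒γ

-- The permutation γ on its outer and inner circle

module Annulus (q : ℕ) where

  p n : ℕ
  p = suc q
  n = suc p

  abstract
    enum : X n ↔ Fin (2 * n)
    enum = ↔-trans (↔-sym Fin.2↔Bool ×-↔ ↔-refl) (↔-sym Fin.*↔×)

  open Finite enum
  open Transpositions enum

  idx : X n → ℕ
  idx = toℕ ∘ proj₂

  Outer Inner : X n → Set
  Outer x = idx x < p
  Inner x = idx x ≡ p

  place : ∀ x → Outer x ⊎ Inner x
  place (_ , i) = ℕ.m≤n⇒m<n∨m≡n (s≤s⁻¹ (Fin.toℕ<n i))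

  outer≢inner : ∀ {x} → Outer x → ¬ Inner x
  outer≢inner o e = ℕ.<-irrefl e o

  neg-neg : (x : X n) → neg (neg x) ≡ x
  neg-neg (s , i) = cong (_, i) (Bool.not-involutive s)

  idx-sign : ∀ {x y : X n} → idx x ≡ idx y → y ≡ x ⊎ y ≡ neg x
  idx-sign {s , i} {t , j} e with Fin.toℕ-injective e
  idx-sign {true  , i} {true  , _} e | refl = inj₁ refl
  idx-sign {true  , i} {false , _} e | refl = inj₂ refl
  idx-sign {false , i} {true  , _} e | refl = inj₂ refl
  idx-sign {false , i} {false , _} e | refl = inj₁ refl

  abstract
    -- Outer points occupy 0 … 2p-1 in the cyclic order of γ; then come n and -n.
    pos : X n → ℕ
    pos (s , i) with toℕ i <? p
    pos (true  , i) | yes _ = toℕ i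
    pos (false , i) | yes _ = p + toℕ i
    pos (true  , i) | no _  = p + p
    pos (false , i) | no _  = suc (p + p)

    side : X n → Fin 2
    side (s , i) with toℕ i <? p
    ... | yes _ = Fin.zero
    ... | no _  = Fin.suc Fin.zero

  data Location : X n → ℕ → Fin 2 → Set where
    out⁺ : ∀ {i} → toℕ i < p → Location (true , i) (toℕ i) Fin.zero
    out⁻ : ∀ {i} → toℕ i < p → Location (false , i) (p + toℕ i) Fin.zero
    inn⁺ : ∀ {i} → toℕ i ≡ p → Location (true , i) (p + p) (Fin.suc Fin.zero)
    inn⁻ : ∀ {i} → toℕ i ≡ p → Location (false , i) (suc (p + p)) (Fin.suc Fin.zero)

  abstract
    location : ∀ x → Location x (pos x) (side x)
    location (s , i) with toℕ i <? p
    location (true  , i) | yes o = out⁺ o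
    location (false , i) | yes o = out⁻ o
    location (true  , i) | no ¬o = inn⁺ ([ (λ o → contradiction o ¬o) , id ]′ (place (true , i)))
    location (false , i) | no ¬o = inn⁻ ([ (λ o → contradiction o ¬o) , id ]′ (place (true , i)))

  pos-outer : ∀ {x} → Outer x → pos x < p + p
  pos-outer {x} o with pos x | side x | location x
  ... | _ | _ | out⁺ _ = ℕ.m≤n⇒m≤o+n p o
  ... | _ | _ | out⁻ _ = ℕ.+-monoʳ-< p o
  ... | _ | _ | inn⁺ e = contradiction e (outer≢inner {x} o)
  ... | _ | _ | inn⁻ e = contradiction e (outer≢inner {x} o)

  pos-inner : ∀ {x} → Inner x → p + p ≤ pos x
  pos-inner {x} e with pos x | side x | location x
  ... | _ | _ | out⁺ o = contradiction e (outer≢inner {x} o)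
  ... | _ | _ | out⁻ o = contradiction e (outer≢inner {x} o)
  ... | _ | _ | inn⁺ _ = ℕ.≤-refl
  ... | _ | _ | inn⁻ _ = ℕ.n≤1+n _

  pos-max : ∀ x → pos x ≤ suc (p + p)
  pos-max x with pos x | side x | location x
  ... | _ | _ | out⁺ o = ℕ.≤-trans (ℕ.<⇒≤ o) (ℕ.m≤n⇒m≤1+n (ℕ.m≤m+n p p))
  ... | _ | _ | out⁻ o = ℕ.m≤n⇒m≤1+n (ℕ.+-monoʳ-≤ p (ℕ.<⇒≤ o))
  ... | _ | _ | inn⁺ _ = ℕ.n≤1+n _
  ... | _ | _ | inn⁻ _ = ℕ.≤-refl

  side-outer : ∀ {x} → Outer x → side x ≡ Fin.zero
  side-outer {x} o with pos x | side x | location x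
  ... | _ | _ | out⁺ _ = refl
  ... | _ | _ | out⁻ _ = refl
  ... | _ | _ | inn⁺ e = contradiction e (outer≢inner {x} o)
  ... | _ | _ | inn⁻ e = contradiction e (outer≢inner {x} o)

  side-inner : ∀ {x} → Inner x → side x ≡ Fin.suc Fin.zero
  side-inner {x} e with pos x | side x | location x
  ... | _ | _ | out⁺ o = contradiction e (outer≢inner {x} o)
  ... | _ | _ | out⁻ o = contradiction e (outer≢inner {x} o)
  ... | _ | _ | inn⁺ _ = refl
  ... | _ | _ | inn⁻ _ = refl

  same-outer : ∀ {x y} → side x ≡ side y → Outer x → Outer y
  same-outer {x} {y} e o with place y
  ... | inj₁ o′ = o′
  ... | inj₂ i with trans (sym (side-outer {x} o)) (trans e (side-inner {y} i))
  ... | ()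

  same-inner : ∀ {x y} → side x ≡ side y → Inner x → Inner y
  same-inner {x} {y} e i with place y
  ... | inj₂ i′ = i′
  ... | inj₁ o = contradiction i (outer≢inner {x} (same-outer {y} {x} (sym e) o))

  side-neg : ∀ x → side (neg x) ≡ side x
  side-neg x with place x
  ... | inj₁ o = trans (side-outer {neg x} o) (sym (side-outer {x} o))
  ... | inj₂ i = trans (side-inner {neg x} i) (sym (side-inner {x} i))

  below-outer : ∀ {x y} → pos x ≤ pos y → Outer y → Outer x
  below-outer {x} {y} x≤y o with place x
  ... | inj₁ o′ = o′
  ... | inj₂ i = contradiction (ℕ.≤-<-trans x≤y (pos-outer {y} o)) (ℕ.≤⇒≯ (pos-inner {x} i))

  pos-out⁺ : ∀ {i} → toℕ i < p → pos (true , i) ≡ toℕ i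
  pos-out⁺ {i} o with pos (true , i) | side (true , i) | location (true , i)
  ... | _ | _ | out⁺ _ = refl
  ... | _ | _ | inn⁺ e = contradiction o (ℕ.<-irrefl e)

  pos-out⁻ : ∀ {i} → toℕ i < p → pos (false , i) ≡ p + toℕ i
  pos-out⁻ {i} o with pos (false , i) | side (false , i) | location (false , i)
  ... | _ | _ | out⁻ _ = refl
  ... | _ | _ | inn⁻ e = contradiction o (ℕ.<-irrefl e)

  pos-inn⁺ : ∀ {i} → toℕ i ≡ p → pos (true , i) ≡ p + p
  pos-inn⁺ {i} e with pos (true , i) | side (true , i) | location (true , i)
  ... | _ | _ | out⁺ o = contradiction o (ℕ.<-irrefl e)
  ... | _ | _ | inn⁺ _ = refl

  pos-inn⁻ : ∀ {i} → toℕ i ≡ p → pos (false , i) ≡ suc (p + p)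
  pos-inn⁻ {i} e with pos (false , i) | side (false , i) | location (false , i)
  ... | _ | _ | out⁻ o = contradiction o (ℕ.<-irrefl e)
  ... | _ | _ | inn⁻ _ = refl

  outer-inner-pos : ∀ {x y} → Outer x → Inner y → pos x < pos y
  outer-inner-pos {x} {y} o i = ℕ.<-≤-trans (pos-outer {x} o) (pos-inner {y} i)

  sign-order : ∀ {i j} → toℕ i < p → toℕ j < p → pos (true , i) < pos (false , j)
  sign-order o o′ = subst₂ _<_ (sym (pos-out⁺ o)) (sym (pos-out⁻ o′)) (ℕ.<-≤-trans o (ℕ.m≤m+n p _))

  pos-injective : ∀ {x y} → pos x ≡ pos y → x ≡ y
  pos-injective {x} {y} e with place x | place y
  ... | inj₁ o | inj₂ i = contradiction e (ℕ.<⇒≢ (outer-inner-pos {x} {y} o i))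
  ... | inj₂ i | inj₁ o = contradiction (sym e) (ℕ.<⇒≢ (outer-inner-pos {y} {x} o i))
  pos-injective {true  , _} {true  , _} e | inj₁ o | inj₁ o′ =
    cong (true ,_) (Fin.toℕ-injective (trans (sym (pos-out⁺ o)) (trans e (pos-out⁺ o′))))
  pos-injective {true  , _} {false , _} e | inj₁ o | inj₁ o′ = contradiction e (ℕ.<⇒≢ (sign-order o o′))
  pos-injective {false , _} {true  , _} e | inj₁ o | inj₁ o′ = contradiction (sym e) (ℕ.<⇒≢ (sign-order o′ o))
  pos-injective {false , _} {false , _} e | inj₁ o | inj₁ o′ =
    cong (false ,_) (Fin.toℕ-injective (ℕ.+-cancelˡ-≡ p _ _ (trans (sym (pos-out⁻ o)) (trans e (pos-out⁻ o′)))))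
  pos-injective {true  , _} {true  , _} e | inj₂ i | inj₂ i′ = cong (true ,_) (Fin.toℕ-injective (trans i (sym i′)))
  pos-injective {true  , _} {false , _} e | inj₂ i | inj₂ i′ =
    contradiction (trans (sym (pos-inn⁻ i′)) (trans (sym e) (pos-inn⁺ i))) ℕ.1+n≢n
  pos-injective {false , _} {true  , _} e | inj₂ i | inj₂ i′ =
    contradiction (trans (sym (pos-inn⁻ i)) (trans e (pos-inn⁺ i′))) ℕ.1+n≢n
  pos-injective {false , _} {false , _} e | inj₂ i | inj₂ i′ = cong (false ,_) (Fin.toℕ-injective (trans i (sym i′)))

  open Linear pos pos-injective public

  -- A relational form of `γ`: functionality, injectivity and equivariance become case analyses
  -- instead of arguments about nested decisions.
  data Rotation : X n → X n → Set where
    flip : ∀ {s t i} → t ≡ not s → toℕ i ≡ p → Rotation (s , i) (t , i)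
    wrap : ∀ {s t i} → t ≡ not s → suc (toℕ i) ≡ p → Rotation (s , i) (t , Fin.zero)
    next : ∀ {s i j} → toℕ j ≡ suc (toℕ i) → suc (toℕ i) < p → Rotation (s , i) (s , j)

  rotation : ∀ x → Rotation x (γ x)
  rotation (s , i) with toℕ i ℕ.≟ p
  ... | yes e = flip refl e
  ... | no i≠p with Fin.suc (lower₁ i (λ e → i≠p (sym e))) Fin.≟ fromℕ p
  ... | yes e = wrap refl (trans (sym (cong suc (Fin.toℕ-lower₁ i (λ e → i≠p (sym e))))) (trans (cong toℕ e) (Fin.toℕ-fromℕ p)))
  ... | no ne = next (cong suc (Fin.toℕ-lower₁ i (λ e → i≠p (sym e))))
    (ℕ.≤∧≢⇒< ([ id , (λ e → contradiction e i≠p) ]′ (place (s , i)))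
      λ e → ne (Fin.toℕ-injective (trans (cong suc (Fin.toℕ-lower₁ i (λ e → i≠p (sym e)))) (trans e (sym (Fin.toℕ-fromℕ p))))))

  rotation-functional : ∀ {x y z} → Rotation x y → Rotation x z → y ≡ z
  rotation-functional (flip refl _) (flip refl _) = refl
  rotation-functional (flip _ e) (wrap _ f) = contradiction (trans f (sym e)) ℕ.1+n≢n
  rotation-functional (flip _ e) (next _ l) = contradiction (ℕ.<-trans (ℕ.n<1+n _) l) (ℕ.<-irrefl e)
  rotation-functional (wrap _ f) (flip _ e) = contradiction (trans f (sym e)) ℕ.1+n≢n
  rotation-functional (wrap refl _) (wrap refl _) = refl
  rotation-functional (wrap _ f) (next _ l) = contradiction l (ℕ.<-irrefl f)
  rotation-functional (next _ l) (flip _ e) = contradiction (ℕ.<-trans (ℕ.n<1+n _) l) (ℕ.<-irrefl e)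
  rotation-functional (next _ l) (wrap _ f) = contradiction l (ℕ.<-irrefl f)
  rotation-functional (next e _) (next f _) = cong (_ ,_) (Fin.toℕ-injective (trans e (sym f)))

  rotation-injective : ∀ {x y z} → Rotation x z → Rotation y z → x ≡ y
  rotation-injective (flip e _) (flip f _) = cong (_, _) (Bool.not-injective (trans (sym e) f))
  rotation-injective (flip _ ()) (wrap _ _)
  rotation-injective (flip _ e) (next f l) = contradiction (trans (sym f) e) (ℕ.<⇒≢ l)
  rotation-injective (wrap _ _) (flip _ ())
  rotation-injective (wrap e i) (wrap f j) = cong₂ _,_ (Bool.not-injective (trans (sym e) f))
    (Fin.toℕ-injective (ℕ.suc-injective (trans i (sym j))))
  rotation-injective (wrap _ _) (next () _)
  rotation-injective (next f l) (flip _ e) = contradiction (trans (sym f) e) (ℕ.<⇒≢ l)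
  rotation-injective (next () _) (wrap _ _)
  rotation-injective (next e _) (next f _) = cong (_ ,_) (Fin.toℕ-injective (ℕ.suc-injective (trans (sym e) f)))

  rotation-neg : ∀ {x y} → Rotation x y → Rotation (neg x) (neg y)
  rotation-neg (flip e i) = flip (cong not e) i
  rotation-neg (wrap e i) = wrap (cong not e) i
  rotation-neg (next e l) = next e l

  γ-neg : (x : X n) → γ (neg x) ≡ neg (γ x)
  γ-neg x = rotation-functional (rotation (neg x)) (rotation-neg (rotation x))

  abstract
    -- Its forward map is `γ`; only the inverse is passed on to `γ-perm`, whose forward map thus
    -- reduces to `γ` while the inverse, found by a search for periods, stays opaque.
    γ⁻¹ : X n ↔ X n
    γ⁻¹ = injective⇒perm γ λ {x} {y} e → rotation-injective (rotation x) (subst (Rotation y) (sym e) (rotation y))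

    γ⁻¹-to : ∀ x → to γ⁻¹ x ≡ γ x
    γ⁻¹-to _ = refl

  γ-perm : X n ↔ X n
  γ-perm = mk↔ₛ′ γ (from γ⁻¹) (λ y → trans (sym (γ⁻¹-to _)) (strictlyInverseˡ γ⁻¹ y))
    (λ x → trans (cong (from γ⁻¹) (sym (γ⁻¹-to x))) (strictlyInverseʳ γ⁻¹ x))

  SameSide : Rel (X n) 0ℓ
  SameSide x y = side x ≡ side y

  rotation-side : ∀ {x y} → Rotation x y → SameSide x y
  rotation-side {x} (flip refl e) = sym (side-neg x)
  rotation-side {x} {y} (wrap refl e) = trans (side-outer {x} (ℕ.≤-reflexive e)) (sym (side-outer {y} (s≤s z≤n)))
  rotation-side {x} {y} (next e l) = trans (side-outer {x} (ℕ.<-trans (ℕ.n<1+n _) l)) (sym (side-outer {y} (subst (_< p) (sym e) l)))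

  between-suc : ∀ {a b c} → c ≡ suc a → ¬ Between a b c
  between-suc refl (inj₁ (a<b , b<c)) = ℕ.<⇒≱ a<b (s≤s⁻¹ b<c)
  between-suc refl (inj₂ (c≤a , _))   = ℕ.1+n≰n c≤a

  between-extremes : ∀ {a b c} → b ≤ a → c ≤ b → ¬ Between a b c
  between-extremes b≤a c≤b (inj₁ (a<b , _))        = ℕ.<⇒≱ a<b b≤a
  between-extremes b≤a c≤b (inj₂ (_ , inj₁ a<b)) = ℕ.<⇒≱ a<b b≤a
  between-extremes b≤a c≤b (inj₂ (_ , inj₂ b<c)) = ℕ.<⇒≱ b<c c≤b

  -- `γ` raises the position by one except at -n and -(n-1), which it takes from the last position
  -- of their side to the first.
  rotation-gap : ∀ {x u y} → Rotation x y → SameSide x u → ¬ Between (pos x) (pos u) (pos y)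
  rotation-gap {true , i} (flip refl e) _ = between-suc (trans (pos-inn⁻ e) (cong suc (sym (pos-inn⁺ e))))
  rotation-gap {false , i} {u} (flip refl e) s = between-extremes
    (subst (pos u ≤_) (sym (pos-inn⁻ e)) (pos-max u))
    (subst (_≤ pos u) (sym (pos-inn⁺ e)) (pos-inner {u} (same-inner {false , i} {u} s e)))
  rotation-gap {true , i} (wrap refl e) _ = between-suc (trans (pos-out⁻ {Fin.zero} (s≤s z≤n))
    (trans (ℕ.+-identityʳ p) (sym (trans (cong suc (pos-out⁺ (ℕ.≤-reflexive e))) e))))
  rotation-gap {false , i} {u} (wrap refl e) s = between-extremes
    (s≤s⁻¹ (subst (pos u <_) (sym (trans (cong suc (pos-out⁻ (ℕ.≤-reflexive e))) (trans (sym (ℕ.+-suc p (toℕ i))) (cong (p +_) e))))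
      (pos-outer {u} (same-outer {false , i} {u} s (ℕ.≤-reflexive e)))))
    (subst (_≤ pos u) (sym (pos-out⁺ {Fin.zero} (s≤s z≤n))) z≤n)
  rotation-gap {true , i} {y = _ , j} (next e l) _ = between-suc
    (trans (pos-out⁺ (subst (_< p) (sym e) l)) (trans e (cong suc (sym (pos-out⁺ (ℕ.<-trans (ℕ.n<1+n _) l))))))
  rotation-gap {false , i} {y = _ , j} (next e l) _ = between-suc
    (trans (pos-out⁻ (subst (_< p) (sym e) l)) (trans (cong (p +_) e)
      (trans (ℕ.+-suc p (toℕ i)) (cong suc (sym (pos-out⁻ (ℕ.<-trans (ℕ.n<1+n _) l)))))))

  -- Inner points hold the last two positions, so an inner `b` leaves no room for two later points.
  crossing-outer : ∀ {b c d} → pos b < pos c → pos c < pos d → SameSide b d → Outer d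
  crossing-outer {b} {c} {d} b<c c<d e with place b
  ... | inj₁ o = same-outer {b} {d} e o
  ... | inj₂ i = contradiction (pos-max d) (ℕ.<⇒≱ (ℕ.≤-<-trans (ℕ.≤-trans (s≤s (pos-inner {b} i)) b<c) c<d))

  sameSide-noncrossing : NonCrossing SameSide
  sameSide-noncrossing {a} {b} {c} {d} a<b b<c c<d _ bd = trans (side-outer {a} oa) (sym (side-outer {b} ob))
    where
    ob = below-outer {b} {d} (ℕ.<⇒≤ (ℕ.<-trans b<c c<d)) (crossing-outer {b} {c} {d} b<c c<d bd)
    oa = below-outer {a} {b} (ℕ.<⇒≤ a<b) ob

  abstract
    γ-planar-side : Planar γ SameSide
    γ-planar-side = record
      { equiv = record { refl = refl ; sym = sym ; trans = trans }
      ; step = rotation-side ∘ rotation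
      ; gap = λ {x} {u} → rotation-gap {x} {u} (rotation x)
      ; noncrossing = λ {a} {b} {c} {d} → sameSide-noncrossing {a} {b} {c} {d} }

  γ-planar : Planar γ (Orbit γ)
  γ-planar = planar-rel (planar⇒orbit γ-planar-side) (orbit⇒planar γ-planar-side) γ-planar-side

  ι : Bool → X n
  ι s = s , fromℕ p

  ι-inner : ∀ s → Inner (ι s)
  ι-inner _ = Fin.toℕ-fromℕ p

  inner-ι : ∀ x → Inner x → ∃[ s ] x ≡ ι s
  inner-ι (s , i) e = s , cong (s ,_) (Fin.toℕ-injective (trans e (sym (Fin.toℕ-fromℕ p))))

  γ-orbits : NumOrbits γ 2
  γ-orbits = classes-resp {E = SameSide} (planar⇒orbit γ-planar-side) (orbit⇒planar γ-planar-side)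
    (side , (λ { Fin.zero → (true , Fin.zero) , λ { refl → side-outer {true , Fin.zero} (s≤s z≤n) }
               ; (Fin.suc Fin.zero) → ι true , λ { refl → side-inner {ι true} (ι-inner true) } }) ,
     λ x y → mk⇔ id id)

  open Geodesics enum γ-perm γ-orbits public
  open Realise enum γ-perm γ-orbits γ-planar public

-- Compatibility with negation and the partitions without a cut

orbits-conj : ∀ {A : Set} {f g : A → A} (h : A → A) → (∀ x → h (h x) ≡ x) → (∀ x → h (f x) ≡ g (h x)) →
  ∀ {k} → NumOrbits f k → NumOrbits g k
orbits-conj {A} {f} {g} h hh comm {k} (c , surj , ker) = c ∘ h , surj′ , λ x y → mk⇔
  (λ p → ⇒to (ker _ _) (Eqv.gmap h (λ { {x} refl → back x }) p))
  (λ e → subst₂ (Orbit g) (hh x) (hh y) (Eqv.gmap h (λ { {x} refl → comm x }) (⇒from (ker _ _) e)))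
  where
  back : ∀ x → h (g x) ≡ f (h x)
  back x = trans (cong (h ∘ g) (sym (hh x))) (trans (cong h (sym (comm (h x)))) (hh _))
  surj′ : Surjective _≡_ _≡_ (c ∘ h)
  surj′ i = h (proj₁ (surj i)) , λ { refl → trans (cong c (hh _)) (proj₂ (surj i) refl) }

module TypeB (q : ℕ) where
  open Annulus q

  record Good (E : Rel (X n) 0ℓ) : Set where
    field
      equiv       : IsEquivalence E
      dec         : ∀ x y → Dec (E x y)
      E-neg       : ∀ {x y} → E x y → E (neg x) (neg y)
      noncrossing : NonCrossing E
      E-side      : ∀ {x y} → E x y → SameSide x y
    open IsEquivalence equiv public renaming (refl to E-refl; sym to E-sym; trans to E-trans)

    zero-resp : ∀ {x y} → E x y → E x (neg x) → E y (neg y)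
    zero-resp xy xz = E-trans (E-sym xy) (E-trans xz (E-neg xy))

    zero-neg : ∀ {x} → E x (neg x) → E (neg x) (neg (neg x))
    zero-neg = E-neg

    E-neg⁻ : ∀ {x y} → E (neg x) (neg y) → E x y
    E-neg⁻ {x} {y} e = subst₂ E (neg-neg x) (neg-neg y) (E-neg e)

  from-resp : ∀ {A : Set} (σ τ : A ↔ A) → to σ ≗ to τ → from σ ≗ from τ
  from-resp σ τ e x = to-injective σ (trans (strictlyInverseˡ σ x) (trans (sym (strictlyInverseˡ τ x)) (sym (e _))))

  inB-from : (τ : Perm n) → InB τ → ∀ x → from τ (neg x) ≡ neg (from τ x)
  inB-from τ B x = to-injective τ (trans (strictlyInverseˡ τ _) (trans (cong neg (sym (strictlyInverseˡ τ x))) (sym (B _))))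

  conj : Perm n → Perm n
  conj τ = mk↔ₛ′ (neg ∘ to τ ∘ neg) (neg ∘ from τ ∘ neg)
    (λ x → trans (cong (neg ∘ to τ) (neg-neg _)) (trans (cong neg (strictlyInverseˡ τ _)) (neg-neg x)))
    (λ x → trans (cong (neg ∘ from τ) (neg-neg _)) (trans (cong neg (strictlyInverseʳ τ _)) (neg-neg x)))

  conj-geodesic : ∀ τ → Geodesic τ → Geodesic (conj τ)
  conj-geodesic τ (a , b , Ca , Cb , eq) = a , b ,
    orbits-conj neg neg-neg (λ x → cong (neg ∘ to τ) (sym (neg-neg x))) Ca ,
    orbits-conj neg neg-neg (λ x → cong (neg ∘ from τ) (sym (trans (cong neg (γ-neg x)) (neg-neg _)))) Cb , eq

  abstract
    -- Conjugating the realising permutation by `neg` gives a geodesic with the same orbits, which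
    -- is again planar for `pos`. Planar maps of a given relation are unique, so the two coincide;
    -- this stands in for a direct check that negation preserves the cyclic order.
    realiseB : ∀ {E} → Good E → ∃[ τ ] (Geodesic τ × Planar (to τ) E × InB τ)
    realiseB {E} G with realise E equiv dec noncrossing (planar⇒orbit γ-planar-side ∘ E-side)
      where open Good G
    ... | τ , geo , P = τ , geo , P , λ x → trans (sym (neg-neg _)) (cong neg (same x))
      where
      open Good G
      orbit-conj : Orbit (to (conj τ)) ⇒ E
      orbit-conj p = E-neg⁻ (orbit⇒planar P (Eqv.gmap neg (λ { {x} refl → neg-neg _ }) p))
      conj-orbit : E ⇒ Orbit (to (conj τ))
      conj-orbit {x} {y} e = subst₂ (Orbit (to (conj τ))) (neg-neg x) (neg-neg y)
        (Eqv.gmap neg (λ { {x} refl → cong (neg ∘ to τ) (sym (neg-neg x)) }) (planar⇒orbit P (E-neg e)))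
      same : ∀ x → to (conj τ) x ≡ to τ x
      same = planar-unique (planar-rel orbit-conj conj-orbit (geodesic⇒planar (conj τ) (conj-geodesic τ geo))) P

  Zero : Rel (X n) 0ℓ → X n → Set
  Zero E x = E x (neg x)

  Merge : Rel (X n) 0ℓ → Rel (X n) 0ℓ
  Merge E x y = E x y ⊎ (Zero E x × Zero E y)

  selfNeg⇔zero : ∀ {E} → Good E → (τ : Perm n) → Orb τ ⇒ E → E ⇒ Orb τ → ∀ x → SelfNeg τ x ⇔ Zero E x
  selfNeg⇔zero {E} G τ O⇒E E⇒O x = mk⇔ (λ s → O⇒E (⇒to (s x) ε)) λ z y → mk⇔
    (λ p → E⇒O (E-trans z (E-neg (O⇒E p))))
    (λ p → E⇒O (E-trans z (subst (E (neg x)) (neg-neg y) (E-neg (O⇒E p)))))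
    where open Good G

  merge⇔Ωt : ∀ {E} → Good E → (τ : Perm n) → Orb τ ⇒ E → E ⇒ Orb τ → Merge E ⇔′ Ωt τ
  merge⇔Ωt G τ O⇒E E⇒O x y = mk⇔
    [ inj₁ ∘ E⇒O , (λ { (zx , zy) → inj₂ (⇒from (S x) zx , ⇒from (S y) zy) }) ]′
    [ inj₁ ∘ O⇒E , (λ { (sx , sy) → inj₂ (⇒to (S x) sx , ⇒to (S y) sy) }) ]′
    where S = selfNeg⇔zero G τ O⇒E E⇒O

  Either : Perm n → Rel (X n) 0ℓ
  Either τ x y = Graph (to τ) x y ⊎ Graph γ x y

  orbits₂-side : (τ : Perm n) → (∀ x → SameSide x (to τ x)) → NumOrbits₂ (to τ) γ 2
  orbits₂-side τ keep = classes-resp {E = Orbit γ} {F = Conn (Either τ)} (conn-gen (edge ∘ inj₂)) (conn-gen back) γ-orbits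
    where
    back : Either τ ⇒ Orbit γ
    back {x} (inj₁ refl) = planar⇒orbit γ-planar-side (keep x)
    back (inj₂ e) = edge e

  geodesic⇒snc : (τ : Perm n) → Geodesic τ → (∀ x → SameSide x (to τ x)) → InSnc τ
  geodesic⇒snc τ (a , b , Ca , Cb , eq) keep = a , b , 2 , 2 , Ca , Cb , γ-orbits , orbits₂-side τ keep ,
      trans (cong (_+ 2) eq) (ℕ.+-assoc (2 * n) 2 2)

  merge-NCB : ∀ {E} → Good E → NCB n (Merge E)
  merge-NCB {E} G with realiseB G
  ... | τ , geo , P , B = τ , B , geodesic⇒snc τ geo (λ x → Good.E-side G (Planar.step P x)) ,
    merge⇔Ωt G τ (orbit⇒planar P) (planar⇒orbit P)

  -- Equivariance makes {n , -n} invariant as soon as n stays inside it, and then its complement is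
  -- invariant too.
  keeps-sides : (τ : Perm n) → InB τ → Inner (to τ (ι true)) → ∀ x → SameSide x (to τ x)
  keeps-sides τ B i x with place x | place (to τ x)
  ... | inj₁ o | inj₁ o′ = trans (side-outer {x} o) (sym (side-outer {to τ x} o′))
  ... | inj₂ j | inj₂ j′ = trans (side-inner {x} j) (sym (side-inner {to τ x} j′))
  ... | inj₂ j | inj₁ o′ with inner-ι x j
  ... | true  , refl = contradiction i (outer≢inner {to τ (ι true)} o′)
  ... | false , refl = contradiction (subst Inner (sym (B (ι true))) i) (outer≢inner {to τ (ι false)} o′)
  keeps-sides τ B i x | inj₁ o | inj₂ j′ with idx-sign {to τ (ι true)} {to τ x} (trans i (sym j′))
  ... | inj₁ e = contradiction (subst Inner (sym (to-injective τ e)) (ι-inner true)) (outer≢inner {x} o)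
  ... | inj₂ e = contradiction (subst Inner (sym (to-injective τ (trans e (sym (B (ι true)))))) (ι-inner false)) (outer≢inner {x} o)

  orbit-good : (τ : Perm n) → Geodesic τ → InB τ → (∀ x → SameSide x (to τ x)) → Good (Orb τ)
  orbit-good τ geo@(_ , _ , Ca , _) B keep = record
    { equiv = conn-equiv _ ; dec = classes-dec Ca
    ; E-neg = Eqv.gmap neg λ { {x} refl → sym (B x) }
    ; noncrossing = Planar.noncrossing (geodesic⇒planar τ geo)
    ; E-side = Eqv.fold (Planar.equiv γ-planar-side) λ { {x} refl → keep x } }

  extract-merge : (τ : Perm n) → InB τ → InSnc τ → Inner (to τ (ι true)) → ∃[ E ] (Good E × Merge E ⇔′ Ωt τ)
  extract-merge τ B (a , b , c , d , Ca , Cb , Cc , Cd , eq) i =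
    Orb τ , G , merge⇔Ωt G τ id id
    where
    keep = keeps-sides τ B i
    geo : Geodesic τ
    geo with classes-unique Cc γ-orbits | classes-unique Cd (orbits₂-side τ keep)
    ... | refl | refl = a , b , Ca , Cb , ℕ.+-cancelʳ-≡ 2 _ _ (trans eq (sym (ℕ.+-assoc (2 * n) 2 2)))
    G = orbit-good τ geo B keep

-- Twisting by two opposite transpositions

module Twist (q : ℕ) where
  open Annulus q
  open Finite enum
  open Transpositions enum
  open TypeB q

  orbit-fixed : (σ : Perm n) → ∀ {x u} → to σ x ≡ x → Orb σ x u → u ≡ x
  orbit-fixed σ {x} {u} fix p with orbit⇒iter σ p
  ... | k , e = trans (sym e) (stay k)
    where
    stay : ∀ k → iter (to σ) k x ≡ x
    stay zero    = refl
    stay (suc k) = trans (cong (to σ) (stay k)) fix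

  neg-≢ : (x : X n) → neg x ≢ x
  neg-≢ (true  , _) ()
  neg-≢ (false , _) ()

  outer≢ι : ∀ {x} → Outer x → ∀ s → x ≢ ι s
  outer≢ι {x} o s refl = outer≢inner {x} o (ι-inner s)

  -- Signs are crossed to suit a `σ` with σ(n) = -n: then `twist σ z` sends n to `z`, and conversely
  -- a permutation sending n to `z` is twisted into one sending n to -n.
  t : X n → X n → X n
  t z = sw (neg z) (ι true) ∘ sw z (ι false)

  module _ (z : X n) (o : Outer z) where

    t-z : t z z ≡ ι false
    t-z = trans (cong (sw (neg z) (ι true)) (sw-l z (ι false))) (sw-o _ _ (outer≢ι {neg z} o false ∘ sym) λ ())

    t-z⁻ : t z (neg z) ≡ ι true
    t-z⁻ = trans (cong (sw (neg z) (ι true)) (sw-o z (ι false) (neg-≢ z) (outer≢ι {neg z} o false))) (sw-l _ _)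

    t-ι⁺ : t z (ι true) ≡ neg z
    t-ι⁺ = trans (cong (sw (neg z) (ι true)) (sw-o z (ι false) (outer≢ι {z} o true ∘ sym) λ ())) (sw-r _ _)

    t-ι⁻ : t z (ι false) ≡ z
    t-ι⁻ = trans (cong (sw (neg z) (ι true)) (sw-r z (ι false))) (sw-o _ _ (neg-≢ z ∘ sym) (outer≢ι {z} o true))

    t-off : ∀ {u} → u ≢ z → u ≢ neg z → u ≢ ι true → u ≢ ι false → t z u ≡ u
    t-off a b c d = trans (cong (sw (neg z) (ι true)) (sw-o z (ι false) a d)) (sw-o _ _ b c)

    data TView (u : X n) : Set where
      at-z   : u ≡ z → TView u
      at-z⁻  : u ≡ neg z → TView u
      at-ι⁺  : u ≡ ι true → TView u
      at-ι⁻  : u ≡ ι false → TView u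
      at-off : u ≢ z → u ≢ neg z → u ≢ ι true → u ≢ ι false → TView u

    tView : ∀ u → TView u
    tView u with decEq u z | decEq u (neg z) | decEq u (ι true) | decEq u (ι false)
    ... | yes e | _     | _     | _     = at-z e
    ... | no _  | yes e | _     | _     = at-z⁻ e
    ... | no _  | no _  | yes e | _     = at-ι⁺ e
    ... | no _  | no _  | no _  | yes e = at-ι⁻ e
    ... | no a  | no b  | no c  | no d  = at-off a b c d

    t-involutive : ∀ u → t z (t z u) ≡ u
    t-involutive u with tView u
    ... | at-z refl  = trans (cong (t z) t-z) t-ι⁻
    ... | at-z⁻ refl = trans (cong (t z) t-z⁻) t-ι⁺
    ... | at-ι⁺ refl = trans (cong (t z) t-ι⁺) t-z⁻
    ... | at-ι⁻ refl = trans (cong (t z) t-ι⁻) t-z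
    ... | at-off a b c d = trans (cong (t z) (t-off a b c d)) (t-off a b c d)

    t-neg : ∀ u → t z (neg u) ≡ neg (t z u)
    t-neg u with tView u
    ... | at-z refl  = trans t-z⁻ (cong neg (sym t-z))
    ... | at-z⁻ refl = trans (cong (t z) (neg-neg z)) (trans t-z (cong neg (sym t-z⁻)))
    ... | at-ι⁺ refl = trans t-ι⁻ (trans (sym (neg-neg z)) (cong neg (sym t-ι⁺)))
    ... | at-ι⁻ refl = trans t-ι⁺ (cong neg (sym t-ι⁻))
    ... | at-off a b c d = trans (t-off (flipped b) (a ∘ neg-inj) (flipped d) (flipped c)) (cong neg (sym (t-off a b c d)))
      where
      neg-inj : ∀ {x y : X n} → neg x ≡ neg y → x ≡ y
      neg-inj {x} {y} e = trans (sym (neg-neg x)) (trans (cong neg e) (neg-neg y))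
      flipped : ∀ {x : X n} → u ≢ neg x → neg u ≢ x
      flipped u≢ e = u≢ (trans (sym (neg-neg u)) (cong neg e))

  twist : Perm n → X n → Perm n
  twist σ z = neg z , ι true ⊚ (z , ι false ⊚ σ)

  twist-inB : ∀ σ z → Outer z → InB σ → InB (twist σ z)
  twist-inB σ z o B x = trans (cong (t z) (B x)) (t-neg z o _)

  module TwistOrbits (σ : Perm n) (B : InB σ) (flip-ι : to σ (ι true) ≡ ι false) (z : X n) (o : Outer z) where

    flip-ι⁻ : to σ (ι false) ≡ ι true
    flip-ι⁻ = trans (B (ι true)) (cong neg flip-ι)

    keep : ∀ x → SameSide x (to σ x)
    keep = keeps-sides σ B (subst Inner (sym flip-ι) (ι-inner false))

    orbit-side : Orb σ ⇒ SameSide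
    orbit-side = Eqv.fold (Planar.equiv γ-planar-side) λ { {x} refl → keep x }

    outer-≁ι : ∀ {x} → Outer x → ∀ s → ¬ Orb σ x (ι s)
    outer-≁ι {x} ox s p = outer≢inner {x} ox (same-inner {ι s} {x} (sym (orbit-side p)) (ι-inner s))

    private
      σ₁ : Perm n
      σ₁ = z , ι false ⊚ σ

      z≁ι : ¬ Orb σ z (ι false)
      z≁ι = outer-≁ι {z} o false

    -- Multiplying by (z , -n) joins the orbit of z with {n , -n}; the second transposition then splits
    -- the result exactly when -z already lay in the orbit of z.
    orbits-zero : ∀ {a} → NumOrbits (to σ) a → Orb σ z (neg z) → NumOrbits (to (twist σ z)) a
    orbits-zero C zz with orbits-mergeˡ σ z (ι false) z≁ι C
    ... | a′ , refl , C′ = orbits-splitˡ σ₁ (neg z) (ι true) C′ (outer≢ι {neg z} o true)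
      (conn-sym (merge-⊇ˡ σ z (ι false) z≁ι zz) ◅◅ mergedˡ σ z (ι false) z≁ι ◅◅ merge-⊇ˡ σ z (ι false) z≁ι (edge (sym flip-ι⁻)))

    orbits-nonzero : ∀ {a} → NumOrbits (to σ) a → ¬ Orb σ z (neg z) → ∃[ a′ ] (a ≡ 2 + a′ × NumOrbits (to (twist σ z)) a′)
    orbits-nonzero C ¬zz with orbits-mergeˡ σ z (ι false) z≁ι C
    ... | a₁ , refl , C₁ with orbits-mergeˡ σ₁ (neg z) (ι true) ≁₁ C₁
      where
      -- `P` is the `σ`-cycle of -z. The first transposition moves only `z` and -n, both outside it,
      -- so in `σ₁` it is still apart from n and the second transposition merges as well.
      P : X n → Set
      P u = Orb σ (neg z) u
      Iff : Rel (X n) 0ℓ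
      Iff u v = (P u → P v) × (P v → P u)
      iff-equiv : IsEquivalence Iff
      iff-equiv = record { refl = id , id ; sym = λ { (f , g) → g , f } ; trans = λ { (f , g) (h , k) → h ∘ f , g ∘ k } }
      ¬Pz : ¬ P z
      ¬Pz = ¬zz ∘ conn-sym
      ¬Pι : ¬ P (ι false)
      ¬Pι = outer-≁ι {neg z} o false
      P-step : ∀ u → Iff u (to σ u)
      P-step u = (λ p → p ◅◅ edge refl) , (λ p → p ◅◅ conn-sym (edge refl))
      P-sw : ∀ u → Iff u (sw z (ι false) u)
      P-sw u with swView z (ι false) u
      ... | at-l refl e = (λ p → contradiction p ¬Pz) , (λ p → contradiction (subst P e p) ¬Pι)
      ... | at-r refl e = (λ p → contradiction p ¬Pι) , (λ p → contradiction (subst P e p) ¬Pz)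
      ... | off _ _ e   = subst P (sym e) , subst P e
      ≁₁ : ¬ Orb σ₁ (neg z) (ι true)
      ≁₁ p = outer-≁ι {neg z} o true (proj₁ (Eqv.fold iff-equiv
        (λ { {x} refl → IsEquivalence.trans iff-equiv (P-step x) (P-sw (to σ x)) }) p) ε)
    ... | a₂ , refl , C₂ = a₂ , refl , C₂

    private
      z′ : X n
      z′ = from σ z

      z′-outer : Outer z′
      z′-outer = same-outer {z} {z′} (trans (cong side (sym (strictlyInverseˡ σ z))) (sym (keep z′))) o

      from-ι⁺ : from σ (ι false) ≡ ι true
      from-ι⁺ = trans (cong (from σ) (sym flip-ι)) (strictlyInverseʳ σ _)

      from-ι⁻ : from σ (ι true) ≡ ι false
      from-ι⁻ = trans (cong (from σ) (sym flip-ι⁻)) (strictlyInverseʳ σ _)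

      γ-ι : ∀ s → γ (ι s) ≡ ι (not s)
      γ-ι s = rotation-functional (rotation (ι s)) (flip refl (ι-inner s))

      κ-ι : ∀ s → to (κ σ) (ι s) ≡ ι s
      κ-ι true  = trans (cong (from σ) (γ-ι true)) from-ι⁺
      κ-ι false = trans (cong (from σ) (γ-ι false)) from-ι⁻

      κ₁ : Perm n
      κ₁ = neg z′ , ι false ⊚ κ σ

      from-sw : ∀ x y u → from σ (sw x y u) ≡ sw (from σ x) (from σ y) (from σ u)
      from-sw x y u = sw-conj (mk↔ₛ′ (from σ) (to σ) (strictlyInverseʳ σ) (strictlyInverseˡ σ)) x y u

      κ-twist : to (z′ , ι true ⊚ κ₁) ≗ to (κ (twist σ z))
      κ-twist u = sym (trans (from-sw z (ι false) _) (trans (cong (λ w → sw z′ w (from σ _)) from-ι⁺)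
        (cong (sw z′ (ι true)) (trans (from-sw (neg z) (ι true) (γ u))
          (cong₂ (λ a b → sw a b (from σ (γ u))) (inB-from σ B z) from-ι⁻)))))

    -- `σ` and `γ` agree on n and -n, so `κ σ` fixes both. Carried through the inverse of `σ`, the
    -- transpositions become (-z′ -n) and (z′ n), and each attaches one of these fixed points to the
    -- cycle of an outer point.
    orbits-complement : ∀ {b} → NumOrbits (to (κ σ)) b → ∃[ b′ ] (b ≡ 2 + b′ × NumOrbits (to (κ (twist σ z))) b′)
    orbits-complement C with orbits-mergeˡ (κ σ) (neg z′) (ι false)
      (λ p → outer≢ι {neg z′} z′-outer false (orbit-fixed (κ σ) (κ-ι false) (conn-sym p))) C
    ... | b₁ , refl , C₁ with orbits-mergeˡ κ₁ z′ (ι true)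
      (λ p → outer≢ι {z′} z′-outer true (orbit-fixed κ₁ (trans (cong (sw (neg z′) (ι false)) (κ-ι true))
        (sw-o _ _ (outer≢ι {neg z′} z′-outer true ∘ sym) λ ())) (conn-sym p))) C₁
    ... | b₂ , refl , C₂ = b₂ , refl , orbits-resp κ-twist C₂

  orbits₂-connected : (τ : Perm n) → Outer (to τ (ι true)) → NumOrbits₂ (to τ) γ 1
  orbits₂-connected τ o = (λ _ → Fin.zero) , (λ { Fin.zero → ι true , λ _ → refl }) ,
    λ x y → mk⇔ (λ _ → refl) (λ _ → to-ι x ◅◅ conn-sym (to-ι y))
    where
    along : ∀ {x y} → SameSide x y → Conn (Either τ) x y
    along s = conn-gen (edge ∘ inj₂) (planar⇒orbit γ-planar-side s)
    to-ι : ∀ x → Conn (Either τ) x (ι true)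
    to-ι x with place x
    ... | inj₁ ox = along (trans (side-outer {x} ox) (sym (side-outer {to τ (ι true)} o))) ◅◅ conn-sym (edge (inj₁ refl))
    ... | inj₂ i  = along (trans (side-inner {x} i) (sym (side-inner {ι true} (ι-inner true))))

-- Half circles

module _ {a b : ℕ} (a<b : a < b) where

  -- Shifted by `suc`, `inside` tests [a , b). Membership now changes on arrival at `a` or `b`, so
  -- it is the end of the step that must avoid them: left multiplication cuts in front of a point,
  -- not behind it.
  arc-step : ∀ {u v} → v ≢ a → v ≢ b → ¬ Between u a v → ¬ Between u b v → inside a b (suc u) ≡ inside a b (suc v)
  arc-step {u} {v} v≢a v≢b ¬a ¬b with inside a b (suc u) | insideView a b (suc u) | inside a b (suc v) | insideView a b (suc v)
  ... | _ | below _          | _ | below _          = refl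
  ... | _ | below u<a        | _ | within a≤v _     = contradiction (inj₁ (u<a , ℕ.≤∧≢⇒< (s≤s⁻¹ a≤v) (v≢a ∘ sym))) ¬a
  ... | _ | below _          | _ | above _          = refl
  ... | _ | within a≤u u<b   | _ | below v<a        = contradiction (inj₂ (ℕ.≤-trans (ℕ.<⇒≤ v<a) (s≤s⁻¹ a≤u) , inj₁ u<b)) ¬b
  ... | _ | within _ _       | _ | within _ _       = refl
  ... | _ | within _ u<b     | _ | above b≤v        = contradiction (inj₁ (u<b , ℕ.≤∧≢⇒< (s≤s⁻¹ b≤v) (v≢b ∘ sym))) ¬b
  ... | _ | above _          | _ | below _          = refl
  ... | _ | above b≤u        | _ | within a≤v v<b   =
    contradiction (inj₂ (ℕ.≤-trans (ℕ.<⇒≤ v<b) (s≤s⁻¹ b≤u) , inj₂ (ℕ.≤∧≢⇒< (s≤s⁻¹ a≤v) (v≢a ∘ sym)))) ¬a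
  ... | _ | above _          | _ | above _          = refl

  arc-into-lower : ∀ {u} → ¬ Between u b a → inside a b (suc u) ≡ false
  arc-into-lower {u} ¬b with inside a b (suc u) | insideView a b (suc u)
  ... | _ | below _        = refl
  ... | _ | within a≤u u<b = contradiction (inj₂ (s≤s⁻¹ a≤u , inj₁ u<b)) ¬b
  ... | _ | above _        = refl

  arc-into-upper : ∀ {u} → ¬ Between u a b → inside a b (suc u) ≡ true
  arc-into-upper {u} ¬a with inside a b (suc u) | insideView a b (suc u)
  ... | _ | below u<a  = contradiction (inj₁ (u<a , a<b)) ¬a
  ... | _ | within _ _ = refl
  ... | _ | above b≤u  = contradiction (inj₂ (s≤s⁻¹ b≤u , inj₂ a<b)) ¬a

less : ℕ → ℕ → Bool
less i r with i <? r
... | yes _ = true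
... | no _  = false

module Cuts (q : ℕ) where
  open Annulus q

  -- For 0 ≤ r ≤ p this is the half circle of p consecutive outer points starting at (true , r).
  arc : ℕ → X n → Bool
  arc r (t , i) = t xor less (toℕ i) r

  arc-inside : ∀ {r} → r ≤ p → ∀ {u} → Outer u → arc r u ≡ inside r (p + r) (suc (pos u))
  arc-inside {r} r≤p {true , i} o rewrite pos-out⁺ o with toℕ i <? r | inside r (p + r) (suc (toℕ i)) | insideView r (p + r) (suc (toℕ i))
  ... | yes _  | _ | below _ = refl
  ... | yes l  | _ | within r≤i _ = contradiction l (ℕ.≤⇒≯ (s≤s⁻¹ r≤i))
  ... | yes _  | _ | above _ = refl
  ... | no ¬l  | _ | below l = contradiction l ¬l
  ... | no _   | _ | within _ _ = refl
  ... | no _   | _ | above h = contradiction (ℕ.≤-trans (ℕ.m≤m+n p r) (s≤s⁻¹ h)) (ℕ.<⇒≱ o)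
  arc-inside {r} r≤p {false , i} o rewrite pos-out⁻ o with toℕ i <? r | inside r (p + r) (suc (p + toℕ i)) | insideView r (p + r) (suc (p + toℕ i))
  ... | _      | _ | below l = contradiction (ℕ.≤-trans l r≤p) (ℕ.<⇒≱ (s≤s (ℕ.m≤m+n p (toℕ i))))
  ... | yes _  | _ | within _ _ = refl
  ... | no ¬l  | _ | within _ h = contradiction (ℕ.+-cancelˡ-< p _ _ h) ¬l
  ... | yes l  | _ | above h = contradiction (ℕ.+-monoʳ-< p l) (ℕ.≤⇒≯ (s≤s⁻¹ h))
  ... | no _   | _ | above _ = refl

  abstract
    -- The value `true` marks the half containing n. For `r` below `p` its outer part begins at the
    -- point with sign `s` and index `r`.
    cut : Bool → ℕ → X n → Bool
    cut s r (t , i) with toℕ i <? p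
    ... | yes _ = not (s xor arc r (t , i))
    ... | no _  = t

    cut-outer : ∀ s r {u} → Outer u → cut s r u ≡ not (s xor arc r u)
    cut-outer s r {t , i} o with toℕ i <? p
    ... | yes _ = refl
    ... | no ¬o = contradiction o ¬o

    cut-inner : ∀ s r {u} → Inner u → cut s r u ≡ proj₁ u
    cut-inner s r {t , i} e with toℕ i <? p
    ... | yes o = contradiction e (outer≢inner {t , i} o)
    ... | no _  = refl

  cut-ι : ∀ s r t → cut s r (ι t) ≡ t
  cut-ι s r t = cut-inner s r (ι-inner t)

  cut-neg : ∀ s r u → cut s r (neg u) ≡ not (cut s r u)
  cut-neg s r u with place u
  ... | inj₂ e = trans (cut-inner s r {neg u} e) (cong not (sym (cut-inner s r {u} e)))
  ... | inj₁ o = trans (cut-outer s r {neg u} o) (trans (flipped s (proj₁ u) (less (idx u) r)) (cong not (sym (cut-outer s r {u} o))))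
    where
    flipped : ∀ s t b → not (s xor (not t xor b)) ≡ not (not (s xor (t xor b)))
    flipped true  true  true  = refl
    flipped true  true  false = refl
    flipped true  false true  = refl
    flipped true  false false = refl
    flipped false true  true  = refl
    flipped false true  false = refl
    flipped false false true  = refl
    flipped false false false = refl

  cut-self : ∀ z → Outer z → cut (proj₁ z) (idx z) z ≡ true
  cut-self z@(s , i) o = trans (cut-outer s (idx z) {z} o) (at s)
    where
    at : ∀ s → not (s xor (s xor less (toℕ i) (toℕ i))) ≡ true
    at s with toℕ i <? toℕ i
    ... | yes l = contradiction l (ℕ.<-irrefl refl)
    at true  | no _ = refl
    at false | no _ = refl

  module _ {σ : X n → X n} {E : Rel (X n) 0ℓ} (P : Planar σ E) {z : X n} (oz : Outer z) where
    open Planar P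

    private
      r = idx z
      lo hi : X n
      lo = true , proj₂ z
      hi = false , proj₂ z

      lo<hi : r < p + r
      lo<hi = ℕ.<-≤-trans oz (ℕ.m≤m+n p r)

      r≤p : r ≤ p
      r≤p = ℕ.<⇒≤ oz

      pos≡ : ∀ {u} → Outer u → arc r u ≡ inside r (p + r) (suc (pos u))
      pos≡ = arc-inside r≤p

    module _ {u : X n} (ou : Outer u) (u-lo : E u lo) (u-hi : E u hi) where

      arc-into-lo : σ u ≡ lo → arc r u ≡ false
      arc-into-lo e = trans (pos≡ {u} ou) (arc-into-lower lo<hi
        (subst₂ (λ b v → ¬ Between (pos u) b v) (pos-out⁻ oz) (trans (cong pos e) (pos-out⁺ oz)) (gap u-hi)))

      arc-into-hi : σ u ≡ hi → arc r u ≡ true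
      arc-into-hi e = trans (pos≡ {u} ou) (arc-into-upper lo<hi
        (subst₂ (λ a v → ¬ Between (pos u) a v) (pos-out⁺ oz) (trans (cong pos e) (pos-out⁻ oz)) (gap u-lo)))

      arc-along : Outer (σ u) → σ u ≢ lo → σ u ≢ hi → arc r u ≡ arc r (σ u)
      arc-along ov ≢lo ≢hi = trans (pos≡ {u} ou) (trans (arc-step lo<hi
        (λ e → ≢lo (pos-injective (trans e (sym (pos-out⁺ oz)))))
        (λ e → ≢hi (pos-injective (trans e (sym (pos-out⁻ oz)))))
        (subst (λ a → ¬ Between (pos u) a (pos (σ u))) (pos-out⁺ oz) (gap u-lo))
        (subst (λ b → ¬ Between (pos u) b (pos (σ u))) (pos-out⁻ oz) (gap u-hi))) (sym (pos≡ {σ u} ov)))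

  module _ {σ : X n → X n} {E : Rel (X n) 0ℓ} (P : Planar σ E) (z : X n) (oz : Outer z)
    {u : X n} (ou : Outer u) (uz : E u z) (uz⁻ : E u (neg z)) where

    private
      H = cut (proj₁ z) (idx z)

    -- `u` is the last point of the class before `z`, so it closes the half opposite to the one that
    -- `z` opens.
    cut-into-z : σ u ≡ z → H u ≡ false
    cut-into-z e = trans (cut-outer (proj₁ z) (idx z) {u} ou) (go z oz uz uz⁻ e)
      where
      go : ∀ z → Outer z → E u z → E u (neg z) → σ u ≡ z → not (proj₁ z xor arc (idx z) u) ≡ false
      go (true  , i) oz uz uz⁻ e rewrite arc-into-lo P {true , i} oz {u} ou uz uz⁻ e = refl
      -- `arc` always starts at the positive point of the pair, so for a negative `z` its two
      -- endpoints exchange roles.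
      go (false , i) oz uz uz⁻ e rewrite arc-into-hi P {true , i} oz {u} ou uz⁻ uz e = refl

    cut-into-z⁻ : σ u ≡ neg z → H u ≡ true
    cut-into-z⁻ e = trans (cut-outer (proj₁ z) (idx z) {u} ou) (go z oz uz uz⁻ e)
      where
      go : ∀ z → Outer z → E u z → E u (neg z) → σ u ≡ neg z → not (proj₁ z xor arc (idx z) u) ≡ true
      go (true  , i) oz uz uz⁻ e rewrite arc-into-hi P {true , i} oz {u} ou uz uz⁻ e = refl
      go (false , i) oz uz uz⁻ e rewrite arc-into-lo P {true , i} oz {u} ou uz⁻ uz e = refl

    cut-along : Outer (σ u) → σ u ≢ z → σ u ≢ neg z → H u ≡ H (σ u)
    cut-along ov ≢z ≢z⁻ = trans (cut-outer (proj₁ z) (idx z) {u} ou) (trans (cong (λ b → not (proj₁ z xor b)) (go z oz uz uz⁻ ≢z ≢z⁻))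
        (sym (cut-outer (proj₁ z) (idx z) {σ u} ov)))
      where
      go : ∀ z → Outer z → E u z → E u (neg z) → σ u ≢ z → σ u ≢ neg z → arc (idx z) u ≡ arc (idx z) (σ u)
      go (true  , i) oz uz uz⁻ a b = arc-along P {true , i} oz {u} ou uz uz⁻ ov a b
      go (false , i) oz uz uz⁻ a b = arc-along P {true , i} oz {u} ou uz⁻ uz ov b a

-- Cut partitions as orbits of twisted permutations

module Halves (q : ℕ) where
  open Annulus q
  open TypeB q
  open Twist q
  open Cuts q

  Cut : Rel (X n) 0ℓ → Bool → ℕ → Rel (X n) 0ℓ
  Cut E s r x y = Merge E x y × (Zero E x → cut s r x ≡ cut s r y)

  module GoodLemmas {E : Rel (X n) 0ℓ} (G : Good E) where
    open Good G

    zero-join : ∀ {i j} → toℕ i < p → toℕ j < p → toℕ i < toℕ j →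
      E (true , i) (false , i) → E (true , j) (false , j) → E (true , i) (true , j)
    zero-join {i} {j} oi oj i<j = noncrossing
      (subst₂ _<_ (sym (pos-out⁺ oi)) (sym (pos-out⁺ oj)) i<j) (sign-order oj oi)
      (subst₂ _<_ (sym (pos-out⁻ oi)) (sym (pos-out⁻ oj)) (ℕ.+-monoʳ-< p i<j))

    zero⁺ : ∀ x → Zero E x → E (true , proj₂ x) (false , proj₂ x)
    zero⁺ (true  , _) z = z
    zero⁺ (false , _) z = E-sym z

    to⁺ : ∀ x → Zero E x → E x (true , proj₂ x)
    to⁺ (true  , _) z = E-refl
    to⁺ (false , _) z = z

    -- Two antipodal pairs of outer points cross, so there is at most one outer zero block.
    zero-unique : ∀ {x y} → Outer x → Outer y → Zero E x → Zero E y → E x y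
    zero-unique {x} {y} ox oy zx zy = E-trans (to⁺ x zx) (E-trans mid (E-sym (to⁺ y zy)))
      where
      mid : E (true , proj₂ x) (true , proj₂ y)
      mid with ℕ.<-cmp (idx x) (idx y)
      ... | tri< l _ _ = zero-join ox oy l (zero⁺ x zx) (zero⁺ y zy)
      ... | tri≈ _ e _ = subst (λ j → E (true , proj₂ x) (true , j)) (Fin.toℕ-injective e) E-refl
      ... | tri> _ _ l = E-sym (zero-join oy ox l (zero⁺ y zy) (zero⁺ x zx))

    -- Each side has at most one zero block, so merging can only join the outer one to {n , -n}.
    merge-side : ∀ {x y} → SameSide x y → Merge E x y → E x y
    merge-side s (inj₁ e) = e
    merge-side {x} {y} s (inj₂ (zx , zy)) with place x
    ... | inj₁ o = zero-unique o (same-outer {x} {y} s o) zx zy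
    ... | inj₂ i with idx-sign {x} {y} (trans i (sym (same-inner {x} {y} s i)))
    ... | inj₁ refl = E-refl
    ... | inj₂ refl = zx

    merge-zero : ∀ {x y} → Merge E x y → Zero E x → Zero E y
    merge-zero (inj₁ e) = zero-resp e
    merge-zero (inj₂ (_ , zy)) _ = zy

    merge-sym : ∀ {x y} → Merge E x y → Merge E y x
    merge-sym (inj₁ e) = inj₁ (E-sym e)
    merge-sym (inj₂ (zx , zy)) = inj₂ (zy , zx)

    merge-trans : ∀ {x y w} → Merge E x y → Merge E y w → Merge E x w
    merge-trans (inj₁ e) (inj₁ f) = inj₁ (E-trans e f)
    merge-trans (inj₁ e) (inj₂ (zy , zw)) = inj₂ (zero-resp (E-sym e) zy , zw)
    merge-trans (inj₂ (zx , zy)) m = inj₂ (zx , merge-zero m zy)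

    merge-dec : ∀ x y → Dec (Merge E x y)
    merge-dec x y = dec x y ⊎-dec (dec x (neg x) ×-dec dec y (neg y))

    cut-dec : ∀ s r x y → Dec (Cut E s r x y)
    cut-dec s r x y = merge-dec x y ×-dec (dec x (neg x) →-dec (cut s r x Bool.≟ cut s r y))

    cut-equiv : ∀ s r → IsEquivalence (Cut E s r)
    cut-equiv s r = record
      { refl = inj₁ E-refl , λ _ → refl
      ; sym = λ { (m , h) → merge-sym m , λ zy → sym (h (merge-zero (merge-sym m) zy)) }
      ; trans = λ { (m , h) (m′ , h′) → merge-trans m m′ , λ zx → trans (h zx) (h′ (merge-zero m zx)) } }

    -- Antipodes carry opposite labels. Hence `Ωt` adds nothing to the orbits of a twisted
    -- permutation.
    cut-no-zero : ∀ s r {x} → ¬ Cut E s r x (neg x)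
    cut-no-zero s r {x} (m , h) = Bool.not-¬ (refl {x = cut s r x}) (trans (h zx) (cut-neg s r x))
      where
      zx : Zero E x
      zx = merge-side (sym (side-neg x)) m

  module TwistedOrbits {E : Rel (X n) 0ℓ} (G : Good E) (zn : E (ι true) (ι false))
    (σ : Perm n) (P : Planar (Inverse.to σ) E) (z : X n) (oz : Outer z) (zz : Zero E z) where
    open Good G
    open GoodLemmas G
    module P = Planar P

    private
      s = proj₁ z
      r = idx z
      H = cut s r
      τ = twist σ z

    flip-ι : to σ (ι true) ≡ ι false
    flip-ι with inner-ι (to σ (ι true)) (same-inner {ι true} {to σ (ι true)} (E-side (P.step (ι true))) (ι-inner true))
    ... | false , e = e
    -- If n were fixed, its gap would contain every other point, among them -n, which `zn` puts in
    -- its class.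
    ... | true , e = contradiction (inj₂ (ℕ.≤-reflexive (cong pos e) ,
      [ inj₁ , (λ l → inj₂ (subst (λ w → pos (ι false) < pos w) (sym e) l)) ]′ (compare (λ e → case-≢ (pos-injective e))))) (P.gap zn)
      where
      case-≢ : ι true ≢ ι false
      case-≢ ()
      compare : ∀ {a b} → a ≢ b → a < b ⊎ b < a
      compare {a} {b} ne with ℕ.<-cmp a b
      ... | tri< l _ _ = inj₁ l
      ... | tri≈ _ e _ = contradiction e ne
      ... | tri> _ _ l = inj₂ l

    zz⁻ : Zero E (neg z)
    zz⁻ = zero-neg zz

    zero-ι : ∀ t → Zero E (ι t)
    zero-ι true  = zn
    zero-ι false = E-sym zn

    -- `σ` sends the last outer zero point of a half to the start of the other half; `τ` sends it to
    -- the inner point of its own half instead, and that inner point to the start of the same half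
    -- (n to `z`, -n to -z).
    cut-step : InB σ → ∀ u → Cut E s r u (to τ u)
    cut-step B u with tView z oz (to σ u)
    ... | at-z e = subst (Cut E s r u) (sym (trans (cong (t z) e) (t-z z oz)))
        (inj₂ (zu , zero-ι false) , λ _ → trans (cut-into-z P z oz ou (subst (E u) e (P.step u)) (E-trans (subst (E u) e (P.step u)) zz) e) (sym (cut-ι s r false)))
      where
      ou : Outer u
      ou = same-outer {z} {u} (trans (cong side (sym e)) (sym (E-side (P.step u)))) oz
      zu : Zero E u
      zu = zero-resp (E-sym (subst (E u) e (P.step u))) zz
    ... | at-z⁻ e = subst (Cut E s r u) (sym (trans (cong (t z) e) (t-z⁻ z oz)))
        (inj₂ (zu , zero-ι true) , λ _ → trans (cut-into-z⁻ P z oz ou (E-trans (subst (E u) e (P.step u)) (E-sym zz)) (subst (E u) e (P.step u)) e) (sym (cut-ι s r true)))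
      where
      ou : Outer u
      ou = same-outer {neg z} {u} (trans (cong side (sym e)) (sym (E-side (P.step u)))) oz
      zu : Zero E u
      zu = zero-resp (E-sym (subst (E u) e (P.step u))) zz⁻
    ... | at-ι⁺ e = subst₂ (Cut E s r) (sym u≡) (sym (trans (cong (t z) e) (t-ι⁺ z oz)))
        (inj₂ (zero-ι false , zz⁻) , λ _ → trans (cut-ι s r false) (sym (trans (cut-neg s r z) (cong not (cut-self z oz)))))
      where
      u≡ : u ≡ ι false
      u≡ = to-injective σ (trans e (sym (trans (B (ι true)) (cong neg flip-ι))))
    ... | at-ι⁻ e = subst₂ (Cut E s r) (sym u≡) (sym (trans (cong (t z) e) (t-ι⁻ z oz)))
        (inj₂ (zero-ι true , zz) , λ _ → trans (cut-ι s r true) (sym (cut-self z oz)))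
      where
      u≡ : u ≡ ι true
      u≡ = to-injective σ (trans e (sym flip-ι))
    ... | at-off a b c d = subst (Cut E s r u) (sym (t-off z oz a b c d))
        (inj₁ (P.step u) , along)
      where
      along : Zero E u → H u ≡ H (to σ u)
      along zu with place (to σ u)
      ... | inj₂ i with inner-ι (to σ u) i
      ... | true  , e = contradiction e c
      ... | false , e = contradiction e d
      along zu | inj₁ ov = cut-along P z oz ou (zero-unique ou oz zu zz) (E-trans (zero-unique ou oz zu zz) zz) ov a b
        where
        ou : Outer u
        ou = same-outer {to σ u} {u} (sym (E-side (P.step u))) ov

    module _ (B : InB σ) where

      orbit⇒cut : Orb τ ⇒ Cut E s r
      orbit⇒cut = Eqv.fold (cut-equiv s r) λ { {u} refl → cut-step B u }

      private
        flip-ι⁻ : to σ (ι false) ≡ ι true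
        flip-ι⁻ = trans (B (ι true)) (cong neg flip-ι)

        Att : X n → Set
        Att u = ∃[ t ] Orb τ u (ι t)

        -- Undoing the twist links only cycles through n or -n, so `E` is contained in this
        -- relation. For a zero point, the cut label then tells which of n and -n its cycle
        -- contains.
        F : Rel (X n) 0ℓ
        F u v = (Att u × Att v) ⊎ Orb τ u v

        att-resp : ∀ {u v} → Orb τ u v → Att u → Att v
        att-resp p (t , a) = t , conn-sym p ◅◅ a

        F-equiv : IsEquivalence F
        F-equiv = record
          { refl = inj₂ ε
          ; sym = λ { (inj₁ (a , b)) → inj₁ (b , a) ; (inj₂ p) → inj₂ (conn-sym p) }
          ; trans = λ { (inj₁ (a , _)) (inj₁ (_ , c)) → inj₁ (a , c)
                      ; (inj₁ (a , b)) (inj₂ p) → inj₁ (a , att-resp p b)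
                      ; (inj₂ p) (inj₁ (b , c)) → inj₁ (att-resp (conn-sym p) b , c)
                      ; (inj₂ p) (inj₂ q) → inj₂ (p ◅◅ q) } }

        z-att : Att z
        z-att = true , conn-sym (edge (sym (trans (cong (t z) flip-ι) (t-ι⁻ z oz))))

        z⁻-att : Att (neg z)
        z⁻-att = false , conn-sym (edge (sym (trans (cong (t z) flip-ι⁻) (t-ι⁺ z oz))))

        F-step : ∀ u → F u (to σ u)
        F-step u with tView z oz (to σ u)
        ... | at-z e  = inj₁ ((false , edge (sym (trans (cong (t z) e) (t-z z oz)))) , subst Att (sym e) z-att)
        ... | at-z⁻ e = inj₁ ((true , edge (sym (trans (cong (t z) e) (t-z⁻ z oz)))) , subst Att (sym e) z⁻-att)
        ... | at-ι⁺ e = inj₁ (att-resp (conn-sym (edge (sym (trans (cong (t z) e) (t-ι⁺ z oz))))) z⁻-att , (true , subst (λ w → Orb τ w (ι true)) (sym e) ε))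
        ... | at-ι⁻ e = inj₁ (att-resp (conn-sym (edge (sym (trans (cong (t z) e) (t-ι⁻ z oz))))) z-att , (false , subst (λ w → Orb τ w (ι false)) (sym e) ε))
        ... | at-off a b c d = inj₂ (edge (sym (t-off z oz a b c d)))

        E⇒F : E ⇒ F
        E⇒F e = Eqv.fold F-equiv (λ { {u} refl → F-step u }) (planar⇒orbit P e)

        zero-att : ∀ {u} → Zero E u → Att u
        zero-att {u} zu with place u
        ... | inj₂ i with inner-ι u i
        ... | t , refl = t , ε
        zero-att {u} zu | inj₁ ou with E⇒F (zero-unique ou oz zu zz)
        ... | inj₁ (a , _) = a
        ... | inj₂ p = att-resp (conn-sym p) z-att

        att-cut : ∀ {u} → Zero E u → ((t , _) : Att u) → H u ≡ t
        att-cut zu (t , p) = trans (proj₂ (orbit⇒cut p) zu) (cut-ι s r t)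

      cut⇒orbit : Cut E s r ⇒ Orb τ
      cut⇒orbit {u} {v} (m , h) with dec u (neg u)
      ... | yes zu with zero-att zu | zero-att (merge-zero m zu)
      ... | a@(t , p) | b@(t′ , p′) = p ◅◅ subst (λ t → Orb τ (ι t) v) (sym t≡) (conn-sym p′)
        where
        t≡ : t ≡ t′
        t≡ = trans (sym (att-cut zu a)) (trans (h zu) (att-cut (merge-zero m zu) b))
      cut⇒orbit {u} {v} (inj₂ (zu , _) , _) | no ¬zu = contradiction zu ¬zu
      cut⇒orbit {u} {v} (inj₁ e , _) | no ¬zu with E⇒F e
      ... | inj₂ p = p
      ... | inj₁ ((t , p) , _) = contradiction (merge-zero (merge-sym (proj₁ (orbit⇒cut p))) (zero-ι t)) ¬zu

      cut⇔Ωt : Cut E s r ⇔′ Ωt τ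
      cut⇔Ωt x y = mk⇔ (inj₁ ∘ cut⇒orbit)
        [ orbit⇒cut , (λ { (sx , _) → contradiction (orbit⇒cut (⇒to (sx x) ε)) (cut-no-zero s r) }) ]′

-- Every member is a merged or a cut noncrossing relation

module Models (q : ℕ) where
  open Annulus q
  open Finite enum
  open TypeB q
  open Twist q
  open Cuts q
  open Halves q

  ⇔′-sym : {π ρ : Rel (X n) 0ℓ} → π ⇔′ ρ → ρ ⇔′ π
  ⇔′-sym e x y = mk⇔ (⇒from (e x y)) (⇒to (e x y))

  ⇔′-trans : {π ρ μ : Rel (X n) 0ℓ} → π ⇔′ ρ → ρ ⇔′ μ → π ⇔′ μ
  ⇔′-trans e f x y = mk⇔ (⇒to (f x y) ∘ ⇒to (e x y)) (⇒from (e x y) ∘ ⇒from (f x y))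

  NCB-resp : {π ρ : Partition n} → π ⇔′ ρ → NCB n ρ → NCB n π
  NCB-resp e (τ , B , S , f) = τ , B , S , ⇔′-trans e f

  Ωt-resp : (σ τ : Perm n) → to σ ≗ to τ → Ωt σ ⇔′ Ωt τ
  Ωt-resp σ τ e x y = mk⇔ (half σ τ e x y) (half τ σ (sym ∘ e) x y)
    where
    half : (σ τ : Perm n) → to σ ≗ to τ → ∀ x y → Ωt σ x y → Ωt τ x y
    half σ τ e x y (inj₁ p) = inj₁ (orbit-resp e p)
    half σ τ e x y (inj₂ (sx , sy)) = inj₂ (self sx , self sy)
      where
      self : ∀ {x} → SelfNeg σ x → SelfNeg τ x
      self s y = mk⇔ (orbit-resp e ∘ ⇒to (s y) ∘ orbit-resp (sym ∘ e)) (orbit-resp e ∘ ⇒from (s y) ∘ orbit-resp (sym ∘ e))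

  cut-NCB-at : ∀ {E} → Good E → E (ι true) (ι false) → ∀ z → Outer z → Zero E z → NCB n (Cut E (proj₁ z) (idx z))
  cut-NCB-at {E} G zn z oz zz with realiseB G
  ... | σ , (a , b , Ca , Cb , eq) , P , B with TwistOrbits.orbits-complement σ B (TwistedOrbits.flip-ι G zn σ P z oz zz) z oz Cb
  ... | b′ , refl , Cb′ = twist σ z , twist-inB σ z oz B ,
    (a , b′ , 2 , 1 , orbits-zero Ca (planar⇒orbit P zz) , Cb′ , γ-orbits ,
      orbits₂-connected (twist σ z) (subst Outer (sym (trans (cong (t z) flip-ι) (t-ι⁻ z oz))) oz) ,
      -- The twist keeps `a`, lowers the complement by two and connects the two sides, so a + b′ + 2
      -- = 2n + 2.
      trans (ℕ.+-assoc a b′ 2) (trans (cong (a +_) (ℕ.+-comm b′ 2)) eq)) ,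
    cut⇔Ωt B
    where
    open TwistedOrbits G zn σ P z oz zz
    open TwistOrbits σ B flip-ι z oz using (orbits-zero)

  private
    index-min : {P : X n → Set} → (∀ x → Dec (P x)) → ∀ x → P x → ∃[ y ] (P y × (∀ v → P v → idx y ≤ idx v))
    index-min = extremal enum (λ x y → idx y ≤ idx x) ℕ.≤-refl (λ a b → ℕ.≤-trans b a) (λ x y → ℕ.≤-total (idx y) (idx x))

  less-yes : ∀ {i r} → i < r → less i r ≡ true
  less-yes {i} {r} l with i <? r
  ... | yes _ = refl
  ... | no ¬l = contradiction l ¬l

  less-no : ∀ {i r} → r ≤ i → less i r ≡ false
  less-no {i} {r} l with i <? r
  ... | yes l′ = contradiction l (ℕ.<⇒≱ l′)
  ... | no _   = refl

  cut-agree : ∀ {E s s′ r r′} → Good E → (∀ u → Zero E u → Outer u → cut s r u ≡ cut s′ r′ u) → Cut E s r ⇔′ Cut E s′ r′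
  cut-agree {E} {s} {s′} {r} {r′} G agree x y = mk⇔
      (λ { (m , h) → m , λ zx → trans (sym (full x zx)) (trans (h zx) (full y (merge-zero m zx))) })
      (λ { (m , h) → m , λ zx → trans (full x zx) (trans (h zx) (sym (full y (merge-zero m zx)))) })
    where
    open GoodLemmas G
    full : ∀ u → Zero E u → cut s r u ≡ cut s′ r′ u
    full u zu with place u
    ... | inj₁ o = agree u zu o
    ... | inj₂ i = trans (cut-inner s r {u} i) (sym (cut-inner s′ r′ {u} i))

  -- Only labels of zero points matter, so the cut may be moved forward to the next outer zero
  -- point: the least index from `r` on with the same sign or, past the end, the least index of all
  -- with the opposite sign.
  cut-NCB : ∀ {E} → Good E → E (ι true) (ι false) → ∀ s r → NCB n (Cut E s r)
  cut-NCB {E} G zn s r with any-dec (λ x → (idx x <? p) ×-dec (dec x (neg x) ×-dec (r ≤? idx x)))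
    where open Good G
  ... | yes (x , px) = from-min (index-min (λ x → (idx x <? p) ×-dec (dec x (neg x) ×-dec (r ≤? idx x))) x px)
    where
    open Good G
    from-min : ∃[ y ] ((Outer y × Zero E y × r ≤ idx y) × (∀ v → Outer v × Zero E v × r ≤ idx v → idx y ≤ idx v)) → NCB n (Cut E s r)
    from-min (y , (oy , zy , r≤y) , min) = NCB-resp (cut-agree G agree) (cut-NCB-at G zn z oy zz)
      where
      z : X n
      z = s , proj₂ y
      zz : Zero E z
      zz with idx-sign {y} {z} refl
      ... | inj₁ e = subst (Zero E) (sym e) zy
      ... | inj₂ e = subst (Zero E) (sym e) (zero-neg zy)
      agree : ∀ u → Zero E u → Outer u → cut s r u ≡ cut s (idx y) u
      agree u zu ou = trans (cut-outer s r {u} ou) (trans (cong (λ b → not (s xor (proj₁ u xor b))) same) (sym (cut-outer s (idx y) {u} ou)))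
        where
        same : less (idx u) r ≡ less (idx u) (idx y)
        same with idx u <? r
        ... | yes l = sym (less-yes (ℕ.<-≤-trans l r≤y))
        ... | no ¬l = sym (less-no (min u (ou , zu , ℕ.≮⇒≥ ¬l)))
  ... | no none with any-dec (λ x → (idx x <? p) ×-dec Good.dec G x (neg x))
  ... | yes (x , px) = from-min (index-min (λ x → (idx x <? p) ×-dec dec x (neg x)) x px)
    where
    open Good G
    from-min : ∃[ y ] ((Outer y × Zero E y) × (∀ v → Outer v × Zero E v → idx y ≤ idx v)) → NCB n (Cut E s r)
    from-min (y , (oy , zy) , min) = NCB-resp (cut-agree G agree) (cut-NCB-at G zn z oy zz)
      where
      z : X n
      z = not s , proj₂ y
      zz : Zero E z
      zz with idx-sign {y} {z} refl
      ... | inj₁ e = subst (Zero E) (sym e) zy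
      ... | inj₂ e = subst (Zero E) (sym e) (zero-neg zy)
      flipped : ∀ s t → not (s xor (t xor true)) ≡ not (not s xor (t xor false))
      flipped true  true  = refl
      flipped true  false = refl
      flipped false true  = refl
      flipped false false = refl
      agree : ∀ u → Zero E u → Outer u → cut s r u ≡ cut (not s) (idx y) u
      agree u zu ou = trans (cut-outer s r {u} ou) (trans
        (cong (λ b → not (s xor (proj₁ u xor b))) (less-yes (ℕ.≰⇒> λ l → none (u , ou , zu , l))))
        (trans (flipped s (proj₁ u)) (sym (trans (cut-outer (not s) (idx y) {u} ou)
          (cong (λ b → not (not s xor (proj₁ u xor b))) (less-no (min u (ou , zu))))))))
  -- Without an outer zero block the cut merely separates n from -n; making both singletons leaves
  -- no zero block at all.
  ... | no no-zero = NCB-resp same (merge-NCB G′)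
    where
    open Good G
    open GoodLemmas G
    E′ : Rel (X n) 0ℓ
    E′ x y = E x y × (Inner x → x ≡ y)
    G′ : Good E′
    G′ = record
      { equiv = record
        { refl = E-refl , λ _ → refl
        ; sym = λ {x} {y} (e , h) → E-sym e , λ i → sym (h (same-inner {y} {x} (sym (E-side e)) i))
        ; trans = λ {x} {y} (e , h) (f , k) → E-trans e f , λ i → trans (h i) (k (same-inner {x} {y} (E-side e) i)) }
      ; dec = λ x y → dec x y ×-dec ((idx x ℕ.≟ p) →-dec decEq x y)
      ; E-neg = λ (e , h) → E-neg e , λ i → cong neg (h i)
      ; noncrossing = λ {a} {b} {c} {d} a<b b<c c<d (ac , _) (bd , _) → noncrossing a<b b<c c<d ac bd ,
          λ i → contradiction i (outer≢inner {a} (below-outer {a} {d} (ℕ.<⇒≤ (ℕ.<-trans a<b (ℕ.<-trans b<c c<d)))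
            (crossing-outer {b} {c} {d} b<c c<d (E-side bd))))
      ; E-side = E-side ∘ proj₁ }
    no-zero′ : ∀ {x} → ¬ Zero E′ x
    no-zero′ {x} (e , h) with place x
    ... | inj₁ o = no-zero (x , o , e)
    ... | inj₂ i = neg-≢ x (sym (h i))
    inner-zero : ∀ {x} → Zero E x → Inner x
    inner-zero {x} z with place x
    ... | inj₁ o = contradiction (x , o , z) no-zero
    ... | inj₂ i = i
    ι-zero : ∀ t → Zero E (ι t)
    ι-zero true  = zn
    ι-zero false = E-sym zn
    inner⇒zero : ∀ {x} → Inner x → Zero E x
    inner⇒zero {x} i with inner-ι x i
    ... | t , refl = ι-zero t
    inner-eq : ∀ {x y} → Inner x → Inner y → cut s r x ≡ cut s r y → x ≡ y
    inner-eq {x} {y} i j e = cong₂ _,_ (trans (sym (cut-inner s r {x} i)) (trans e (cut-inner s r {y} j)))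
      (Fin.toℕ-injective (trans i (sym j)))
    same : Cut E s r ⇔′ Merge E′
    same x y = mk⇔
      (λ { (inj₁ e , h) → inj₁ (e , λ i → inner-eq {x} {y} i (same-inner {x} {y} (E-side e) i) (h (inner⇒zero {x} i)))
         ; (inj₂ (zx , zy) , h) → inj₁ (subst (E′ x) (inner-eq {x} {y} (inner-zero zx) (inner-zero zy) (h zx)) (E-refl , λ _ → refl)) })
      (λ { (inj₁ (e , h)) → inj₁ e , λ zx → cong (cut s r) (h (inner-zero zx))
         ; (inj₂ (zx , _)) → contradiction zx no-zero′ })

  data Model (π : Rel (X n) 0ℓ) : Set₁ where
    merge-model : ∀ {E} → Good E → π ⇔′ Merge E → Model π
    cut-model   : ∀ {E} → Good E → E (ι true) (ι false) → ∀ s (i : Fin n) → π ⇔′ Cut E s (toℕ i) → Model π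

  model⇒NCB : ∀ {π} → Model π → NCB n π
  model⇒NCB (merge-model G e)      = NCB-resp e (merge-NCB G)
  model⇒NCB (cut-model G zn s i e) = NCB-resp e (cut-NCB G zn s (toℕ i))

  module Untwist (τ : Perm n) (B : InB τ) (o : Outer (Inverse.to τ (ι true))) where

    z : X n
    z = to τ (ι true)

    σ : Perm n
    σ = twist τ z

    σ-inB : InB σ
    σ-inB = twist-inB τ z o B

    σ-flip : to σ (ι true) ≡ ι false
    σ-flip = t-z z o

    twice : to (twist σ z) ≗ to τ
    twice u = t-involutive z o (to τ u)

    open TwistOrbits σ σ-inB σ-flip z o

    κ-twice : to (κ (twist σ z)) ≗ to (κ τ)
    κ-twice u = from-resp (twist σ z) τ twice (γ u)

    -- σ = twist τ z gains two cycles in its complement; genus bounds its own number of cycles by that of τ,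
    -- which forces z and -z into one orbit of σ.
    untwist-geodesic : ∀ {a b} → NumOrbits (to τ) a → NumOrbits (to (κ τ)) b → a + b ≡ 2 * n → Geodesic σ × Orb σ z (neg z)
    untwist-geodesic {a} {b} Ca Cb eq with orbits-exist (to σ) | orbits-exist (to (κ σ))
    ... | a′ , Ca′ | b′ , Cb′ with orbits-complement Cb′
    ... | b″ , refl , Cb″ with classes-unique (orbits-resp κ-twice Cb″) Cb
    ... | refl with classes-dec Ca′ z (neg z)
    ... | yes zz with classes-unique (orbits-resp twice (orbits-zero Ca′ zz)) Ca
    ... | refl = (a , 2 + b , Ca′ , Cb′ , trans (trans (cong (a +_) (ℕ.+-comm 2 b)) (sym (ℕ.+-assoc a b 2))) (cong (_+ 2) eq)) , zz
    untwist-geodesic {a} {b} Ca Cb eq | a′ , Ca′ | b′ , Cb′ | b″ , refl , Cb″ | refl | no ¬zz with orbits-nonzero Ca′ ¬zz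
    ... | a″ , refl , Ca″ with classes-unique (orbits-resp twice Ca″) Ca
    ... | refl = contradiction (orbits-bound σ Ca′ Cb′) (ℕ.<⇒≱ (s≤s (ℕ.≤-trans
      (ℕ.≤-reflexive (trans (cong (_+ 2) (sym eq)) (trans (ℕ.+-assoc a b 2) (cong (a +_) (ℕ.+-comm b 2))))) (ℕ.n≤1+n _))))

    -- Twisting is an involution, so the description of twisted permutations, applied to `σ`,
    -- describes `τ`.
    extract-cut : InSnc τ → Model (Ωt τ)
    extract-cut (a , b , c , d , Ca , Cb , Cc , Cd , eq)
      with classes-unique Cc γ-orbits | classes-unique Cd (orbits₂-connected τ o)
    ... | refl | refl with untwist-geodesic Ca Cb (ℕ.+-cancelʳ-≡ 2 _ _ eq)
    ... | geo , zz = cut-model G zn (proj₁ z) (proj₂ z) (⇔′-sym (⇔′-trans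
        (TwistedOrbits.cut⇔Ωt G zn σ (geodesic⇒planar σ geo) z o zz σ-inB) (Ωt-resp (twist σ z) τ twice)))
      where
      G = orbit-good σ geo σ-inB keep
      zn : Orb σ (ι true) (ι false)
      zn = edge (sym σ-flip)

  model-resp : ∀ {π ρ} → π ⇔′ ρ → Model ρ → Model π
  model-resp e (merge-model G f)      = merge-model G (⇔′-trans e f)
  model-resp e (cut-model G zn s i f) = cut-model G zn s i (⇔′-trans e f)

  NCB⇒model : ∀ {π} → NCB n π → Model π
  NCB⇒model (τ , B , S , e) with place (to τ (ι true))
  ... | inj₁ o = model-resp e (Untwist.extract-cut τ B o S)
  ... | inj₂ i with extract-merge τ B S i
  ... | E , G , f = merge-model G (⇔′-trans e (⇔′-sym f))

-- Superposing two half circles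

-- Two half circles [r₁ , p+r₁) and [r₂ , p+r₂) with r₁ ≤ r₂ ≤ p cut the line into five intervals.
in₁ in₂ : Fin 5 → Bool
in₁ Fin.zero = false
in₁ (Fin.suc Fin.zero) = true
in₁ (Fin.suc (Fin.suc Fin.zero)) = true
in₁ (Fin.suc (Fin.suc (Fin.suc _))) = false
in₂ Fin.zero = false
in₂ (Fin.suc Fin.zero) = false
in₂ (Fin.suc (Fin.suc Fin.zero)) = true
in₂ (Fin.suc (Fin.suc (Fin.suc Fin.zero))) = true
in₂ (Fin.suc (Fin.suc (Fin.suc (Fin.suc _)))) = false

module _ {A : Set} where

  -- Values (h₁ , h₂) are compared after identifying (true , true) with (false , false).
  Joint : (A → Bool) → (A → Bool) → Rel A 0ℓ
  Joint h₁ h₂ x y = (h₁ x ≡ h₁ y × h₂ x ≡ h₂ y) ⊎ (h₁ x ≡ h₂ x × h₁ y ≡ h₂ y)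

  joint-equiv : ∀ h₁ h₂ → IsEquivalence (Joint h₁ h₂)
  joint-equiv h₁ h₂ = record
    { refl = inj₁ (refl , refl)
    ; sym = λ { (inj₁ (a , b)) → inj₁ (sym a , sym b) ; (inj₂ (a , b)) → inj₂ (b , a) }
    ; trans = λ { (inj₁ (a , b)) (inj₁ (c , d)) → inj₁ (trans a c , trans b d)
                ; (inj₁ (a , b)) (inj₂ (c , d)) → inj₂ (trans a (trans c (sym b)) , d)
                ; (inj₂ (a , b)) (inj₁ (c , d)) → inj₂ (a , trans (sym c) (trans b d))
                ; (inj₂ (a , b)) (inj₂ (c , d)) → inj₂ (a , d) } }

  joint-dec : ∀ h₁ h₂ x y → Dec (Joint h₁ h₂ x y)
  joint-dec h₁ h₂ x y = ((h₁ x Bool.≟ h₁ y) ×-dec (h₂ x Bool.≟ h₂ y)) ⊎-dec ((h₁ x Bool.≟ h₂ x) ×-dec (h₁ y Bool.≟ h₂ y))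

  joint-swap : ∀ h₁ h₂ → Joint h₁ h₂ ⇒ Joint h₂ h₁
  joint-swap h₁ h₂ (inj₁ (a , b)) = inj₁ (b , a)
  joint-swap h₁ h₂ (inj₂ (a , b)) = inj₂ (sym a , sym b)

level₁ level₂ : Bool → Fin 5 → Bool
level₁ s k = not (s xor in₁ k)
level₂ s k = not (s xor in₂ k)

-- The claim concerns five consecutive intervals only and is settled by evaluating a decision
-- procedure. The inequalities are weak because several points may share an interval.
joint-level : ∀ s₁ s₂ (a b c d : Fin 5) → a Fin.≤ b → b Fin.≤ c → c Fin.≤ d →
  Joint (level₁ s₁) (level₂ s₂) a c → Joint (level₁ s₁) (level₂ s₂) b d → Joint (level₁ s₁) (level₂ s₂) a b
joint-level = λ { true true → toWitness {a? = check true true} tt ; true false → toWitness {a? = check true false} tt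
                ; false true → toWitness {a? = check false true} tt ; false false → toWitness {a? = check false false} tt }
  where
  check : ∀ s₁ s₂ → Dec (∀ (a b c d : Fin 5) → a Fin.≤ b → b Fin.≤ c → c Fin.≤ d →
    Joint (level₁ s₁) (level₂ s₂) a c → Joint (level₁ s₁) (level₂ s₂) b d → Joint (level₁ s₁) (level₂ s₂) a b)
  check s₁ s₂ = Fin.all? λ a → Fin.all? λ b → Fin.all? λ c → Fin.all? λ d →
    (a Fin.≤? b) →-dec ((b Fin.≤? c) →-dec ((c Fin.≤? d) →-dec
      (J a c →-dec (J b d →-dec J a b))))
    where J = joint-dec (level₁ s₁) (level₂ s₂)

module Levels {p r₁ r₂ : ℕ} (r₁≤r₂ : r₁ ≤ r₂) (r₂≤p : r₂ ≤ p) where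

  data AtLevel (m : ℕ) : Fin 5 → Set where
    l₀ : m < r₁ → AtLevel m Fin.zero
    l₁ : r₁ ≤ m → m < r₂ → AtLevel m (Fin.suc Fin.zero)
    l₂ : r₂ ≤ m → m < p + r₁ → AtLevel m (Fin.suc (Fin.suc Fin.zero))
    l₃ : p + r₁ ≤ m → m < p + r₂ → AtLevel m (Fin.suc (Fin.suc (Fin.suc Fin.zero)))
    l₄ : p + r₂ ≤ m → AtLevel m (Fin.suc (Fin.suc (Fin.suc (Fin.suc Fin.zero))))

  r₂≤p+r₁ : r₂ ≤ p + r₁
  r₂≤p+r₁ = ℕ.≤-trans r₂≤p (ℕ.m≤m+n p r₁)

  level : ∀ m → ∃[ k ] (AtLevel m k × inside r₁ (p + r₁) (suc m) ≡ in₁ k × inside r₂ (p + r₂) (suc m) ≡ in₂ k)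
  level m with inside r₁ (p + r₁) (suc m) | insideView r₁ (p + r₁) (suc m) | inside r₂ (p + r₂) (suc m) | insideView r₂ (p + r₂) (suc m)
  ... | _ | below a    | _ | below _    = _ , l₀ a , refl , refl
  ... | _ | below a    | _ | within b _ = contradiction (ℕ.≤-trans a r₁≤r₂) (ℕ.<⇒≱ b)
  ... | _ | below a    | _ | above b    = contradiction (ℕ.≤-trans a (ℕ.≤-trans r₁≤r₂ (ℕ.m≤n+m r₂ p))) (ℕ.<⇒≱ b)
  ... | _ | within a _ | _ | below b    = _ , l₁ (s≤s⁻¹ a) b , refl , refl
  ... | _ | within _ a | _ | within b _ = _ , l₂ (s≤s⁻¹ b) a , refl , refl
  ... | _ | within _ a | _ | above b    = contradiction (ℕ.≤-trans a (ℕ.+-monoʳ-≤ p r₁≤r₂)) (ℕ.<⇒≱ b)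
  ... | _ | above a    | _ | below b    = contradiction (ℕ.≤-trans b r₂≤p+r₁) (ℕ.<⇒≱ a)
  ... | _ | above a    | _ | within _ b = _ , l₃ (s≤s⁻¹ a) b , refl , refl
  ... | _ | above _    | _ | above b    = _ , l₄ (s≤s⁻¹ b) , refl , refl

  level-mono : ∀ {m m′ k k′} → m ≤ m′ → AtLevel m k → AtLevel m′ k′ → k Fin.≤ k′
  level-mono {m} {m′} m≤ = go
    where
    absurd : ∀ {ℓ} {C : Set ℓ} {θ θ′} → θ ≤ m → m′ < θ′ → θ′ ≤ θ → C
    absurd a b c = contradiction (ℕ.≤-trans (ℕ.≤-trans c a) m≤) (ℕ.<⇒≱ b)
    go : ∀ {k k′} → AtLevel m k → AtLevel m′ k′ → k Fin.≤ k′
    go (l₀ _) _ = z≤n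
    go (l₁ a _) (l₀ b) = absurd a b ℕ.≤-refl
    go (l₁ _ _) (l₁ _ _) = s≤s z≤n
    go (l₁ _ _) (l₂ _ _) = s≤s z≤n
    go (l₁ _ _) (l₃ _ _) = s≤s z≤n
    go (l₁ _ _) (l₄ _) = s≤s z≤n
    go (l₂ a _) (l₀ b) = absurd a b r₁≤r₂
    go (l₂ a _) (l₁ _ b) = absurd a b ℕ.≤-refl
    go (l₂ _ _) (l₂ _ _) = s≤s (s≤s z≤n)
    go (l₂ _ _) (l₃ _ _) = s≤s (s≤s z≤n)
    go (l₂ _ _) (l₄ _) = s≤s (s≤s z≤n)
    go (l₃ a _) (l₀ b) = absurd a b (ℕ.m≤n+m r₁ p)
    go (l₃ a _) (l₁ _ b) = absurd a b r₂≤p+r₁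
    go (l₃ a _) (l₂ _ b) = absurd a b ℕ.≤-refl
    go (l₃ _ _) (l₃ _ _) = s≤s (s≤s (s≤s z≤n))
    go (l₃ _ _) (l₄ _) = s≤s (s≤s (s≤s z≤n))
    go (l₄ a) (l₀ b) = absurd a b (ℕ.≤-trans r₁≤r₂ (ℕ.m≤n+m r₂ p))
    go (l₄ a) (l₁ _ b) = absurd a b (ℕ.m≤n+m r₂ p)
    go (l₄ a) (l₂ _ b) = absurd a b (ℕ.+-monoʳ-≤ p r₁≤r₂)
    go (l₄ a) (l₃ _ b) = absurd a b ℕ.≤-refl
    go (l₄ _) (l₄ _) = s≤s (s≤s (s≤s (s≤s z≤n)))

-- Noncrossing conditions on zero points

module Keys (q : ℕ) where
  open Annulus q
  open Cuts q

  -- Noncrossing is asked of outer points alone: the labels of n and -n are their signs and are not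
  -- read off from a half circle. `crossing-outer` provides the outer point.
  record Key (K : Rel (X n) 0ℓ) : Set where
    field
      equiv       : IsEquivalence K
      dec         : ∀ x y → Dec (K x y)
      K-neg       : ∀ {x y} → K x y → K (neg x) (neg y)
      noncrossing : ∀ {a b c d} → pos a < pos b → pos b < pos c → pos c < pos d → Outer d → K a c → K b d → K a b
    open IsEquivalence equiv public renaming (refl to K-refl; sym to K-sym; trans to K-trans)

  Total : Rel (X n) 0ℓ
  Total _ _ = ⊤

  total-key : Key Total
  total-key = record { equiv = _ ; dec = λ _ _ → yes tt ; K-neg = λ _ → tt ; noncrossing = λ _ _ _ _ _ _ → tt }

  SameHalf : Bool → ℕ → Rel (X n) 0ℓ
  SameHalf s r x y = cut s r x ≡ cut s r y

  halves : Bool → Bool → Bool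
  halves s b = not (s xor b)

  halves-injective : ∀ s {b b′} → halves s b ≡ halves s b′ → b ≡ b′
  halves-injective true  e = trans (sym (Bool.not-involutive _)) (trans e (Bool.not-involutive _))
  halves-injective false e = Bool.not-injective e

  cut-inside : ∀ s {r} → r ≤ p → ∀ {u} → Outer u → cut s r u ≡ halves s (inside r (p + r) (suc (pos u)))
  cut-inside s {r} r≤p {u} o = trans (cut-outer s r {u} o) (cong (halves s) (arc-inside r≤p {u} o))

  module OuterFour {a b c d : X n} (a<b : pos a < pos b) (b<c : pos b < pos c) (c<d : pos c < pos d) (od : Outer d) where
    oc : Outer c
    oc = below-outer {c} {d} (ℕ.<⇒≤ c<d) od
    ob : Outer b
    ob = below-outer {b} {c} (ℕ.<⇒≤ b<c) oc
    oa : Outer a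
    oa = below-outer {a} {b} (ℕ.<⇒≤ a<b) ob

  sameHalf-key : ∀ s {r} → r ≤ p → Key (SameHalf s r)
  sameHalf-key s {r} r≤p = record
    { equiv = record { refl = refl ; sym = sym ; trans = trans }
    ; dec = λ x y → cut s r x Bool.≟ cut s r y
    ; K-neg = λ {x} {y} e → trans (cut-neg s r x) (trans (cong not e) (sym (cut-neg s r y)))
    ; noncrossing = λ {a} {b} {c} {d} a<b b<c c<d od ac bd →
        let open OuterFour {a} {b} {c} {d} a<b b<c c<d od in
        trans (via a oa) (trans (cong (halves s) (inside-noncrossing (s≤s a<b) (s≤s b<c) (s≤s c<d)
          (halves-injective s (trans (sym (via a oa)) (trans ac (via c oc))))
          (halves-injective s (trans (sym (via b ob)) (trans bd (via d od)))))) (sym (via b ob))) }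
    where
    via : ∀ u → Outer u → cut s r u ≡ halves s (inside r (p + r) (suc (pos u)))
    via u o = cut-inside s r≤p {u} o

  module _ (s₁ : Bool) {r₁ : ℕ} (r₁≤p : r₁ ≤ p) (s₂ : Bool) {r₂ : ℕ} (r₂≤p : r₂ ≤ p) where

    private
      h₁ = cut s₁ r₁
      h₂ = cut s₂ r₂

    -- Both labels of an outer point depend only on its interval, and intervals are monotone in the
    -- position, so `joint-level` decides.
    joint-ordered : r₁ ≤ r₂ → ∀ {a b c d} → pos a < pos b → pos b < pos c → pos c < pos d → Outer d →
      Joint h₁ h₂ a c → Joint h₁ h₂ b d → Joint h₁ h₂ a b
    joint-ordered r₁≤r₂ {a} {b} {c} {d} a<b b<c c<d od ac bd =
      down a b oa ob (joint-level s₁ s₂ (lv a) (lv b) (lv c) (lv d)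
        (mono {a} {b} a<b) (mono {b} {c} b<c) (mono {c} {d} c<d) (up a c oa oc ac) (up b d ob od bd))
      where
      open OuterFour {a} {b} {c} {d} a<b b<c c<d od
      open Levels r₁≤r₂ r₂≤p
      lv : X n → Fin 5
      lv u = proj₁ (level (pos u))
      mono : ∀ {u v} → pos u < pos v → lv u Fin.≤ lv v
      mono {u} {v} l = level-mono (ℕ.<⇒≤ l) (proj₁ (proj₂ (level (pos u)))) (proj₁ (proj₂ (level (pos v))))
      e₁ : ∀ u → Outer u → h₁ u ≡ level₁ s₁ (lv u)
      e₁ u o = trans (cut-inside s₁ r₁≤p {u} o) (cong (halves s₁) (proj₁ (proj₂ (proj₂ (level (pos u))))))
      e₂ : ∀ u → Outer u → h₂ u ≡ level₂ s₂ (lv u)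
      e₂ u o = trans (cut-inside s₂ r₂≤p {u} o) (cong (halves s₂) (proj₂ (proj₂ (proj₂ (level (pos u))))))
      up : ∀ u v → Outer u → Outer v → Joint h₁ h₂ u v → Joint (level₁ s₁) (level₂ s₂) (lv u) (lv v)
      up u v ou ov (inj₁ (x , y)) = inj₁ (trans (sym (e₁ u ou)) (trans x (e₁ v ov)) , trans (sym (e₂ u ou)) (trans y (e₂ v ov)))
      up u v ou ov (inj₂ (x , y)) = inj₂ (trans (sym (e₁ u ou)) (trans x (e₂ u ou)) , trans (sym (e₁ v ov)) (trans y (e₂ v ov)))
      down : ∀ u v → Outer u → Outer v → Joint (level₁ s₁) (level₂ s₂) (lv u) (lv v) → Joint h₁ h₂ u v
      down u v ou ov (inj₁ (x , y)) = inj₁ (trans (e₁ u ou) (trans x (sym (e₁ v ov))) , trans (e₂ u ou) (trans y (sym (e₂ v ov))))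
      down u v ou ov (inj₂ (x , y)) = inj₂ (trans (e₁ u ou) (trans x (sym (e₂ u ou))) , trans (e₁ v ov) (trans y (sym (e₂ v ov))))

  joint-key : ∀ s₁ {r₁} → r₁ ≤ p → ∀ s₂ {r₂} → r₂ ≤ p → Key (Joint (cut s₁ r₁) (cut s₂ r₂))
  joint-key s₁ {r₁} r₁≤p s₂ {r₂} r₂≤p = record
    { equiv = joint-equiv h₁ h₂
    ; dec = joint-dec h₁ h₂
    ; K-neg = λ { {x} {y} (inj₁ (a , b)) → inj₁ (n₁ x y a , n₂ x y b)
                ; {x} {y} (inj₂ (a , b)) → inj₂ (n₁₂ x a , n₁₂ y b) }
    ; noncrossing = λ {a} {b} {c} {d} a<b b<c c<d od ac bd →
        [ (λ l → joint-ordered s₁ r₁≤p s₂ r₂≤p l {a} {b} {c} {d} a<b b<c c<d od ac bd)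
        , (λ l → joint-swap h₂ h₁ (joint-ordered s₂ r₂≤p s₁ r₁≤p l {a} {b} {c} {d} a<b b<c c<d od
            (joint-swap h₁ h₂ ac) (joint-swap h₁ h₂ bd))) ]′ (ℕ.≤-total r₁ r₂) }
    where
    h₁ = cut s₁ r₁
    h₂ = cut s₂ r₂
    n₁ : ∀ x y → h₁ x ≡ h₁ y → h₁ (neg x) ≡ h₁ (neg y)
    n₁ x y e = trans (cut-neg s₁ r₁ x) (trans (cong not e) (sym (cut-neg s₁ r₁ y)))
    n₂ : ∀ x y → h₂ x ≡ h₂ y → h₂ (neg x) ≡ h₂ (neg y)
    n₂ x y e = trans (cut-neg s₂ r₂ x) (trans (cong not e) (sym (cut-neg s₂ r₂ y)))
    n₁₂ : ∀ x → h₁ x ≡ h₂ x → h₁ (neg x) ≡ h₂ (neg x)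
    n₁₂ x e = trans (cut-neg s₁ r₁ x) (trans (cong not e) (sym (cut-neg s₂ r₂ x)))

-- Intersections of members

module Meets (q : ℕ) where
  open Annulus q
  open TypeB q
  open Cuts q
  open Halves q
  open Models q
  open Keys q

  -- A point that is zero in just one relation is no longer zero in the intersection, so its cut has
  -- to be built into the relation. Points zero in both are treated apart, since their zero block
  -- may survive.
  Refined : (E₁ E₂ K₁ K₂ K₁₂ : Rel (X n) 0ℓ) → Rel (X n) 0ℓ
  Refined E₁ E₂ K₁ K₂ K₁₂ x y = E₁ x y × E₂ x y ×
    (Zero E₁ x → ¬ Zero E₂ x → K₁ x y) × (Zero E₂ x → ¬ Zero E₁ x → K₂ x y) × (Zero E₁ x → Zero E₂ x → K₁₂ x y)

  refined-good : ∀ {E₁ E₂ K₁ K₂ K₁₂} → Good E₁ → Good E₂ → Key K₁ → Key K₂ → Key K₁₂ → Good (Refined E₁ E₂ K₁ K₂ K₁₂)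
  refined-good {E₁} {E₂} {K₁} {K₂} {K₁₂} G₁ G₂ κ₁ κ₂ κ₁₂ = record
    { equiv = record
      { refl = G₁.E-refl , G₂.E-refl , (λ _ _ → k₁.K-refl) , (λ _ _ → k₂.K-refl) , (λ _ _ → k₁₂.K-refl)
      ; sym = λ (e , f , a , b , c) → let e′ = G₁.E-sym e ; f′ = G₂.E-sym f in e′ , f′ ,
          (λ z ¬z → k₁.K-sym (a (G₁.zero-resp e′ z) (¬z ∘ G₂.zero-resp f))) ,
          (λ z ¬z → k₂.K-sym (b (G₂.zero-resp f′ z) (¬z ∘ G₁.zero-resp e))) ,
          (λ z w → k₁₂.K-sym (c (G₁.zero-resp e′ z) (G₂.zero-resp f′ w)))
      ; trans = λ (e , f , a , b , c) (e′ , f′ , a′ , b′ , c′) → G₁.E-trans e e′ , G₂.E-trans f f′ ,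
          (λ z ¬z → k₁.K-trans (a z ¬z) (a′ (G₁.zero-resp e z) (¬z ∘ G₂.zero-resp (G₂.E-sym f)))) ,
          (λ z ¬z → k₂.K-trans (b z ¬z) (b′ (G₂.zero-resp f z) (¬z ∘ G₁.zero-resp (G₁.E-sym e)))) ,
          (λ z w → k₁₂.K-trans (c z w) (c′ (G₁.zero-resp e z) (G₂.zero-resp f w))) }
    ; dec = λ x y → G₁.dec x y ×-dec (G₂.dec x y ×-dec
        ((G₁.dec x (neg x) →-dec (¬? (G₂.dec x (neg x)) →-dec k₁.dec x y)) ×-dec
        ((G₂.dec x (neg x) →-dec (¬? (G₁.dec x (neg x)) →-dec k₂.dec x y)) ×-dec
         (G₁.dec x (neg x) →-dec (G₂.dec x (neg x) →-dec k₁₂.dec x y)))))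
    ; E-neg = λ (e , f , a , b , c) → G₁.E-neg e , G₂.E-neg f ,
        (λ z ¬z → k₁.K-neg (a (G₁.E-neg⁻ z) (¬z ∘ G₂.zero-neg))) ,
        (λ z ¬z → k₂.K-neg (b (G₂.E-neg⁻ z) (¬z ∘ G₁.zero-neg))) ,
        (λ z w → k₁₂.K-neg (c (G₁.E-neg⁻ z) (G₂.E-neg⁻ w)))
    ; noncrossing = λ {p} {q} {r} {s} p<q q<r r<s (e , f , a , b , c) (e′ , f′ , a′ , b′ , c′) →
        let o = crossing-outer {q} {r} {s} q<r r<s (G₁.E-side e′)
            g = G₁.noncrossing p<q q<r r<s e e′
            h = G₂.noncrossing p<q q<r r<s f f′ in
        g , h ,
        (λ z ¬z → k₁.noncrossing p<q q<r r<s o (a z ¬z) (a′ (G₁.zero-resp g z) (¬z ∘ G₂.zero-resp (G₂.E-sym h)))) ,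
        (λ z ¬z → k₂.noncrossing p<q q<r r<s o (b z ¬z) (b′ (G₂.zero-resp h z) (¬z ∘ G₁.zero-resp (G₁.E-sym g)))) ,
        (λ z w → k₁₂.noncrossing p<q q<r r<s o (c z w) (c′ (G₁.zero-resp g z) (G₂.zero-resp h w)))
    ; E-side = λ (e , _) → G₁.E-side e }
    where
    module G₁ = Good G₁
    module G₂ = Good G₂
    module k₁ = Key κ₁
    module k₂ = Key κ₂
    module k₁₂ = Key κ₁₂

  meet-swap : (π ρ : Rel (X n) 0ℓ) → (π ∧P ρ) ⇔′ (ρ ∧P π)
  meet-swap π ρ x y = mk⇔ (λ { (a , b) → b , a }) (λ { (a , b) → b , a })

  meet-resp : ∀ {π π′ ρ ρ′ : Rel (X n) 0ℓ} → π ⇔′ π′ → ρ ⇔′ ρ′ → (π ∧P ρ) ⇔′ (π′ ∧P ρ′)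
  meet-resp e f x y = mk⇔ (λ { (a , b) → ⇒to (e x y) a , ⇒to (f x y) b }) (λ { (a , b) → ⇒from (e x y) a , ⇒from (f x y) b })

  fin≤p : (i : Fin n) → toℕ i ≤ p
  fin≤p i = s≤s⁻¹ (Fin.toℕ<n i)

  not-zero : ∀ s r x → cut s r x ≢ cut s r (neg x)
  not-zero s r x e = Bool.not-¬ (refl {x = cut s r x}) (trans e (cut-neg s r x))

  module _ {E₁ E₂ : Rel (X n) 0ℓ} (G₁ : Good E₁) (G₂ : Good E₂) where
    module G₁ = Good G₁
    module G₂ = Good G₂
    module L₁ = GoodLemmas G₁
    module L₂ = GoodLemmas G₂

    merge-off : ∀ {E} → Good E → ∀ {x y} → ¬ SameSide x y → Merge E x y → Zero E x × Zero E y
    merge-off G ¬s (inj₁ e) = contradiction (Good.E-side G e) ¬s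
    merge-off G ¬s (inj₂ z) = z

    off-inner : ∀ {x y} → ¬ SameSide x y → Inner x ⊎ Inner y
    off-inner {x} {y} ¬s with place x | place y
    ... | inj₂ i | _      = inj₁ i
    ... | inj₁ _ | inj₂ j = inj₂ j
    ... | inj₁ o | inj₁ o′ = contradiction (trans (side-outer {x} o) (sym (side-outer {y} o′))) ¬s

    merge-meet-merge : Model (Merge E₁ ∧P Merge E₂)
    merge-meet-merge = merge-model (refined-good G₁ G₂ total-key total-key total-key) λ x y → mk⇔ (there′ x y) (back x y)
      where
      E′ = Refined E₁ E₂ Total Total Total
      both : ∀ {x y} → E₁ x y → E₂ x y → E′ x y
      both e f = e , f , _
      there′ : ∀ x y → (Merge E₁ ∧P Merge E₂) x y → Merge E′ x y
      there′ x y (m₁ , m₂) with side x Fin.≟ side y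
      ... | yes s = inj₁ (both (L₁.merge-side s m₁) (L₂.merge-side s m₂))
      ... | no ¬s with merge-off G₁ ¬s m₁ | merge-off G₂ ¬s m₂
      ... | a , b | c , d = inj₂ (both a c , both b d)
      back : ∀ x y → Merge E′ x y → (Merge E₁ ∧P Merge E₂) x y
      back x y (inj₁ (e , f , _)) = inj₁ e , inj₁ f
      back x y (inj₂ ((a , c , _) , (b , d , _))) = inj₂ (a , b) , inj₂ (c , d)

    module _ (zn₁ : E₁ (ι true) (ι false)) (s : Bool) (i : Fin n) where
      private
        r = toℕ i
        H = cut s r
        half = sameHalf-key s (fin≤p i)

      -- Common zero points form the new zero block and are cut afterwards; the half condition
      -- becomes a key only for points that are zero in `E₁` alone.
      cut-meet-zero : E₂ (ι true) (ι false) → Model (Cut E₁ s r ∧P Merge E₂)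
      cut-meet-zero zn₂ = cut-model (refined-good G₁ G₂ half total-key total-key) zn′ s i λ x y → mk⇔ (there′ x y) (back x y)
        where
        E′ = Refined E₁ E₂ (SameHalf s r) Total Total
        zero-both : ∀ {x} → Zero E₁ x → Zero E₂ x → Zero E′ x
        zero-both a b = a , b , (λ _ ¬b → contradiction b ¬b) , _ , _
        zn′ : E′ (ι true) (ι false)
        zn′ = zero-both zn₁ zn₂
        there′ : ∀ x y → (Cut E₁ s r ∧P Merge E₂) x y → Cut E′ s r x y
        there′ x y ((m₁ , h) , m₂) = merged , λ (z , _) → h z
          where
          merged : Merge E′ x y
          merged with side x Fin.≟ side y
          ... | yes e = inj₁ (L₁.merge-side e m₁ , L₂.merge-side e m₂ , (λ z _ → h z) , _ , _)
          ... | no ¬e with merge-off G₁ ¬e m₁ | merge-off G₂ ¬e m₂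
          ... | a , b | c , d = inj₂ (zero-both a c , zero-both b d)
        back : ∀ x y → Cut E′ s r x y → (Cut E₁ s r ∧P Merge E₂) x y
        back x y (inj₁ (e , f , k , _) , h) = (inj₁ e , same) , inj₁ f
          where
          same : Zero E₁ x → H x ≡ H y
          same z with G₂.dec x (neg x)
          ... | yes w = h (zero-both z w)
          ... | no ¬w = k z ¬w
        back x y (inj₂ (z@(a , c , _) , (b , d , _)) , h) = (inj₂ (a , b) , λ _ → h z) , inj₂ (c , d)

      -- `Merge E₂` now relates no outer point to an inner one, so no block crosses the sides. With
      -- the halves built in for all zero points of `E₁` no zero block remains, and `Merge` adds
      -- nothing.
      cut-meet-nonzero : ¬ E₂ (ι true) (ι false) → Model (Cut E₁ s r ∧P Merge E₂)
      cut-meet-nonzero ¬zn₂ = merge-model (refined-good G₁ G₂ half total-key half) λ x y → mk⇔ (there′ x y) (back x y)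
        where
        E′ = Refined E₁ E₂ (SameHalf s r) Total (SameHalf s r)
        inner-nonzero : ∀ {x} → Inner x → ¬ Zero E₂ x
        inner-nonzero {x} j z with inner-ι x j
        ... | true  , refl = ¬zn₂ z
        ... | false , refl = ¬zn₂ (G₂.E-sym z)
        there′ : ∀ x y → (Cut E₁ s r ∧P Merge E₂) x y → Merge E′ x y
        there′ x y ((m₁ , h) , m₂) with side x Fin.≟ side y
        ... | yes e = inj₁ (L₁.merge-side e m₁ , L₂.merge-side e m₂ , (λ z _ → h z) , _ , (λ z _ → h z))
        ... | no ¬e with merge-off G₂ ¬e m₂ | off-inner {x} {y} ¬e
        ... | c , _ | inj₁ j = contradiction c (inner-nonzero {x} j)
        ... | _ , d | inj₂ j = contradiction d (inner-nonzero {y} j)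
        back : ∀ x y → Merge E′ x y → (Cut E₁ s r ∧P Merge E₂) x y
        back x y (inj₁ (e , f , k , _ , l)) = (inj₁ e , same) , inj₁ f
          where
          same : Zero E₁ x → H x ≡ H y
          same z with G₂.dec x (neg x)
          ... | yes w = l z w
          ... | no ¬w = k z ¬w
        back x y (inj₂ ((a , c , _ , _ , l) , _)) = contradiction (l a c) (not-zero s r x)

      cut-meet-merge : Model (Cut E₁ s r ∧P Merge E₂)
      cut-meet-merge with G₂.dec (ι true) (ι false)
      ... | yes zn₂ = cut-meet-zero zn₂
      ... | no ¬zn₂ = cut-meet-nonzero ¬zn₂

      -- Where the two cuts agree they also agree at the antipode, and they agree at n and -n.
      -- `Joint` keeps these points together as the zero block, on which cutting by `H` is the same
      -- as cutting by `H₂`.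
      cut-meet-cut : E₂ (ι true) (ι false) → ∀ s₂ (i₂ : Fin n) → Model (Cut E₁ s r ∧P Cut E₂ s₂ (toℕ i₂))
      cut-meet-cut zn₂ s₂ i₂ = cut-model (refined-good G₁ G₂ half half₂ (joint-key s (fin≤p i) s₂ (fin≤p i₂)))
          (zero-both zn₁ zn₂ (agree-inner {ι true} (ι-inner true))) s i λ x y → mk⇔ (there′ x y) (back x y)
        where
        r₂ = toℕ i₂
        H₂ = cut s₂ r₂
        half₂ = sameHalf-key s₂ (fin≤p i₂)
        E′ = Refined E₁ E₂ (SameHalf s r) (SameHalf s₂ r₂) (Joint H H₂)
        agree-inner : ∀ {x} → Inner x → H x ≡ H₂ x
        agree-inner {x} j = trans (cut-inner s r {x} j) (sym (cut-inner s₂ r₂ {x} j))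
        agree-neg : ∀ {x} → H x ≡ H₂ x → H (neg x) ≡ H₂ (neg x)
        agree-neg {x} e = trans (cut-neg s r x) (trans (cong not e) (sym (cut-neg s₂ r₂ x)))
        zero-both : ∀ {x} → Zero E₁ x → Zero E₂ x → H x ≡ H₂ x → Zero E′ x
        zero-both {x} a b e = a , b , (λ _ ¬b → contradiction b ¬b) , (λ _ ¬a → contradiction a ¬a) ,
          λ _ _ → inj₂ (e , agree-neg {x} e)
        zero-agree : ∀ {x} → Zero E′ x → H x ≡ H₂ x
        zero-agree {x} (a , b , _ , _ , j) with j a b
        ... | inj₁ (e , _) = contradiction e (not-zero s r x)
        ... | inj₂ (e , _) = e
        there′ : ∀ x y → (Cut E₁ s r ∧P Cut E₂ s₂ r₂) x y → Cut E′ s r x y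
        there′ x y ((m₁ , h₁) , (m₂ , h₂)) = merged , λ (z , _) → h₁ z
          where
          merged : Merge E′ x y
          merged with side x Fin.≟ side y
          ... | yes e = inj₁ (L₁.merge-side e m₁ , L₂.merge-side e m₂ , (λ z _ → h₁ z) , (λ w _ → h₂ w) , (λ z w → inj₁ (h₁ z , h₂ w)))
          -- One of `x` and `y` is inner, where both labels equal the sign; as `x` and `y` share
          -- both labels, the labels agree at the other point too.
          ... | no ¬e with merge-off G₁ ¬e m₁ | merge-off G₂ ¬e m₂ | off-inner {x} {y} ¬e
          ... | a , b | c , d | inj₁ j = inj₂ (zero-both a c (agree-inner {x} j) ,
            zero-both b d (trans (sym (h₁ a)) (trans (agree-inner {x} j) (h₂ c))))
          ... | a , b | c , d | inj₂ j = inj₂ (zero-both a c (trans (h₁ a) (trans (agree-inner {y} j) (sym (h₂ c)))) ,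
            zero-both b d (agree-inner {y} j))
        back : ∀ x y → Cut E′ s r x y → (Cut E₁ s r ∧P Cut E₂ s₂ r₂) x y
        back x y (inj₁ (e , f , k , l , j) , h) = (inj₁ e , same₁) , (inj₁ f , same₂)
          where
          joint : Zero E₁ x → Zero E₂ x → H x ≡ H y × H₂ x ≡ H₂ y
          joint z w with j z w
          ... | inj₁ es = es
          ... | inj₂ (a , b) = let e = h (zero-both z w a) in e , trans (sym a) (trans e b)
          same₁ : Zero E₁ x → H x ≡ H y
          same₁ z with G₂.dec x (neg x)
          ... | yes w = proj₁ (joint z w)
          ... | no ¬w = k z ¬w
          same₂ : Zero E₂ x → H₂ x ≡ H₂ y
          same₂ w with G₁.dec x (neg x)
          ... | yes z = proj₂ (joint z w)
          ... | no ¬z = l w ¬z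
        back x y (inj₂ (z@(a , c , _) , w@(b , d , _)) , h) = (inj₂ (a , b) , λ _ → h z) ,
          (inj₂ (c , d) , λ _ → trans (sym (zero-agree z)) (trans (h z) (zero-agree w)))

  model-meet : ∀ {π ρ} → Model π → Model ρ → Model (π ∧P ρ)
  model-meet (merge-model G e) (merge-model G′ f) = model-resp (meet-resp e f) (merge-meet-merge G G′)
  model-meet (cut-model G zn s i e) (merge-model G′ f) = model-resp (meet-resp e f) (cut-meet-merge G G′ zn s i)
  model-meet (merge-model G e) (cut-model G′ zn s i f) =
    model-resp (⇔′-trans (meet-resp e f) (meet-swap _ _)) (cut-meet-merge G′ G zn s i)
  model-meet (cut-model G zn s i e) (cut-model G′ zn′ s′ i′ f) = model-resp (meet-resp e f) (cut-meet-cut G G′ zn s i zn′ s′ i′)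

-- Joins by finite search

module Joins (q : ℕ) where
  open Annulus q
  open Finite enum
  open TypeB q
  open Halves q
  open Models q
  open Meets q

  N : ℕ
  N = 2 * n

  -- Boolean matrices, flattened to subsets so that `anySubset?` can search through them.
  ⟦_⟧ : Subset (N * N) → Rel (X n) 0ℓ
  ⟦ c ⟧ x y = lookup c (Fin.combine (to enum x) (to enum y)) ≡ true

  encode : {E : Rel (X n) 0ℓ} → (∀ x y → Dec (E x y)) → ∃[ c ] E ⇔′ ⟦ c ⟧
  encode {E} E? = c , λ x y → mk⇔ (λ e → trans (value x y) (dec-true (E? x y) e)) (λ e → reflect x y (trans (sym (value x y)) e))
    where
    entry : Fin N × Fin N → Bool
    entry (i , j) = does (E? (from enum i) (from enum j))
    c : Subset (N * N)
    c = tabulate (entry ∘ Fin.remQuot {N} N)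
    value : ∀ x y → lookup c (Fin.combine (to enum x) (to enum y)) ≡ does (E? x y)
    value x y = trans (lookup∘tabulate (entry ∘ Fin.remQuot {N} N) (Fin.combine (to enum x) (to enum y)))
      (trans (cong entry (Fin.remQuot-combine (to enum x) (to enum y)))
        (cong₂ (λ a b → does (E? a b)) (strictlyInverseʳ enum x) (strictlyInverseʳ enum y)))
    reflect : ∀ x y → does (E? x y) ≡ true → E x y
    reflect x y e with E? x y
    ... | yes p = p
    reflect x y () | no _

  good? : ∀ c → Dec (Good ⟦ c ⟧)
  good? c = map′
    (λ (r , s , t , g , h , k) → record
      { equiv = record { refl = r _ ; sym = s _ _ ; trans = t _ _ _ }
      ; dec = E? ; E-neg = g _ _ ; noncrossing = h _ _ _ _ ; E-side = k _ _ })
    (λ G → let open Good G in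
      (λ _ → E-refl) , (λ _ _ → E-sym) , (λ _ _ _ → E-trans) , (λ _ _ → E-neg) , (λ _ _ _ _ → noncrossing) , (λ _ _ → E-side))
    (all-dec (λ x → E? x x)
      ×-dec all-dec (λ x → all-dec λ y → E? x y →-dec E? y x)
      ×-dec all-dec (λ x → all-dec λ y → all-dec λ z → E? x y →-dec (E? y z →-dec E? x z))
      ×-dec all-dec (λ x → all-dec λ y → E? x y →-dec E? (neg x) (neg y))
      ×-dec all-dec (λ x → all-dec λ y → all-dec λ z → all-dec λ w →
        (pos x <? pos y) →-dec ((pos y <? pos z) →-dec ((pos z <? pos w) →-dec (E? x z →-dec (E? y w →-dec E? x y)))))
      ×-dec all-dec (λ x → all-dec λ y → E? x y →-dec (side x Fin.≟ side y)))
    where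
    E? : ∀ x y → Dec (⟦ c ⟧ x y)
    E? x y = lookup c _ Bool.≟ true

  good-resp : ∀ {E F} → E ⇔′ F → Good E → Good F
  good-resp {E} {F} e G = record
    { equiv = record { refl = fw E-refl ; sym = fw ∘ E-sym ∘ bk ; trans = λ a b → fw (E-trans (bk a) (bk b)) }
    ; dec = λ x y → map′ fw bk (dec x y)
    ; E-neg = fw ∘ E-neg ∘ bk
    ; noncrossing = λ a b c ac bd → fw (noncrossing a b c (bk ac) (bk bd))
    ; E-side = E-side ∘ bk }
    where
    open Good G
    fw : ∀ {x y} → E x y → F x y
    fw = ⇒to (e _ _)
    bk : ∀ {x y} → F x y → E x y
    bk = ⇒from (e _ _)

  merge-⇒ : ∀ {E F} → E ⇔′ F → ∀ x y → Merge E x y → Merge F x y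
  merge-⇒ e x y (inj₁ a)       = inj₁ (⇒to (e x y) a)
  merge-⇒ e x y (inj₂ (a , b)) = inj₂ (⇒to (e _ _) a , ⇒to (e _ _) b)

  merge-resp : ∀ {E F} → E ⇔′ F → Merge E ⇔′ Merge F
  merge-resp e x y = mk⇔ (merge-⇒ e x y) (merge-⇒ (⇔′-sym e) x y)

  cut-resp : ∀ {E F} → E ⇔′ F → ∀ s r → Cut E s r ⇔′ Cut F s r
  cut-resp e s r x y = mk⇔
    (λ (m , h) → merge-⇒ e x y m , h ∘ ⇒from (e _ _))
    (λ (m , h) → merge-⇒ (⇔′-sym e) x y m , h ∘ ⇒to (e _ _))

  model-dec : ∀ {π} → Model π → ∀ x y → Dec (π x y)
  model-dec (merge-model G e)     x y = map′ (⇒from (e x y)) (⇒to (e x y)) (GoodLemmas.merge-dec G x y)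
  model-dec (cut-model G _ s i e) x y = map′ (⇒from (e x y)) (⇒to (e x y)) (GoodLemmas.cut-dec G s (toℕ i) x y)

  abstract
    NCB-meet : ∀ {π ρ} → NCB n π → NCB n ρ → NCB n (π ∧P ρ)
    NCB-meet π∈ ρ∈ = model⇒NCB (model-meet (NCB⇒model π∈) (NCB⇒model ρ∈))

  -- Each side is closed under negation, so both are zero blocks and merging relates all points.
  top : Rel (X n) 0ℓ
  top = Merge SameSide

  top-NCB : NCB n top
  top-NCB = merge-NCB record
    { equiv = record { refl = refl ; sym = sym ; trans = trans }
    ; dec = λ x y → side x Fin.≟ side y
    ; E-neg = λ {x} {y} e → trans (side-neg x) (trans e (sym (side-neg y)))
    ; noncrossing = λ {a} {b} {c} {d} → sameSide-noncrossing {a} {b} {c} {d}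
    ; E-side = id }

  top-max : ∀ x y → top x y
  top-max x y = inj₂ (sym (side-neg x) , sym (side-neg y))

  module _ {π ρ : Partition n} (π? : ∀ x y → Dec (π x y)) (ρ? : ∀ x y → Dec (ρ x y)) where

    Upper : Partition n → Set
    Upper σ = π ≤P σ × ρ ≤P σ

    upper-dec : ∀ {σ} → (∀ x y → Dec (σ x y)) → Dec (Upper σ)
    upper-dec σ? = all-dec (λ x → all-dec λ y → π? x y →-dec σ? x y) ×-dec all-dec (λ x → all-dec λ y → ρ? x y →-dec σ? x y)

    upper-resp : ∀ {σ σ′} → σ ⇔′ σ′ → Upper σ → Upper σ′
    upper-resp e (a , b) = (λ x y → ⇒to (e x y) ∘ a x y) , (λ x y → ⇒to (e x y) ∘ b x y)

    Separated : X n → X n → Partition n → Set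
    Separated x y σ = Upper σ × ¬ σ x y

    separated-resp : ∀ {x y σ σ′} → σ ⇔′ σ′ → Separated x y σ → Separated x y σ′
    separated-resp e (u , ¬s) = upper-resp e u , ¬s ∘ ⇒from (e _ _)

    Witness : X n → X n → Subset (N * N) → Set
    Witness x y c = Σ[ G ∈ Good ⟦ c ⟧ ] (Separated x y (Merge ⟦ c ⟧) ⊎
      (⟦ c ⟧ (ι true) (ι false) × ∃[ z ] Separated x y (Cut ⟦ c ⟧ (proj₁ z) (idx z))))

    witness-dec : ∀ x y c → Dec (Witness x y c)
    witness-dec x y c with good? c
    ... | no ¬G = no (¬G ∘ proj₁)
    ... | yes G = map′ (G ,_) proj₂ (sep? merge-dec ⊎-dec (dec (ι true) (ι false) ×-dec any-dec (λ z → sep? (cut-dec (proj₁ z) (idx z)))))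
      where
      open Good G
      open GoodLemmas G
      sep? : ∀ {σ} → (∀ x y → Dec (σ x y)) → Dec (Separated x y σ)
      sep? σ? = upper-dec σ? ×-dec ¬? (σ? x y)

    model-witness : ∀ {x y σ} → Model σ → Separated x y σ → ∃[ c ] Witness x y c
    model-witness (merge-model G e) sep with encode (Good.dec G)
    ... | c , f = c , good-resp f G , inj₁ (separated-resp (⇔′-trans e (merge-resp f)) sep)
    model-witness (cut-model G zn s i e) sep with encode (Good.dec G)
    ... | c , f = c , good-resp f G , inj₂ (⇒to (f _ _) zn , (s , i) , separated-resp (⇔′-trans e (cut-resp f s (toℕ i))) sep)

    abstract
      -- Through the models, a search over permutations becomes one over matrices and cut points. If
      -- it fails, decidability of each model turns the absence of a separating bound into
      -- relatedness.
      separate : ∀ x y → (∃[ σ ] (NCB n σ × Separated x y σ)) ⊎ (∀ σ → NCB n σ → Upper σ → σ x y)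
      separate x y = decide (anySubset? (witness-dec x y))
        where
        decide : Dec (∃[ c ] Witness x y c) → (∃[ σ ] (NCB n σ × Separated x y σ)) ⊎ (∀ σ → NCB n σ → Upper σ → σ x y)
        decide (yes (c , G , inj₁ sep))            = inj₁ (_ , merge-NCB G , sep)
        decide (yes (c , G , inj₂ (zn , z , sep))) = inj₁ (_ , cut-NCB G zn (proj₁ z) (idx z) , sep)
        decide (no none) = inj₂ λ σ σ∈ u → let M = NCB⇒model σ∈ in
          decidable-stable (model-dec M x y) λ ¬s → none (model-witness M (u , ¬s))

    -- For the list of all pairs this makes `j` least. Each pair costs at most one meet, with an
    -- upper bound separating it, so upper bounds never have to be listed.
    Bound : List (X n × X n) → Partition n → Set₁
    Bound L j = NCB n j × Upper j × (∀ {x y} → (x , y) ∈ L → j x y → ∀ σ → NCB n σ → Upper σ → σ x y)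

    bound-cons : ∀ {x y L j} → Bound L j →
      (∃[ σ ] (NCB n σ × Separated x y σ)) ⊎ (∀ σ → NCB n σ → Upper σ → σ x y) → ∃[ j′ ] Bound ((x , y) ∷ L) j′
    bound-cons (j∈ , u , least) (inj₂ all) = _ , j∈ , u , λ { (here refl) _ → all ; (there m) → least m }
    bound-cons {j = j} (j∈ , u , least) (inj₁ (σ , σ∈ , v , ¬s)) =
      (j ∧P σ) , NCB-meet j∈ σ∈ ,
      ((λ x y a → proj₁ u x y a , proj₁ v x y a) , (λ x y a → proj₂ u x y a , proj₂ v x y a)) ,
      λ { (here refl) (_ , s) → contradiction s ¬s ; (there m) (a , _) → least m a }

    bound : (L : List (X n × X n)) → ∃[ j ] Bound L j
    bound []            = top , top-NCB , ((λ x y _ → top-max x y) , (λ x y _ → top-max x y)) , λ ()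
    bound ((x , y) ∷ L) = bound-cons (proj₂ (bound L)) (separate x y)

    join : Σ[ j ∈ Partition n ] IsJoinIn n π ρ j
    join = let j , j∈ , (a , b) , least = bound (cartesianProduct elements elements) in
      j , j∈ , a , b , λ σ σ∈ c d x y jxy →
      least (∈-cartesianProduct⁺ (∈-elements x) (∈-elements y)) jxy σ σ∈ (c , d)

theorem1p5 : (n : ℕ) → 2 ≤ n → (π ρ : Partition n) → NCB n π → NCB n ρ →
    IsMeetIn n π ρ (π ∧P ρ) × (Σ[ j ∈ Partition n ] IsJoinIn n π ρ j)
theorem1p5 (suc (suc q)) (s≤s (s≤s z≤n)) π ρ π∈ ρ∈ =
    (NCB-meet π∈ ρ∈ , (λ _ _ → proj₁) , (λ _ _ → proj₂) , λ σ _ a b x y s → a x y s , b x y s)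
  , join (model-dec (NCB⇒model π∈)) (model-dec (NCB⇒model ρ∈))
  where
  open Models q
  open Joins q
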